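{- There exists a sequence of positive integers $(L_r)_{r\ge1}$ such that the posets $P_r$ defined recursively by $P_0=C_2$ and, for $r\ge1$, $$R_r=C_{L_r}\oplus P_{r-1}\oplus C_{L_r},\qquad P_r=R_r\sqcup R_r,$$ satisfy, with $m_s=|R_s|$, for every $r\ge0$, $$\tau(P_r)<3,\qquad \operatorname{gap}(P_r)=\prod_{s=1}^r\frac{2m_s+1}{m_s+1}\ \ge\ (3/2)^r .$$
   Context: $C_k$ is the chain with $k$ elements. For posets $Q,R$ (on disjoint copies of their ground sets): the ordinal sum $Q\oplus R$ keeps the relations inside $Q$ and $R$ and makes every element of $Q$ less than every element of $R$; the parallel sum $Q\sqcup R$ keeps the relations inside $Q$ and $R$ and imposes no further relations. Repeated summands denote distinct isomorphic copies. A linear extension of a finite poset $P$ with $n$ elements is an order-preserving bijection $f:P\to\{1,\dots,n\}$, and $h_P(x)=\mathbb E[f(x)]$ for $f$ a uniformly random linear extension. If $s_1\le\cdots\le s_n$ are the values $h_P(x)$ listed with repetition, then $\operatorname{gap}(P)=\max\{s_1,s_2-s_1,\ldots,s_n-s_{n-1},n+1-s_n\}$. For a finite nonempty poset $P$ let $\boldsymbol\sigma_P$ be a uniformly random linear extension viewed as a total ordering of $P$, and for $\varnothing\ne X\subseteq P$ let $\boldsymbol\sigma_P|_X$ be the relative order it induces on $X$. With $H$ denoting Shannon entropy in bits (base-two logarithm), the hereditary entropy per point is $$\tau(P)=\max_{\varnothing\ne X\subseteq P}\frac{H(\boldsymbol\sigma_P|_X)}{|X|}.$$ Empty products equal $1$.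 -}

module Defs where

import Algebra.Definitions.RawSemiring as RawSemiringDefs
open import Data.Bool.Base using (true; false)
open import Data.Fin.Base as Fin using (Fin; toℕ; splitAt)
import Data.Fin.Properties as Fin
open import Data.Fin.Subset using (Subset; ∣_∣)
open import Data.Fin.Subset.Properties using (_∈?_; nonempty?)
open import Data.Integer.Base as ℤ using (+_; +[1+_])
import Data.Integer.Properties as ℤ
open import Data.List.Base using (List; []; _∷_; map; filter; foldr; length; concatMap; allFin; deduplicate; cartesianProductWith)
open import Data.List.NonEmpty using (List⁺; _∷⁺_; [_]; foldr₁)
import Data.List.Properties as List
import Data.List.Sort as Sort
open import Data.Nat.Base as ℕ using (ℕ; zero; suc; NonZero; ⌊_/2⌋)
open import Data.Nat.Induction using (<-wellFounded)
open import Data.Nat.ListAction using (sum)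
open import Data.Nat.Logarithm using (⌊log₂_⌋)
open import Data.Nat.Logarithm.Core using (⌊log2⌋)
import Data.Nat.Properties as ℕ
open import Data.Nat.Tactic.RingSolver using (solve-∀)
open import Data.Product.Base using (∃; _×_; _,_; proj₁; proj₂)
open import Data.Rational.Base as ℚ using (ℚ; mkℚ; 0ℚ; 1ℚ; ½; toℚᵘ)
import Data.Rational.Properties as ℚ
open import Data.Rational.Unnormalised.Base as ℚᵘ using (mkℚᵘ)
import Data.Rational.Unnormalised.Properties as ℚᵘ
open import Data.Sum.Base using (_⊎_; inj₁; inj₂)
open import Data.Sum.Relation.Binary.LeftOrder using (_⊎-<_; ⊎-<-isPartialOrder; ⊎-<-decidable)
open import Data.Sum.Relation.Binary.Pointwise using (Pointwise; Pointwise-≡⇒≡; ⊎-isPartialOrder; ⊎-decidable)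
open import Data.Vec.Base using (Vec; []; _∷_; lookup)
open import Function.Base using (_on_; _∘_)
open import Function.Definitions using (Bijective)
open import Induction.WellFounded using (Acc; acc)
open import Level using (0ℓ)
open import Relation.Binary.Core using (Rel)
open import Relation.Binary.Definitions using (Decidable; DecidableEquality)
open import Relation.Binary.PropositionalEquality using (_≡_; refl; sym; trans; cong; cong₂; subst; subst₂; isEquivalence)
open import Relation.Binary.Structures using (IsPartialOrder)
open import Relation.Nullary.Decidable using (Dec; map′; _×-dec_; _→-dec_)

-- a / b, with the junk value 0 when b = 0.
ratio : ℕ → ℕ → ℚ
ratio a zero    = 0ℚ
ratio a (suc b) = + a ℚ./ suc b

infixr 8 _^_
_^_ : ℚ → ℕ → ℚ
_^_ = RawSemiringDefs._^_ ℚ.+-*-rawSemiring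

∏< : ℕ → (ℕ → ℚ) → ℚ
∏< zero    f = 1ℚ
∏< (suc n) f = ∏< n f ℚ.* f n

record ℝ : Set where
  constructor mkℝ
  field
    seq    : ℕ → ℚ
    cauchy : ∀ ε → 0ℚ ℚ.< ε → ∃ λ N → ∀ m n → N ℕ.≤ m → N ℕ.≤ n →
             ℚ.∣ seq m ℚ.- seq n ∣ ℚ.≤ ε

open ℝ public

infix 4 _<ᴿ_
_<ᴿ_ : ℝ → ℝ → Set
x <ᴿ y = ∃ λ ε → 0ℚ ℚ.< ε × ∃ λ N → ∀ n → N ℕ.≤ n → seq x n ℚ.+ ε ℚ.≤ seq y n

private
  -- One-sided form of the Cauchy condition; m and n range symmetrically.
  Cauchy′ : (ℕ → ℚ) → Set
  Cauchy′ s = ∀ ε → 0ℚ ℚ.< ε → ∃ λ N → ∀ m n → N ℕ.≤ m → N ℕ.≤ n → s m ℚ.≤ s n ℚ.+ ε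

  b+[a-b]≡a : ∀ a b → b ℚ.+ (a ℚ.- b) ≡ a
  b+[a-b]≡a a b = trans (cong (b ℚ.+_) (ℚ.+-comm a (ℚ.- b)))
    (trans (sym (ℚ.+-assoc b (ℚ.- b) a))
    (trans (cong (ℚ._+ a) (ℚ.+-inverseʳ b)) (ℚ.+-identityˡ a)))

  [b+ε]-b≡ε : ∀ b ε → (b ℚ.+ ε) ℚ.- b ≡ ε
  [b+ε]-b≡ε b ε = trans (cong (ℚ._- b) (ℚ.+-comm b ε))
    (trans (ℚ.+-assoc ε b (ℚ.- b))
    (trans (cong (ε ℚ.+_) (ℚ.+-inverseʳ b)) (ℚ.+-identityʳ ε)))

  -[a-b]≡b-a : ∀ a b → ℚ.- (a ℚ.- b) ≡ b ℚ.- a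
  -[a-b]≡b-a a b = trans (ℚ.neg-distrib-+ a (ℚ.- b))
    (trans (cong (ℚ.- a ℚ.+_) (neg-involutive b)) (ℚ.+-comm (ℚ.- a) b))
    where
    neg-involutive : ∀ p → ℚ.- (ℚ.- p) ≡ p
    neg-involutive (mkℚ +[1+ n ] d c) = refl
    neg-involutive (mkℚ (+ zero) d c) = refl
    neg-involutive (mkℚ ℤ.-[1+ n ] d c) = refl

  a≤b+ε⇒a-b≤ε : ∀ {a b ε} → a ℚ.≤ b ℚ.+ ε → a ℚ.- b ℚ.≤ ε
  a≤b+ε⇒a-b≤ε {a} {b} {ε} le =
    subst (a ℚ.- b ℚ.≤_) ([b+ε]-b≡ε b ε) (ℚ.+-monoˡ-≤ (ℚ.- b) le)

  p≤∣p∣ : ∀ p → p ℚ.≤ ℚ.∣ p ∣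
  p≤∣p∣ p@(mkℚ (+ n) d c)    = ℚ.≤-refl
  p≤∣p∣ (mkℚ ℤ.-[1+ n ] d c) = ℚ.*≤* ℤ.-≤+

  ∣-∣-close : ∀ {a b ε} → a ℚ.≤ b ℚ.+ ε → b ℚ.≤ a ℚ.+ ε → ℚ.∣ a ℚ.- b ∣ ℚ.≤ ε
  ∣-∣-close {a} {b} {ε} p q with ℚ.∣p∣≡p∨∣p∣≡-p (a ℚ.- b)
  ... | inj₁ eq = subst (ℚ._≤ ε) (sym eq) (a≤b+ε⇒a-b≤ε p)
  ... | inj₂ eq = subst (ℚ._≤ ε) (sym (trans eq (-[a-b]≡b-a a b))) (a≤b+ε⇒a-b≤ε q)

  close-∣-∣ : ∀ {a b ε} → ℚ.∣ a ℚ.- b ∣ ℚ.≤ ε → a ℚ.≤ b ℚ.+ ε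
  close-∣-∣ {a} {b} {ε} p = subst (ℚ._≤ b ℚ.+ ε) (b+[a-b]≡a a b)
    (ℚ.+-monoʳ-≤ b (ℚ.≤-trans (p≤∣p∣ (a ℚ.- b)) p))

  mkℝ′ : (s : ℕ → ℚ) → Cauchy′ s → ℝ
  mkℝ′ s c = mkℝ s λ ε ε>0 → proj₁ (c ε ε>0) , λ m n N≤m N≤n →
    ∣-∣-close (proj₂ (c ε ε>0) m n N≤m N≤n) (proj₂ (c ε ε>0) n m N≤n N≤m)

  cauchy′ : (x : ℝ) → Cauchy′ (seq x)
  cauchy′ x ε ε>0 = proj₁ (cauchy x ε ε>0) , λ m n N≤m N≤n →
    close-∣-∣ (proj₂ (cauchy x ε ε>0) m n N≤m N≤n)

  ½ε>0 : ∀ {ε} → 0ℚ ℚ.< ε → 0ℚ ℚ.< ½ ℚ.* ε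
  ½ε>0 {ε} ε>0 = subst (ℚ._< ½ ℚ.* ε) (ℚ.*-zeroʳ ½) (ℚ.*-monoʳ-<-pos ½ ε>0)

  ½ε+½ε≡ε : ∀ ε → ½ ℚ.* ε ℚ.+ ½ ℚ.* ε ≡ ε
  ½ε+½ε≡ε ε = trans (sym (ℚ.*-distribʳ-+ ε ½ ½)) (ℚ.*-identityˡ ε)

  +-interchange : ∀ a b c d → (a ℚ.+ b) ℚ.+ (c ℚ.+ d) ≡ (a ℚ.+ c) ℚ.+ (b ℚ.+ d)
  +-interchange a b c d = trans (ℚ.+-assoc a b (c ℚ.+ d))
    (trans (cong (a ℚ.+_) (trans (sym (ℚ.+-assoc b c d))
      (trans (cong (ℚ._+ d) (ℚ.+-comm b c)) (ℚ.+-assoc c b d))))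
    (sym (ℚ.+-assoc a c (b ℚ.+ d))))

fromℚ : ℚ → ℝ
fromℚ q = mkℝ′ (λ _ → q) λ ε ε>0 → 0 , λ _ _ _ _ →
  subst (ℚ._≤ q ℚ.+ ε) (ℚ.+-identityʳ q) (ℚ.+-monoʳ-≤ q (ℚ.<⇒≤ ε>0))

0ᴿ : ℝ
0ᴿ = fromℚ 0ℚ

infixl 6 _+ᴿ_ _-ᴿ_
infixr 7 _·_
infixl 6 _⊔ᴿ_

_+ᴿ_ : ℝ → ℝ → ℝ
x +ᴿ y = mkℝ′ (λ n → seq x n ℚ.+ seq y n) go
  where
  go : Cauchy′ (λ n → seq x n ℚ.+ seq y n)
  go ε ε>0 with cauchy′ x (½ ℚ.* ε) (½ε>0 ε>0) | cauchy′ y (½ ℚ.* ε) (½ε>0 ε>0)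
  ... | M , p | N , q = M ℕ.⊔ N , λ m n ≤m ≤n →
    subst (seq x m ℚ.+ seq y m ℚ.≤_)
      (trans (+-interchange (seq x n) (½ ℚ.* ε) (seq y n) (½ ℚ.* ε))
             (cong ((seq x n ℚ.+ seq y n) ℚ.+_) (½ε+½ε≡ε ε)))
      (ℚ.+-mono-≤ (p m n (ℕ.m⊔n≤o⇒m≤o M N ≤m) (ℕ.m⊔n≤o⇒m≤o M N ≤n))
                  (q m n (ℕ.m⊔n≤o⇒n≤o M N ≤m) (ℕ.m⊔n≤o⇒n≤o M N ≤n)))

_·_ : ℚ → ℝ → ℝ
q · x = mkℝ (λ n → q ℚ.* seq x n) go
  where
  K : ℚ
  K = ℚ.∣ q ∣ ℚ.+ 1ℚ

  K>0 : 0ℚ ℚ.< K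
  K>0 = ℚ.+-mono-≤-< (ℚ.0≤∣p∣ q) (ℚ.positive⁻¹ 1ℚ)

  instance
    K-pos : ℚ.Positive K
    K-pos = ℚ.positive K>0

    K-nz : ℚ.NonZero K
    K-nz = ℚ.pos⇒nonZero K

  ∣q∣≤K : ℚ.∣ q ∣ ℚ.≤ K
  ∣q∣≤K = subst (ℚ._≤ K) (ℚ.+-identityʳ ℚ.∣ q ∣) (ℚ.+-monoʳ-≤ ℚ.∣ q ∣ (ℚ.<⇒≤ (ℚ.positive⁻¹ 1ℚ)))

  module _ (ε : ℚ) (ε>0 : 0ℚ ℚ.< ε) where
    δ : ℚ
    δ = (ℚ.1/ K) ℚ.* ε

    δ>0 : 0ℚ ℚ.< δ
    δ>0 = subst (ℚ._< δ) (ℚ.*-zeroʳ (ℚ.1/ K))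
      (ℚ.*-monoʳ-<-pos (ℚ.1/ K) {{ℚ.1/pos⇒pos K}} ε>0)

    Kδ≡ε : K ℚ.* δ ≡ ε
    Kδ≡ε = trans (sym (ℚ.*-assoc K (ℚ.1/ K) ε))
      (trans (cong (ℚ._* ε) (ℚ.*-inverseʳ K)) (ℚ.*-identityˡ ε))

  factor : ∀ a b → q ℚ.* a ℚ.- q ℚ.* b ≡ q ℚ.* (a ℚ.- b)
  factor a b = trans (cong (q ℚ.* a ℚ.+_) (ℚ.neg-distribʳ-* q b))
    (sym (ℚ.*-distribˡ-+ q a (ℚ.- b)))

  go : ∀ ε → 0ℚ ℚ.< ε → ∃ λ N → ∀ m n → N ℕ.≤ m → N ℕ.≤ n →
       ℚ.∣ q ℚ.* seq x m ℚ.- q ℚ.* seq x n ∣ ℚ.≤ ε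
  go ε ε>0 with cauchy x (δ ε ε>0) (δ>0 ε ε>0)
  ... | N , p = N , λ m n N≤m N≤n → let d = seq x m ℚ.- seq x n in
    subst₂ ℚ._≤_
      (sym (trans (cong ℚ.∣_∣ (factor (seq x m) (seq x n))) (ℚ.∣p*q∣≡∣p∣*∣q∣ q d)))
      (Kδ≡ε ε ε>0)
      (ℚ.≤-trans
        (ℚ.*-monoʳ-≤-nonNeg ℚ.∣ d ∣ {{ℚ.nonNegative (ℚ.0≤∣p∣ d)}} ∣q∣≤K)
        (ℚ.*-monoˡ-≤-nonNeg K {{ℚ.pos⇒nonNeg K}} (p m n N≤m N≤n)))

_-ᴿ_ : ℝ → ℝ → ℝ
x -ᴿ y = x +ᴿ (ℚ.- 1ℚ) · y

_⊔ᴿ_ : ℝ → ℝ → ℝ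
x ⊔ᴿ y = mkℝ′ (λ n → seq x n ℚ.⊔ seq y n) go
  where
  go : Cauchy′ (λ n → seq x n ℚ.⊔ seq y n)
  go ε ε>0 with cauchy′ x ε ε>0 | cauchy′ y ε ε>0
  ... | M , p | N , q = M ℕ.⊔ N , λ m n ≤m ≤n →
    ℚ.⊔-lub
      (ℚ.≤-trans (p m n (ℕ.m⊔n≤o⇒m≤o M N ≤m) (ℕ.m⊔n≤o⇒m≤o M N ≤n))
                 (ℚ.+-monoˡ-≤ ε (ℚ.p≤p⊔q (seq x n) (seq y n))))
      (ℚ.≤-trans (q m n (ℕ.m⊔n≤o⇒n≤o M N ≤m) (ℕ.m⊔n≤o⇒n≤o M N ≤n))
                 (ℚ.+-monoˡ-≤ ε (ℚ.p≤q⊔p (seq x n) (seq y n))))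

sumᴿ : List ℝ → ℝ
sumᴿ = foldr _+ᴿ_ 0ᴿ

2^⌊log₂n⌋≤n : ∀ n .{{_ : NonZero n}} → 2 ℕ.^ ⌊log₂ n ⌋ ℕ.≤ n
2^⌊log₂n⌋≤n n = go n (<-wellFounded n)
  where
  2⌊n/2⌋≤n : ∀ n → 2 ℕ.* ⌊ n /2⌋ ℕ.≤ n
  2⌊n/2⌋≤n zero          = ℕ.z≤n
  2⌊n/2⌋≤n (suc zero)    = ℕ.z≤n
  2⌊n/2⌋≤n (suc (suc n)) = subst (ℕ._≤ suc (suc n)) (sym (ℕ.*-suc 2 ⌊ n /2⌋))
    (ℕ.s≤s (ℕ.s≤s (2⌊n/2⌋≤n n)))

  go : ∀ n (a : Acc ℕ._<_ n) .{{_ : NonZero n}} → 2 ℕ.^ ⌊log2⌋ n a ℕ.≤ n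
  go 1             _        = ℕ.≤-refl
  go (suc (suc n)) (acc rs) = ℕ.≤-trans
    (ℕ.*-monoʳ-≤ 2 (go (suc ⌊ n /2⌋) (rs _))) (2⌊n/2⌋≤n (suc (suc n)))

n<2^[1+⌊log₂n⌋] : ∀ n → n ℕ.< 2 ℕ.^ suc ⌊log₂ n ⌋
n<2^[1+⌊log₂n⌋] n = go n (<-wellFounded n)
  where
  n≤1+2⌊n/2⌋ : ∀ n → n ℕ.≤ 1 ℕ.+ 2 ℕ.* ⌊ n /2⌋
  n≤1+2⌊n/2⌋ zero          = ℕ.z≤n
  n≤1+2⌊n/2⌋ (suc zero)    = ℕ.≤-refl
  n≤1+2⌊n/2⌋ (suc (suc n)) = subst (λ k → suc (suc n) ℕ.≤ suc k) (sym (ℕ.*-suc 2 ⌊ n /2⌋))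
    (ℕ.s≤s (ℕ.s≤s (n≤1+2⌊n/2⌋ n)))

  go : ∀ n (a : Acc ℕ._<_ n) → n ℕ.< 2 ℕ.^ suc (⌊log2⌋ n a)
  go 0             _        = ℕ.s≤s ℕ.z≤n
  go 1             _        = ℕ.≤-refl
  go (suc (suc n)) (acc rs) = ℕ.≤-trans
    (ℕ.s≤s (n≤1+2⌊n/2⌋ (suc (suc n))))
    (ℕ.≤-trans (ℕ.≤-reflexive (sym (ℕ.*-suc 2 (suc ⌊ n /2⌋))))
      (ℕ.*-monoʳ-≤ 2 (go (suc ⌊ n /2⌋) (rs _))))

private
  2^-cancel-< : ∀ a b → 2 ℕ.^ a ℕ.< 2 ℕ.^ b → a ℕ.< b
  2^-cancel-< a b lt = ℕ.≰⇒> λ b≤a → ℕ.<⇒≱ lt (ℕ.^-monoʳ-≤ 2 b≤a)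

-- With k = ⌊log₂ cⁿ⌋ we have 2ᵏ ≤ cⁿ < 2ᵏ⁺¹, so k/n ≤ log₂ c < (k+1)/n.
log₂ℕ : (c : ℕ) .{{_ : NonZero c}} → ℝ
log₂ℕ c = mkℝ′ s go
  where
  k : ℕ → ℕ
  k n = ⌊log₂ (c ℕ.^ suc n) ⌋

  s : ℕ → ℚ
  s n = + k n ℚ./ suc n

  compare : ∀ m n → k m ℕ.* suc n ℕ.≤ suc (k n) ℕ.* suc m
  compare m n = ℕ.<⇒≤ (2^-cancel-< _ _ (ℕ.≤-<-trans lower upper))
    where
    lower : 2 ℕ.^ (k m ℕ.* suc n) ℕ.≤ c ℕ.^ (suc m ℕ.* suc n)
    lower = subst₂ ℕ._≤_ (ℕ.^-*-assoc 2 (k m) (suc n)) (ℕ.^-*-assoc c (suc m) (suc n))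
      (ℕ.^-monoˡ-≤ (suc n) (2^⌊log₂n⌋≤n (c ℕ.^ suc m) {{ℕ.m^n≢0 c (suc m)}}))

    upper : c ℕ.^ (suc m ℕ.* suc n) ℕ.< 2 ℕ.^ (suc (k n) ℕ.* suc m)
    upper = subst₂ ℕ._<_
      (trans (ℕ.^-*-assoc c (suc n) (suc m)) (cong (c ℕ.^_) (ℕ.*-comm (suc n) (suc m))))
      (ℕ.^-*-assoc 2 (suc (k n)) (suc m))
      (ℕ.^-monoˡ-< (suc m) (n<2^[1+⌊log₂n⌋] (c ℕ.^ suc n)))

  bound : ∀ m n a b → b ℕ.≤ n →
    k m ℕ.* (suc n ℕ.* suc b) ℕ.≤ (k n ℕ.* suc b ℕ.+ suc a ℕ.* suc n) ℕ.* suc m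
  bound m n a b b≤n = begin
    k m ℕ.* (suc n ℕ.* suc b)                         ≡⟨ sym (ℕ.*-assoc (k m) (suc n) (suc b)) ⟩
    k m ℕ.* suc n ℕ.* suc b                           ≤⟨ ℕ.*-monoˡ-≤ (suc b) (compare m n) ⟩
    suc (k n) ℕ.* suc m ℕ.* suc b                     ≡⟨ rearrange (k n) (suc m) (suc b) ⟩
    (k n ℕ.* suc b ℕ.+ suc b) ℕ.* suc m               ≤⟨ ℕ.*-monoˡ-≤ (suc m) (ℕ.+-monoʳ-≤ (k n ℕ.* suc b)
                                                          (ℕ.≤-trans (ℕ.s≤s b≤n) (ℕ.m≤m+n (suc n) (a ℕ.* suc n)))) ⟩
    (k n ℕ.* suc b ℕ.+ suc a ℕ.* suc n) ℕ.* suc m     ∎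
    where
    open ℕ.≤-Reasoning
    rearrange : ∀ x y z → suc x ℕ.* y ℕ.* z ≡ (x ℕ.* z ℕ.+ z) ℕ.* y
    rearrange = solve-∀

  go : Cauchy′ s
  go (mkℚ ℤ.-[1+ a ] b c) (ℚ.*<* ())
  go (mkℚ (+ zero) b c) (ℚ.*<* (ℤ.+<+ ()))
  go ε@(mkℚ +[1+ a ] b cop) ε>0 = b , λ m n _ b≤n → ℚ.toℚᵘ-cancel-≤ (begin
    toℚᵘ (s m)                      ≃⟨ ℚ.toℚᵘ-fromℚᵘ (mkℚᵘ (+ k m) m) ⟩
    mkℚᵘ (+ k m) m                  ≤⟨ ℚᵘ.*≤* (subst₂ ℤ._≤_
                                         (ℤ.pos-* (k m) (suc n ℕ.* suc b))
                                         (trans (ℤ.pos-* (k n ℕ.* suc b ℕ.+ suc a ℕ.* suc n) (suc m))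
                                           (cong (ℤ._* + suc m) (cong₂ ℤ._+_ (ℤ.pos-* (k n) (suc b)) (ℤ.pos-* (suc a) (suc n)))))
                                         (ℤ.+≤+ (bound m n a b b≤n))) ⟩
    mkℚᵘ (+ k n) n ℚᵘ.+ toℚᵘ ε      ≃⟨ ℚᵘ.+-congˡ (toℚᵘ ε) (ℚᵘ.≃-sym (ℚ.toℚᵘ-fromℚᵘ (mkℚᵘ (+ k n) n))) ⟩
    toℚᵘ (s n) ℚᵘ.+ toℚᵘ ε          ≃⟨ ℚᵘ.≃-sym (ℚ.toℚᵘ-homo-+ (s n) ε) ⟩
    toℚᵘ (s n ℚ.+ ε)                ∎)
    where open ℚᵘ.≤-Reasoning

-- log₂ (a / b) = log₂ a - log₂ b; the junk value at q ≤ 0 is 0.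
log₂ : ℚ → ℝ
log₂ (mkℚ +[1+ a ] b-1 _) = log₂ℕ (suc a) -ᴿ log₂ℕ (suc b-1)
log₂ (mkℚ (+ zero) _ _)   = 0ᴿ
log₂ (mkℚ ℤ.-[1+ _ ] _ _) = 0ᴿ

record FinPoset : Set₁ where
  infix 4 _⊑_ _⊑?_
  field
    size           : ℕ
    _⊑_            : Rel (Fin size) 0ℓ
    isPartialOrder : IsPartialOrder _≡_ _⊑_
    _⊑?_           : Decidable _⊑_

open FinPoset using (size) public

Chain : ℕ → FinPoset
Chain k = record
  { size           = k
  ; _⊑_            = Fin._≤_
  ; isPartialOrder = Fin.≤-isPartialOrder
  ; _⊑?_           = Fin._≤?_
  }

private
  splitAt-isPartialOrder : ∀ {m n} {_≲_ : Rel (Fin m ⊎ Fin n) 0ℓ} →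
    IsPartialOrder (Pointwise _≡_ _≡_) _≲_ → IsPartialOrder _≡_ (_≲_ on splitAt m)
  splitAt-isPartialOrder {m} {n} po = record
    { isPreorder = record
      { isEquivalence = isEquivalence
      ; reflexive     = λ { refl → PO.refl }
      ; trans         = PO.trans
      }
    ; antisym = λ {x} {y} p q → trans (sym (Fin.join-splitAt m n x))
        (trans (cong (Fin.join m n) (Pointwise-≡⇒≡ (PO.antisym p q))) (Fin.join-splitAt m n y))
    }
    where module PO = IsPartialOrder po

-- In both sums the first summand occupies the first `size Q` indices of
-- Fin (size Q + size R), the second summand the remaining ones.

infixr 6 _⊕_
_⊕_ : FinPoset → FinPoset → FinPoset
Q ⊕ R = record
  { size           = size Q ℕ.+ size R
  ; _⊑_            = (Q._⊑_ ⊎-< R._⊑_) on splitAt (size Q)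
  ; isPartialOrder = splitAt-isPartialOrder (⊎-<-isPartialOrder Q.isPartialOrder R.isPartialOrder)
  ; _⊑?_           = λ x y → ⊎-<-decidable Q._⊑?_ R._⊑?_ (splitAt (size Q) x) (splitAt (size Q) y)
  }
  where
  module Q = FinPoset Q
  module R = FinPoset R

infixr 5 _⊔ᴾ_
_⊔ᴾ_ : FinPoset → FinPoset → FinPoset
Q ⊔ᴾ R = record
  { size           = size Q ℕ.+ size R
  ; _⊑_            = Pointwise Q._⊑_ R._⊑_ on splitAt (size Q)
  ; isPartialOrder = splitAt-isPartialOrder (⊎-isPartialOrder Q.isPartialOrder R.isPartialOrder)
  ; _⊑?_           = λ x y → ⊎-decidable Q._⊑?_ R._⊑?_ (splitAt (size Q) x) (splitAt (size Q) y)
  }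
  where
  module Q = FinPoset Q
  module R = FinPoset R

allVecs : ∀ {A : Set} → List A → ∀ n → List (Vec A n)
allVecs xs zero    = [] ∷ []
allVecs xs (suc n) = cartesianProductWith _∷_ xs (allVecs xs n)

module _ (P : FinPoset) where
  open FinPoset P hiding (size)

  -- A map f : P → {1,…,n} is stored as its table of values, with
  -- i : Fin n standing for the position 1 + toℕ i.
  Labelling : Set
  Labelling = Vec (Fin (size P)) (size P)

  IsLinearExtension : Labelling → Set
  IsLinearExtension f =
    Bijective _≡_ _≡_ (lookup f) × (∀ x y → x ⊑ y → lookup f x Fin.≤ lookup f y)

  isLinearExtension? : ∀ f → Dec (IsLinearExtension f)
  isLinearExtension? f = (injective? ×-dec surjective?) ×-dec
    Fin.all? λ x → Fin.all? λ y → (x ⊑? y) →-dec (lookup f x Fin.≤? lookup f y)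
    where
    injective? = map′ (λ h {x} {y} → h x y) (λ h x y → h {x} {y})
      (Fin.all? λ x → Fin.all? λ y → (lookup f x Fin.≟ lookup f y) →-dec (x Fin.≟ y))
    surjective? = Fin.all? λ y → map′
      (λ (x , e) → x , λ { refl → e }) (λ (x , e) → x , e refl)
      (Fin.any? λ x → lookup f x Fin.≟ y)

  linearExtensions : List Labelling
  linearExtensions = filter isLinearExtension? (allVecs (allFin (size P)) (size P))

  position : Labelling → Fin (size P) → ℕ
  position f x = suc (toℕ (lookup f x))

  h : Fin (size P) → ℚ
  h x = ratio (sum (map (λ f → position f x) linearExtensions)) (length linearExtensions)

  -- f viewed as a total ordering: the elements of P in order of position.
  ordering : Labelling → List (Fin (size P))
  ordering f = concatMap (λ i → filter (λ x → lookup f x Fin.≟ i) (allFin (size P))) (allFin (size P))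

  restrict : Subset (size P) → List (Fin (size P)) → List (Fin (size P))
  restrict X = filter (_∈? X)

open Sort ℚ.≤-decTotalOrder using (sort)

-- s₁ - a, s₂ - s₁, …, b - sₙ
spacings : ℚ → List ℚ → ℚ → List⁺ ℚ
spacings a []       b = [ b ℚ.- a ]
spacings a (s ∷ ss) b = (s ℚ.- a) ∷⁺ spacings s ss b

gap : FinPoset → ℚ
gap P = foldr₁ ℚ._⊔_
  (spacings 0ℚ (sort (map (h P) (allFin (size P)))) (+ suc (size P) ℚ./ 1))

-- Shannon entropy -∑ p log₂ p of a uniformly random entry of a list;
-- the sum ranges over the distinct values, each of positive probability.
entropy : ∀ {A : Set} → DecidableEquality A → List A → ℝ
entropy {A} _≟_ xs = sumᴿ (map term (deduplicate _≟_ xs))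
  where
  prob : A → ℚ
  prob a = ratio (length (filter (a ≟_) xs)) (length xs)

  term : A → ℝ
  term a = (ℚ.- prob a) · log₂ (prob a)

nonemptySubsets : ∀ n → List (Subset n)
nonemptySubsets n = filter nonempty? (allVecs (true ∷ false ∷ []) n)

-- Entropies are nonnegative, so for nonempty P starting the maximum at 0
-- does not change it.
τ : FinPoset → ℝ
τ P = foldr _⊔ᴿ_ 0ᴿ (map perPoint (nonemptySubsets (size P)))
  where
  H : Subset (size P) → ℝ
  H X = entropy (List.≡-dec Fin._≟_) (map (restrict P X ∘ ordering P) (linearExtensions P))

  perPoint : Subset (size P) → ℝ
  perPoint X = ratio 1 ∣ X ∣ · H X

-- L r is used only for r ≥ 1, and R₁₊ L i is R_r for r = 1 + i.
mutual
  P : (ℕ → ℕ) → ℕ → FinPoset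
  P L zero    = Chain 2
  P L (suc r) = R₁₊ L r ⊔ᴾ R₁₊ L r

  R₁₊ : (ℕ → ℕ) → ℕ → FinPoset
  R₁₊ L r = Chain (L (suc r)) ⊕ P L r ⊕ Chain (L (suc r))

m₁₊ : (ℕ → ℕ) → ℕ → ℕ
m₁₊ L i = size (R₁₊ L i)

{-# OPTIONS --safe #-}
module Submission where

-- A linear extension of Q ⊔ Q (Q of size m) is a pair of linear extensions of Q together with a
-- shuffle, that is, a lattice path from (0,0) to (m,m).  The i-th element of one copy has average
-- position i (2m+1)/(m+1), and an ordinal sum with chains only shifts positions and adds gaps 1;
-- hence the gap is multiplied by (2m+1)/(m+1) at each level.
--
-- For the entropy, H(σ|X) is at most the average length of a prefix code for the restricted
-- orderings (Gibbs' inequality).  Given codes for the two copies of P_{r-1}, it remains to encode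
-- the interleaving of the two halves of X.  When the chains are long, a given lattice point near
-- the centre is visited with small probability; so, as long as X has not many more points in the
-- chains than in the copies of P_{r-1}, each copy typically lies in a single gap of the rest of X
-- and behaves like one point.  One flag bit tells whether this happens; otherwise the interleaving
-- is written out in full.  The average code length is then at most (3 − 2^(-r)) |X| − 2.

open import Data.Bool.Base using (Bool; true; false; if_then_else_; not; _∧_; T)
open import Data.Empty using (⊥; ⊥-elim)
open import Data.Fin.Base as Fin using (Fin; zero; suc; toℕ; splitAt; join; _↑ˡ_; _↑ʳ_)
import Data.Fin.Properties as Fin
open import Data.Fin.Subset using (Subset; ∣_∣; Nonempty)
open import Data.Fin.Subset.Properties using (_∈?_; nonempty?)
open import Data.Integer.Base as ℤ using (+_)
import Data.Integer.Properties as ℤ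
open import Data.List.Base hiding (sum; product; splitAt; lookup; merge)
open import Data.List.Membership.Propositional using (_∈_; _∉_)
import Data.List.Membership.Propositional.Properties as ∈
import Data.List.Membership.Propositional.Properties.WithK as ∈
open import Data.List.NonEmpty.Base using (foldr₁)
open import Data.List.Properties as List hiding (sum-++; length-filter)
open import Data.List.Relation.Binary.BagAndSetEquality using (∼bag⇒↭)
open import Data.List.Relation.Binary.Equality.Propositional using (≋⇒≡)
open import Data.List.Relation.Binary.Permutation.Propositional as ↭ using (_↭_; ↭-refl; ↭-trans)
import Data.List.Relation.Binary.Permutation.Propositional.Properties as ↭
open import Data.List.Relation.Unary.All as All using (All; []; _∷_)
import Data.List.Relation.Unary.All.Properties as All
open import Data.List.Relation.Unary.AllPairs as AllPairs using (AllPairs; []; _∷_)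
import Data.List.Relation.Unary.AllPairs.Properties as AllPairs
open import Data.List.Relation.Unary.Any using (here; there)
open import Data.List.Relation.Unary.Linked using (Linked; []; [-]; _∷_)
open import Data.List.Relation.Unary.Sorted.TotalOrder.Properties using (↗↭↗⇒≋)
import Data.List.Relation.Unary.Unique.DecPropositional.Properties as DecUnique
open import Data.List.Relation.Unary.Unique.Propositional using (Unique)
import Data.List.Relation.Unary.Unique.Propositional.Properties as Unique
import Data.List.Sort as Sort
open import Data.Maybe.Base using (Maybe; just; nothing; is-just)
open import Data.Nat.Base as ℕ using (ℕ; zero; suc; _+_; _*_; _∸_; _≤_; _<_; z≤n; s≤s; NonZero; _!)
import Data.Nat.DivMod as DivMod
import Data.Nat.Divisibility as Divisibility
open import Data.Nat.ListAction using (sum; product)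
open import Data.Nat.ListAction.Properties using (sum-++; sum-↭)
open import Data.Nat.Logarithm using (⌊log₂_⌋)
import Data.Nat.Properties as ℕ
open import Data.Nat.Tactic.RingSolver using (solve-∀)
open import Data.Product.Base using (∃; ∃₂; _×_; _,_; proj₁; proj₂)
open import Data.Rational.Base as ℚ using (ℚ; mkℚ; _/_; _≥_; 0ℚ; 1ℚ; toℚᵘ)
import Data.Rational.Properties as ℚ
open import Data.Rational.Solver using (module +-*-Solver)
open import Data.Rational.Unnormalised.Base as ℚᵘ using (mkℚᵘ)
import Data.Rational.Unnormalised.Properties as ℚᵘ
open import Data.Sum.Base using (_⊎_; inj₁; inj₂)
open import Data.Sum.Relation.Binary.LeftOrder using (_⊎-<_; ₁∼₂; ₁∼₁; ₂∼₂)
open import Data.Sum.Relation.Binary.Pointwise using (Pointwise)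
open import Data.Vec.Base as Vec using (Vec; []; _∷_)
import Data.Vec.Properties as Vec
open import Function.Base using (_∘_; id)
open import Function.Bundles using (mk⇔)
open import Function.Definitions using (Injective)
open import Relation.Binary.Bundles using (DecTotalOrder)
open import Relation.Binary.Definitions using (DecidableEquality)
open import Relation.Binary.PropositionalEquality using (_≡_; _≢_; refl; sym; trans; cong; cong₂; subst; subst₂; module ≡-Reasoning)
open import Relation.Binary.Structures using (IsPartialOrder)
open import Relation.Nullary.Decidable using (Dec; yes; no; does)
open import Relation.Nullary.Negation using (¬_)
open import Defs

-- With p = 2^r, the form (3 - 1/p)|X| - 2 is what lets the induction close. Each copy met by X
-- contributes -2. A flagged interleaving of two copies with `a` chain points has `a + 2` cold
-- marks, so flag and bits cost at most `a + 2`, and -2 - 2 + 2 restores the -2. The term |X|/p is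
-- halved at each level; the half given up pays for the rare words written out in full. For one
-- point at r = 0 the bound reads (3 - 1) - 2 = 0, which fixes the 3.
--
-- The obstacle is the order of choice: ℓ precedes X, so X may contain a multiple of ℓ chain points,
-- while a lattice point is visited with probability only about ℓ^(-1/2). Hence the flag is used
-- only if |X| is at most three times the number of its points in the copies, a bound free of ℓ;
-- otherwise the chain points alone leave room for one bit per point.
--
-- Codes instead of conditional entropies keep the induction in the natural numbers. Logarithms
-- enter once, through Gibbs' inequality, and the -2 also absorbs their rounding error in every
-- approximant.

variable
  A C A′ C′ : Set

-- Sums over lists

∑ : List A → (A → ℕ) → ℕ
∑ xs f = sum (map f xs)

∑-++ : ∀ (xs ys : List A) (f : A → ℕ) → ∑ (xs ++ ys) f ≡ ∑ xs f + ∑ ys f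
∑-++ xs ys f = trans (cong sum (map-++ f xs ys)) (sum-++ (map f xs) (map f ys))

∑-map : ∀ (g : A → C) (xs : List A) (f : C → ℕ) → ∑ (map g xs) f ≡ ∑ xs (f ∘ g)
∑-map g xs f = cong sum (sym (map-∘ xs))

∑-cong-∈ : ∀ (xs : List A) {f g : A → ℕ} → (∀ x → x ∈ xs → f x ≡ g x) → ∑ xs f ≡ ∑ xs g
∑-cong-∈ []       eq = refl
∑-cong-∈ (x ∷ xs) eq = cong₂ _+_ (eq x (here refl)) (∑-cong-∈ xs λ y y∈ → eq y (there y∈))

∑-cong : ∀ (xs : List A) {f g : A → ℕ} → (∀ x → f x ≡ g x) → ∑ xs f ≡ ∑ xs g
∑-cong xs eq = ∑-cong-∈ xs λ x _ → eq x

∑-mono-∈ : ∀ (xs : List A) {f g : A → ℕ} → (∀ x → x ∈ xs → f x ≤ g x) → ∑ xs f ≤ ∑ xs g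
∑-mono-∈ []       le = z≤n
∑-mono-∈ (x ∷ xs) le = ℕ.+-mono-≤ (le x (here refl)) (∑-mono-∈ xs λ y y∈ → le y (there y∈))

∑-const : ∀ (xs : List A) c → ∑ xs (λ _ → c) ≡ length xs * c
∑-const []       c = refl
∑-const (x ∷ xs) c = cong (c ℕ.+_) (∑-const xs c)

∑-0 : ∀ (xs : List A) → ∑ xs (λ _ → 0) ≡ 0
∑-0 xs = trans (∑-const xs 0) (ℕ.*-zeroʳ (length xs))

∑-1 : ∀ (xs : List A) → ∑ xs (λ _ → 1) ≡ length xs
∑-1 xs = trans (∑-const xs 1) (ℕ.*-identityʳ (length xs))

∑-+ : ∀ (xs : List A) (f g : A → ℕ) → ∑ xs (λ x → f x + g x) ≡ ∑ xs f + ∑ xs g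
∑-+ []       f g = refl
∑-+ (x ∷ xs) f g = trans (cong (f x + g x ℕ.+_) (∑-+ xs f g)) (lemma (f x) (g x) _ _)
  where
  lemma : ∀ a b c d → a + b + (c + d) ≡ a + c + (b + d)
  lemma = solve-∀

∑-*ˡ : ∀ (xs : List A) c (f : A → ℕ) → ∑ xs (λ x → c * f x) ≡ c * ∑ xs f
∑-*ˡ []       c f = sym (ℕ.*-zeroʳ c)
∑-*ˡ (x ∷ xs) c f = trans (cong (c * f x ℕ.+_) (∑-*ˡ xs c f)) (sym (ℕ.*-distribˡ-+ c (f x) _))

∑-*ʳ : ∀ (xs : List A) c (f : A → ℕ) → ∑ xs (λ x → f x * c) ≡ ∑ xs f * c
∑-*ʳ xs c f = trans (∑-cong xs λ x → ℕ.*-comm (f x) c) (trans (∑-*ˡ xs c f) (ℕ.*-comm c _))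

∑-swap : ∀ (xs : List A) (ys : List C) (f : A → C → ℕ) →
  ∑ xs (λ x → ∑ ys (f x)) ≡ ∑ ys (λ y → ∑ xs λ x → f x y)
∑-swap []       ys f = sym (∑-0 ys)
∑-swap (x ∷ xs) ys f = trans (cong (∑ ys (f x) ℕ.+_) (∑-swap xs ys f))
  (sym (∑-+ ys (f x) λ y → ∑ xs λ x → f x y))

∑-cartesianProductWith : ∀ {D : Set} (g : A → C → D) xs ys (f : D → ℕ) →
  ∑ (cartesianProductWith g xs ys) f ≡ ∑ xs λ x → ∑ ys λ y → f (g x y)
∑-cartesianProductWith g []       ys f = refl
∑-cartesianProductWith g (x ∷ xs) ys f = trans (∑-++ (map (g x) ys) _ f)
  (cong₂ _+_ (∑-map (g x) ys f) (∑-cartesianProductWith g xs ys f))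

∑-↭ : ∀ {xs ys : List A} (f : A → ℕ) → xs ↭ ys → ∑ xs f ≡ ∑ ys f
∑-↭ f p = sum-↭ (↭.map⁺ f p)

term≤∑ : ∀ {xs : List A} (f : A → ℕ) {x} → x ∈ xs → f x ≤ ∑ xs f
term≤∑ f (here refl) = ℕ.m≤m+n _ _
term≤∑ f (there x∈)  = ℕ.≤-trans (term≤∑ f x∈) (ℕ.m≤n+m _ _)

𝟙 : Bool → ℕ
𝟙 b = if b then 1 else 0

∑-𝟙≤1 : ∀ {xs : List A} (p : A → Bool) → Unique xs →
  (∀ {x y} → x ∈ xs → y ∈ xs → T (p x) → T (p y) → x ≡ y) → ∑ xs (𝟙 ∘ p) ≤ 1
∑-𝟙≤1 {xs = []} p u one = z≤n
∑-𝟙≤1 {xs = x ∷ xs} p (x∉ ∷ u) one with p x in eq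
... | false = ∑-𝟙≤1 p u λ a b → one (there a) (there b)
... | true  = ℕ.≤-reflexive (cong suc (trans (∑-cong-∈ xs {g = λ _ → 0} zeros) (∑-0 xs)))
  where
  zeros : ∀ y → y ∈ xs → 𝟙 (p y) ≡ 0
  zeros y y∈ with p y in eq′
  ... | false = refl
  ... | true  = ⊥-elim (All.lookup x∉ y∈
                  (one (here refl) (there y∈) (subst T (sym eq) _) (subst T (sym eq′) _)))

length-filter : ∀ {p} {P : A → Set p} (P? : ∀ x → Dec (P x)) xs →
  length (filter P? xs) ≡ ∑ xs (λ x → 𝟙 (does (P? x)))
length-filter P? []       = refl
length-filter P? (x ∷ xs) with does (P? x)
... | false = length-filter P? xs
... | true  = cong suc (length-filter P? xs)

-- AM–GM, Kraft's and Gibbs' inequalities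

[m*n]^k : ∀ m n k → (m * n) ℕ.^ k ≡ m ℕ.^ k * n ℕ.^ k
[m*n]^k m n zero    = refl
[m*n]^k m n (suc k) = trans (cong (m * n *_) ([m*n]^k m n k)) (lemma m n (m ℕ.^ k) (n ℕ.^ k))
  where
  lemma : ∀ a b c d → a * b * (c * d) ≡ a * c * (b * d)
  lemma = solve-∀

-- Two-valued AM–GM; the induction replaces x by x + y − z, which keeps the mean z
-- and increases the product since (z − y)(x − z) = (n + 1)(z − y)² ≥ 0.
yⁿx≤zⁿ⁺¹ : ∀ n x y z → n * y + x ≡ suc n * z → y ℕ.^ n * x ≤ z ℕ.^ suc n
yⁿx≤zⁿ⁺¹ zero x y z eq = ℕ.≤-reflexive (trans (ℕ.+-identityʳ x)
    (trans eq (trans (ℕ.+-identityʳ z) (sym (ℕ.*-identityʳ z)))))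
yⁿx≤zⁿ⁺¹ (suc n) x y z eq = begin
  y * y ℕ.^ n * x ≡⟨ rotate y (y ℕ.^ n) x ⟩
  y ℕ.^ n * (y * x) ≤⟨ ℕ.*-monoʳ-≤ (y ℕ.^ n) (proj₂ (proj₂ replace)) ⟩
  y ℕ.^ n * (z * x′) ≡⟨ rotate z (y ℕ.^ n) x′ ⟨
  z * y ℕ.^ n * x′ ≡⟨ ℕ.*-assoc z (y ℕ.^ n) x′ ⟩
  z * (y ℕ.^ n * x′) ≤⟨ ℕ.*-monoʳ-≤ z (yⁿx≤zⁿ⁺¹ n x′ y z (proj₁ (proj₂ replace))) ⟩
  z * z ℕ.^ suc n ∎
  where
  open ℕ.≤-Reasoning

  rotate : ∀ a b c → a * b * c ≡ b * (a * c)
  rotate = solve-∀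

  -- The cases `y = z + d` and `z = y + d` avoid subtraction. Here the mean condition forces x ≤ z;
  -- in `below` it determines x outright.
  above : ∀ n x z d → suc n * (z + d) + x ≡ suc (suc n) * z →
    n * (z + d) + (x + d) ≡ suc n * z × (z + d) * x ≤ z * (x + d)
  above n x z d eq = ℕ.+-cancelʳ-≡ z _ _ (trans (l₁ n x z d) (trans eq (l₂ n z))) , (begin
    (z + d) * x ≡⟨ l₃ z d x ⟩
    z * x + x * d ≤⟨ ℕ.+-monoʳ-≤ (z * x) (ℕ.*-monoˡ-≤ d x≤z) ⟩
    z * x + z * d ≡⟨ ℕ.*-distribˡ-+ z x d ⟨
    z * (x + d) ∎)
    where
    l₁ : ∀ n x z d → n * (z + d) + (x + d) + z ≡ suc n * (z + d) + x
    l₁ = solve-∀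
    l₂ : ∀ n z → suc (suc n) * z ≡ suc n * z + z
    l₂ = solve-∀
    l₃ : ∀ z d x → (z + d) * x ≡ z * x + x * d
    l₃ = solve-∀
    l₄ : ∀ n x z d → suc n * z + (suc n * d + x) ≡ suc n * (z + d) + x
    l₄ = solve-∀
    x≤z : x ≤ z
    x≤z = ℕ.≤-trans (ℕ.m≤n+m x (suc n * d))
      (ℕ.≤-reflexive (ℕ.+-cancelˡ-≡ (suc n * z) _ _ (trans (l₄ n x z d) (trans eq (l₂ n z)))))

  below : ∀ n x y d → suc n * y + x ≡ suc (suc n) * (y + d) →
    let x′ = y + suc n * d in n * y + x′ ≡ suc n * (y + d) × y * x ≤ (y + d) * x′
  below n x y d eq = l₁ n y d , (begin
    y * x ≡⟨ cong (y *_) x≡ ⟩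
    y * (y + suc n * d + d) ≤⟨ ℕ.m≤m+n _ (suc n * (d * d)) ⟩
    y * (y + suc n * d + d) + suc n * (d * d) ≡⟨ l₃ n y d ⟩
    (y + d) * (y + suc n * d) ∎)
    where
    l₁ : ∀ n y d → n * y + (y + suc n * d) ≡ suc n * (y + d)
    l₁ = solve-∀
    l₂ : ∀ n y d → suc (suc n) * (y + d) ≡ suc n * y + (y + suc n * d + d)
    l₂ = solve-∀
    l₃ : ∀ n y d → y * (y + suc n * d + d) + suc n * (d * d) ≡ (y + d) * (y + suc n * d)
    l₃ = solve-∀
    x≡ : x ≡ y + suc n * d + d
    x≡ = ℕ.+-cancelˡ-≡ (suc n * y) _ _ (trans eq (l₂ n y d))

  replace : ∃ λ x′ → n * y + x′ ≡ suc n * z × y * x ≤ z * x′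
  replace with ℕ.≤-total z y
  ... | inj₁ z≤y with d , refl ← ℕ.m≤n⇒∃[o]m+o≡n z≤y = _ , above n x z d eq
  ... | inj₂ y≤z with d , refl ← ℕ.m≤n⇒∃[o]m+o≡n y≤z = _ , below n x y d eq

  x′ = proj₁ replace

-- The two-valued case is applied to n copies of the mean of the tail and to the new entry,
-- everything multiplied by n (n + 1) so that all means are natural numbers.
AM–GM : ∀ xs → length xs ℕ.^ length xs * product xs ≤ sum xs ℕ.^ length xs
AM–GM []       = ℕ.≤-refl
AM–GM (x ∷ []) = ℕ.≤-reflexive (lemma x)
  where
  lemma : ∀ x → 1 * (x * 1) ≡ (x + 0) * 1
  lemma = solve-∀
AM–GM (x ∷ xs@(_ ∷ xs′)) = ℕ.*-cancelˡ-≤ (n ℕ.^ suc n) {{ℕ.m^n≢0 n (suc n)}} (begin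
  n ℕ.^ suc n * (suc n ℕ.^ suc n * (x * p)) ≡⟨ l₁ n (n ℕ.^ n) (suc n ℕ.^ suc n) x p ⟩
  suc n ℕ.^ suc n * (n * x) * (n ℕ.^ n * p) ≤⟨ ℕ.*-monoʳ-≤ (suc n ℕ.^ suc n * (n * x)) (AM–GM xs) ⟩
  suc n ℕ.^ suc n * (n * x) * s ℕ.^ n ≡⟨ l₂ (suc n) (suc n ℕ.^ n) (n * x) (s ℕ.^ n) ⟩
  suc n ℕ.^ n * s ℕ.^ n * (suc n * (n * x)) ≡⟨ cong (_* (suc n * (n * x))) ([m*n]^k (suc n) s n) ⟨
  (suc n * s) ℕ.^ n * (suc n * (n * x)) ≤⟨ yⁿx≤zⁿ⁺¹ n (suc n * (n * x)) (suc n * s) (n * (x + s)) (l₃ n x s) ⟩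
  (n * (x + s)) ℕ.^ suc n ≡⟨ [m*n]^k n (x + s) (suc n) ⟩
  n ℕ.^ suc n * (x + s) ℕ.^ suc n ∎)
  where
  open ℕ.≤-Reasoning
  n = length xs
  p = product xs
  s = sum xs
  l₁ : ∀ n a b x p → n * a * (b * (x * p)) ≡ b * (n * x) * (a * p)
  l₁ = solve-∀
  l₂ : ∀ a b c d → a * b * c * d ≡ b * d * (a * c)
  l₂ = solve-∀
  l₃ : ∀ n x s → n * (suc n * s) + suc n * (n * x) ≡ suc n * (n * (x + s))
  l₃ = solve-∀

words : ℕ → List (List Bool)
words zero    = [ [] ]
words (suc K) = map (true ∷_) (words K) ++ map (false ∷_) (words K)

prefixOf : List Bool → List Bool → Bool
prefixOf []          z           = true
prefixOf (x ∷ u)     []          = false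
prefixOf (true ∷ u)  (true ∷ z)  = prefixOf u z
prefixOf (false ∷ u) (false ∷ z) = prefixOf u z
prefixOf (_ ∷ u)     (_ ∷ z)     = false

prefixOf-sound : ∀ u z → T (prefixOf u z) → ∃ λ s → u ++ s ≡ z
prefixOf-sound []          z           _ = z , refl
prefixOf-sound (true ∷ u)  (true ∷ z)  p with s , refl ← prefixOf-sound u z p = s , refl
prefixOf-sound (false ∷ u) (false ∷ z) p with s , refl ← prefixOf-sound u z p = s , refl

length-words : ∀ K → length (words K) ≡ 2 ℕ.^ K
length-words zero    = refl
length-words (suc K) = trans (length-++ (map (true ∷_) (words K)))
  (cong₂ _+_ (trans (length-map _ (words K)) (length-words K))
             (trans (trans (length-map _ (words K)) (length-words K)) (sym (ℕ.+-identityʳ _))))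

∑-prefixOf : ∀ u K → length u ≤ K → ∑ (words K) (𝟙 ∘ prefixOf u) ≡ 2 ℕ.^ (K ∸ length u)
∑-prefixOf []          K       _        = trans (∑-1 (words K)) (length-words K)
∑-prefixOf (true ∷ u)  (suc K) (s≤s le) = trans (∑-++ (map (true ∷_) (words K)) _ _)
  (trans (cong₂ _+_ (trans (∑-map _ (words K) _) (∑-prefixOf u K le))
                    (trans (∑-map _ (words K) _) (∑-0 (words K)))) (ℕ.+-identityʳ _))
∑-prefixOf (false ∷ u) (suc K) (s≤s le) = trans (∑-++ (map (true ∷_) (words K)) _ _)
  (cong₂ _+_ (trans (∑-map _ (words K) _) (∑-0 (words K)))
             (trans (∑-map _ (words K) _) (∑-prefixOf u K le)))

-- One of two words is a prefix of the other exactly if they have a common extension; the suffixes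
-- `s` and `t` produce that extension.
PrefixFree : (A → List Bool) → List A → Set
PrefixFree enc xs = ∀ {x y} → x ∈ xs → y ∈ xs → ∀ s t → enc x ++ s ≡ enc y ++ t → x ≡ y

-- Each word of length K extends at most one codeword.
kraft : ∀ (enc : A → List Bool) {vs} K → Unique vs → PrefixFree enc vs →
  (∀ v → v ∈ vs → length (enc v) ≤ K) → ∑ vs (λ v → 2 ℕ.^ (K ∸ length (enc v))) ≤ 2 ℕ.^ K
kraft enc {vs} K u pf le = begin
  ∑ vs (λ v → 2 ℕ.^ (K ∸ length (enc v))) ≡⟨ ∑-cong-∈ vs
      (λ v v∈ → sym (∑-prefixOf (enc v) K (le v v∈))) ⟩
  ∑ vs (λ v → ∑ (words K) (𝟙 ∘ prefixOf (enc v))) ≡⟨ ∑-swap vs (words K) _ ⟩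
  ∑ (words K) (λ z → ∑ vs λ v → 𝟙 (prefixOf (enc v) z)) ≤⟨ ∑-mono-∈ (words K) (λ z _ → ∑-𝟙≤1 _ u (one z)) ⟩
  ∑ (words K) (λ _ → 1) ≡⟨ ∑-1 (words K) ⟩
  length (words K) ≡⟨ length-words K ⟩
  2 ℕ.^ K ∎
  where
  open ℕ.≤-Reasoning
  one : ∀ z {x y} → x ∈ vs → y ∈ vs → T (prefixOf (enc x) z) → T (prefixOf (enc y) z) → x ≡ y
  one z {x} {y} x∈ y∈ p q with s , eq ← prefixOf-sound (enc x) z p | t , eq′ ← prefixOf-sound (enc y) z q =
    pf x∈ y∈ s t (trans eq (sym eq′))

∏ : List A → (A → ℕ) → ℕ
∏ xs f = product (map f xs)

∏-cong-∈ : ∀ (xs : List A) {f g : A → ℕ} → (∀ x → x ∈ xs → f x ≡ g x) → ∏ xs f ≡ ∏ xs g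
∏-cong-∈ []       eq = refl
∏-cong-∈ (x ∷ xs) eq = cong₂ _*_ (eq x (here refl)) (∏-cong-∈ xs λ y y∈ → eq y (there y∈))

∏-mono-∈ : ∀ (xs : List A) {f g : A → ℕ} → (∀ x → x ∈ xs → f x ≤ g x) → ∏ xs f ≤ ∏ xs g
∏-mono-∈ []       le = ℕ.≤-refl
∏-mono-∈ (x ∷ xs) le = ℕ.*-mono-≤ (le x (here refl)) (∏-mono-∈ xs λ y y∈ → le y (there y∈))

∏-* : ∀ (xs : List A) (f g : A → ℕ) → ∏ xs (λ x → f x * g x) ≡ ∏ xs f * ∏ xs g
∏-* []       f g = refl
∏-* (x ∷ xs) f g = trans (cong (f x * g x *_) (∏-* xs f g)) (lemma (f x) (g x) _ _)
  where
  lemma : ∀ a b c d → a * b * (c * d) ≡ a * c * (b * d)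
  lemma = solve-∀

∏-const : ∀ (xs : List A) c → ∏ xs (λ _ → c) ≡ c ℕ.^ length xs
∏-const []       c = refl
∏-const (x ∷ xs) c = cong (c *_) (∏-const xs c)

∏-^ : ∀ (xs : List A) (f : A → ℕ) k → ∏ xs (λ x → f x ℕ.^ k) ≡ ∏ xs f ℕ.^ k
∏-^ []       f k = sym (ℕ.^-zeroˡ k)
∏-^ (x ∷ xs) f k = trans (cong (f x ℕ.^ k *_) (∏-^ xs f k)) (sym ([m*n]^k (f x) _ k))

∏-2^ : ∀ (xs : List A) (f : A → ℕ) → ∏ xs (λ x → 2 ℕ.^ f x) ≡ 2 ℕ.^ ∑ xs f
∏-2^ []       f = refl
∏-2^ (x ∷ xs) f = trans (cong (2 ℕ.^ f x *_) (∏-2^ xs f)) (sym (ℕ.^-distribˡ-+-* 2 (f x) _))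

∏-pos : ∀ (xs : List A) (f : A → ℕ) → (∀ x → x ∈ xs → 0 < f x) → 0 < ∏ xs f
∏-pos []       f pos = s≤s z≤n
∏-pos (x ∷ xs) f pos = ℕ.*-mono-< (pos x (here refl)) (∏-pos xs f λ y y∈ → pos y (there y∈))

-- Gibbs' inequality for the empirical distribution of a list

module Samples (_≟_ : DecidableEquality A) (xs : List A) where

  n : ℕ
  n = length xs

  distinct : List A
  distinct = deduplicate _≟_ xs

  count : A → ℕ
  count v = length (filter (v ≟_) xs)

  count≡∑ : ∀ v → count v ≡ ∑ xs (λ x → 𝟙 (does (v ≟ x)))
  count≡∑ v = length-filter (v ≟_) xs

  ∑-𝟙-distinct : ∀ {x} → x ∈ xs → ∑ distinct (λ v → 𝟙 (does (v ≟ x))) ≡ 1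
  ∑-𝟙-distinct {x} x∈ = ℕ.≤-antisym
    (∑-𝟙≤1 (λ v → does (v ≟ x)) (Dedup.deduplicate-! xs) same)
    (ℕ.≤-trans (ℕ.≤-reflexive (sym x≟x)) (term≤∑ (λ v → 𝟙 (does (v ≟ x))) (∈.∈-deduplicate⁺ _≟_ x∈)))
    where
    module Dedup = DecUnique _≟_
    same : ∀ {v w} → v ∈ distinct → w ∈ distinct → T (does (v ≟ x)) → T (does (w ≟ x)) → v ≡ w
    same {v} {w} _ _ p q with v ≟ x | w ≟ x
    ... | yes refl | yes refl = refl
    x≟x : 𝟙 (does (x ≟ x)) ≡ 1
    x≟x with x ≟ x
    ... | yes _   = refl
    ... | no x≢x = ⊥-elim (x≢x refl)

  -- Passes between sums over samples, in which code costs are measured, and sums over distinct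
  -- values, in which the entropy and the Kraft sum are expressed.
  ∑-distinct : ∀ f → ∑ distinct (λ v → count v * f v) ≡ ∑ xs f
  ∑-distinct f = begin
    ∑ distinct (λ v → count v * f v) ≡⟨ ∑-cong distinct (λ v → cong (_* f v) (count≡∑ v)) ⟩
    ∑ distinct (λ v → ∑ xs (λ x → 𝟙 (does (v ≟ x))) * f v) ≡⟨ ∑-cong distinct (λ v → sym (∑-*ʳ xs (f v) _)) ⟩
    ∑ distinct (λ v → ∑ xs λ x → 𝟙 (does (v ≟ x)) * f v) ≡⟨ ∑-swap distinct xs _ ⟩
    ∑ xs (λ x → ∑ distinct λ v → 𝟙 (does (v ≟ x)) * f v) ≡⟨ ∑-cong xs (λ x → ∑-cong distinct λ v → same v x) ⟩
    ∑ xs (λ x → ∑ distinct λ v → 𝟙 (does (v ≟ x)) * f x) ≡⟨ ∑-cong xs (λ x → ∑-*ʳ distinct (f x) _) ⟩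
    ∑ xs (λ x → ∑ distinct (λ v → 𝟙 (does (v ≟ x))) * f x)
      ≡⟨ ∑-cong-∈ xs (λ x x∈ → trans (cong (_* f x) (∑-𝟙-distinct x∈)) (ℕ.*-identityˡ (f x))) ⟩
    ∑ xs f ∎
    where
    open ≡-Reasoning
    same : ∀ v x → 𝟙 (does (v ≟ x)) * f v ≡ 𝟙 (does (v ≟ x)) * f x
    same v x with v ≟ x
    ... | yes refl = refl
    ... | no  _    = refl

  count-pos : ∀ {x} → x ∈ xs → 0 < count x
  count-pos {x} x∈ = ∈.∈-length (∈.∈-filter⁺ (x ≟_) x∈ refl)

  count≤n : ∀ v → count v ≤ n
  count≤n v = List.length-filter (v ≟_) xs

  module Gibbs (enc : A → List Bool) (pf : PrefixFree enc xs) where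

    len : A → ℕ
    len = length ∘ enc

    -- AM–GM for the numbers n! · 2^(K − len x) / count x, whose sum over the samples x is
    -- n! times the Kraft sum.
    gibbs : n ℕ.^ n ≤ ∏ xs count * 2 ℕ.^ ∑ xs len
    gibbs = ℕ.*-cancelʳ-≤ _ _ (Z ℕ.^ n) {{ℕ.m^n≢0 Z n {{Z≢0}}}} (begin
      n ℕ.^ n * Z ℕ.^ n ≡⟨ cong (n ℕ.^ n *_) (sym Πy) ⟩
      n ℕ.^ n * (∏ xs y * (∏ xs count * S)) ≡⟨ ℕ.*-assoc (n ℕ.^ n) (∏ xs y) _ ⟨
      n ℕ.^ n * ∏ xs y * (∏ xs count * S) ≤⟨ ℕ.*-monoˡ-≤ (∏ xs count * S) amgm ⟩
      Z ℕ.^ n * (∏ xs count * S) ≡⟨ ℕ.*-comm (Z ℕ.^ n) _ ⟩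
      ∏ xs count * S * Z ℕ.^ n ∎)
      where
      open ℕ.≤-Reasoning
      -- Any common bound for the codeword lengths serves as `K`.
      K = ∑ xs len
      S = 2 ℕ.^ ∑ xs len
      Z = n ! * 2 ℕ.^ K
      Z≢0 : NonZero Z
      Z≢0 = ℕ.m*n≢0 (n !) (2 ℕ.^ K) {{n ℕ.!≢0}} {{ℕ.m^n≢0 2 K}}

      -- All counts lie between 1 and n, so they divide `n !` and the numbers fed into AM-GM are
      -- integers.
      quot : ℕ → ℕ
      quot zero      = 0
      quot c@(suc _) = n ! ℕ./ c

      c*quot : ∀ {c} → 0 < c → c ≤ n → c * quot c ≡ n !
      c*quot {suc c} _ c≤n = DivMod.m*[n/m]≡n
          (Divisibility.∣-trans (Divisibility.m∣m*n (c !)) (Divisibility.m≤n⇒m!∣n! c≤n))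

      w y : A → ℕ
      w x = 2 ℕ.^ (K ∸ len x)
      y x = quot (count x) * w x

      len≤K : ∀ x → x ∈ xs → len x ≤ K
      len≤K x x∈ = term≤∑ len x∈

      count*y : ∀ x → x ∈ xs → count x * y x ≡ n ! * w x
      count*y x x∈ = trans (sym (ℕ.*-assoc (count x) (quot (count x)) (w x)))
        (cong (_* w x) (c*quot (count-pos x∈) (count≤n x)))

      ∈xs : ∀ {v} → v ∈ distinct → v ∈ xs
      ∈xs = ∈.∈-deduplicate⁻ _≟_ xs

      ∑y≤Z : ∑ xs y ≤ Z
      ∑y≤Z = begin
        ∑ xs y ≡⟨ ∑-distinct y ⟨
        ∑ distinct (λ v → count v * y v)
          ≡⟨ ∑-cong-∈ distinct (λ v v∈ → count*y v (∈xs v∈)) ⟩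
        ∑ distinct (λ v → n ! * w v) ≡⟨ ∑-*ˡ distinct (n !) w ⟩
        n ! * ∑ distinct w
          ≤⟨ ℕ.*-monoʳ-≤ (n !) (kraft enc K (DecUnique.deduplicate-! _≟_ xs) (λ v∈ w∈ → pf (∈xs v∈) (∈xs w∈))
              λ v v∈ → len≤K v (∈xs v∈)) ⟩
        Z ∎

      amgm : n ℕ.^ n * ∏ xs y ≤ Z ℕ.^ n
      amgm = ℕ.≤-trans (subst (λ k → k ℕ.^ k * ∏ xs y ≤ ∑ xs y ℕ.^ k) (length-map y xs) (AM–GM (map y xs)))
        (ℕ.^-monoˡ-≤ n ∑y≤Z)

      factor : ∀ x → x ∈ xs → y x * (count x * 2 ℕ.^ len x) ≡ Z
      factor x x∈ = begin-equality
        y x * (count x * 2 ℕ.^ len x) ≡⟨ lemma (y x) (count x) (2 ℕ.^ len x) ⟩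
        count x * y x * 2 ℕ.^ len x ≡⟨ cong (_* 2 ℕ.^ len x) (count*y x x∈) ⟩
        n ! * w x * 2 ℕ.^ len x ≡⟨ ℕ.*-assoc (n !) (w x) _ ⟩
        n ! * (w x * 2 ℕ.^ len x) ≡⟨ cong (n ! *_) (ℕ.^-distribˡ-+-* 2 (K ∸ len x) (len x)) ⟨
        n ! * 2 ℕ.^ (K ∸ len x + len x) ≡⟨ cong (λ k → n ! * 2 ℕ.^ k) (ℕ.m∸n+n≡m (len≤K x x∈)) ⟩
        Z ∎
        where
        lemma : ∀ a b c → a * (b * c) ≡ b * a * c
        lemma = solve-∀

      Πy : ∏ xs y * (∏ xs count * S) ≡ Z ℕ.^ n
      Πy = begin-equality
        ∏ xs y * (∏ xs count * S) ≡⟨ cong (λ s → ∏ xs y * (∏ xs count * s)) (∏-2^ xs len) ⟨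
        ∏ xs y * (∏ xs count * ∏ xs (λ x → 2 ℕ.^ len x)) ≡⟨ cong (∏ xs y *_) (∏-* xs count _) ⟨
        ∏ xs y * ∏ xs (λ x → count x * 2 ℕ.^ len x) ≡⟨ ∏-* xs y _ ⟨
        ∏ xs (λ x → y x * (count x * 2 ℕ.^ len x)) ≡⟨ ∏-cong-∈ xs factor ⟩
        ∏ xs (λ _ → Z) ≡⟨ ∏-const xs Z ⟩
        Z ℕ.^ n ∎

    -- If k₊ x / N and k₋ x / N approximate the logarithms of the denominator and the numerator
    -- of the probability count x / n, then ∑ (k₊ − k₋) / (n N) approximates the entropy.
    rounded-entropy-bound : ∀ N (k₊ k₋ : A → ℕ) →
      (∀ x → x ∈ xs → 2 ℕ.^ k₊ x * count x ℕ.^ N ≤ n ℕ.^ N * 2 ℕ.^ suc (k₋ x)) →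
      ∑ xs k₊ ≤ N * ∑ xs len + n + ∑ xs k₋
    rounded-entropy-bound N k₊ k₋ approx = 2^-cancel-≤
        (ℕ.*-cancelʳ-≤ _ _ (c ℕ.^ N) {{ℕ.m^n≢0 c N {{ℕ.>-nonZero (∏-pos xs count λ _ → count-pos)}}}} (begin
      2 ℕ.^ ∑ xs k₊ * c ℕ.^ N ≡⟨ cong₂ _*_ (∏-2^ xs k₊) (∏-^ xs count N) ⟨
      ∏ xs (λ x → 2 ℕ.^ k₊ x) * ∏ xs (λ x → count x ℕ.^ N) ≡⟨ ∏-* xs _ _ ⟨
      ∏ xs (λ x → 2 ℕ.^ k₊ x * count x ℕ.^ N) ≤⟨ ∏-mono-∈ xs approx ⟩
      ∏ xs (λ x → n ℕ.^ N * 2 ℕ.^ suc (k₋ x)) ≡⟨ ∏-* xs _ _ ⟩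
      ∏ xs (λ _ → n ℕ.^ N) * ∏ xs (λ x → 2 ℕ.^ suc (k₋ x))
        ≡⟨ cong₂ _*_ (∏-const xs (n ℕ.^ N)) (∏-2^ xs (suc ∘ k₋)) ⟩
      (n ℕ.^ N) ℕ.^ n * 2 ℕ.^ ∑ xs (suc ∘ k₋)
        ≡⟨ cong₂ (λ a b → a * 2 ℕ.^ b) exchange (trans (∑-+ xs (λ _ → 1) k₋) (cong (_+ ∑ xs k₋) (∑-1 xs))) ⟩
      (n ℕ.^ n) ℕ.^ N * 2 ℕ.^ (n + ∑ xs k₋) ≤⟨ ℕ.*-monoˡ-≤ (2 ℕ.^ (n + ∑ xs k₋))
          (ℕ.^-monoˡ-≤ N gibbs) ⟩
      (c * 2 ℕ.^ ∑ xs len) ℕ.^ N * 2 ℕ.^ (n + ∑ xs k₋) ≡⟨ cong (_* 2 ℕ.^ (n + ∑ xs k₋)) ([m*n]^k c _ N) ⟩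
      c ℕ.^ N * (2 ℕ.^ ∑ xs len) ℕ.^ N * 2 ℕ.^ (n + ∑ xs k₋)
        ≡⟨ cong (λ k → c ℕ.^ N * k * 2 ℕ.^ (n + ∑ xs k₋))
            (trans (ℕ.^-*-assoc 2 (∑ xs len) N) (cong (2 ℕ.^_) (ℕ.*-comm _ N))) ⟩
      c ℕ.^ N * 2 ℕ.^ (N * ∑ xs len) * 2 ℕ.^ (n + ∑ xs k₋) ≡⟨ lemma (c ℕ.^ N) (2 ℕ.^ (N * ∑ xs len)) _ ⟩
      2 ℕ.^ (N * ∑ xs len) * 2 ℕ.^ (n + ∑ xs k₋) * c ℕ.^ N
        ≡⟨ cong (_* c ℕ.^ N) (ℕ.^-distribˡ-+-* 2 (N * ∑ xs len) _) ⟨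
      2 ℕ.^ (N * ∑ xs len + (n + ∑ xs k₋)) * c ℕ.^ N
        ≡⟨ cong (λ k → 2 ℕ.^ k * c ℕ.^ N) (ℕ.+-assoc (N * ∑ xs len) n _) ⟨
      2 ℕ.^ (N * ∑ xs len + n + ∑ xs k₋) * c ℕ.^ N ∎))
      where
      open ℕ.≤-Reasoning
      c = ∏ xs count
      exchange : (n ℕ.^ N) ℕ.^ n ≡ (n ℕ.^ n) ℕ.^ N
      exchange = trans (ℕ.^-*-assoc n N n) (trans (cong (n ℕ.^_) (ℕ.*-comm N n)) (sym (ℕ.^-*-assoc n n N)))
      lemma : ∀ a b c → a * b * c ≡ b * c * a
      lemma = solve-∀
      2^-cancel-≤ : ∀ {a b} → 2 ℕ.^ a ≤ 2 ℕ.^ b → a ≤ b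
      2^-cancel-≤ le = ℕ.≮⇒≥ λ b<a → ℕ.<⇒≱ (ℕ.^-monoʳ-< 2 (s≤s (s≤s z≤n)) b<a) le

-- Rational arithmetic and the entropy bound

ι : ℕ → ℚ
ι n = + n / 1

toℚᵘ-/ : ∀ i d → toℚᵘ (i / suc d) ℚᵘ.≃ mkℚᵘ i d
toℚᵘ-/ i d = ℚ.toℚᵘ-fromℚᵘ (mkℚᵘ i d)

ι-+ : ∀ m n → ι (m + n) ≡ ι m ℚ.+ ι n
ι-+ m n = ℚ.toℚᵘ-injective (begin
  toℚᵘ (ι (m + n)) ≈⟨ toℚᵘ-/ (+ (m + n)) 0 ⟩
  mkℚᵘ (+ (m + n)) 0
    ≈⟨ ℚᵘ.*≡* (cong (ℤ._* + 1) (cong₂ ℤ._+_ (sym (ℤ.*-identityʳ (+ m))) (sym (ℤ.*-identityʳ (+ n))))) ⟩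
  mkℚᵘ (+ m) 0 ℚᵘ.+ mkℚᵘ (+ n) 0 ≈⟨ ℚᵘ.+-cong (toℚᵘ-/ (+ m) 0) (toℚᵘ-/ (+ n) 0) ⟨
  toℚᵘ (ι m) ℚᵘ.+ toℚᵘ (ι n) ≈⟨ ℚ.toℚᵘ-homo-+ (ι m) (ι n) ⟨
  toℚᵘ (ι m ℚ.+ ι n) ∎)
  where open ℚᵘ.≃-Reasoning

/-* : ∀ a b c d → (+ a / suc b) ℚ.* (+ c / suc d) ≡ + (a * c) / suc (d + b * suc d)
/-* a b c d = ℚ.toℚᵘ-injective (begin
  toℚᵘ ((+ a / suc b) ℚ.* (+ c / suc d)) ≈⟨ ℚ.toℚᵘ-homo-* (+ a / suc b) (+ c / suc d) ⟩
  toℚᵘ (+ a / suc b) ℚᵘ.* toℚᵘ (+ c / suc d) ≈⟨ ℚᵘ.*-cong (toℚᵘ-/ (+ a) b) (toℚᵘ-/ (+ c) d) ⟩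
  mkℚᵘ (+ a) b ℚᵘ.* mkℚᵘ (+ c) d ≈⟨ ℚᵘ.*≡* (cong (ℤ._* + (suc b * suc d)) (sym (ℤ.pos-* a c))) ⟩
  mkℚᵘ (+ (a * c)) (d + b * suc d) ≈⟨ toℚᵘ-/ (+ (a * c)) (d + b * suc d) ⟨
  toℚᵘ (+ (a * c) / suc (d + b * suc d)) ∎)
  where open ℚᵘ.≃-Reasoning

/-≡ : ∀ a b c d → a * suc d ≡ c * suc b → + a / suc b ≡ + c / suc d
/-≡ a b c d eq = ℚ.fromℚᵘ-cong {mkℚᵘ (+ a) b} {mkℚᵘ (+ c) d}
  (ℚᵘ.*≡* (trans (sym (ℤ.pos-* a (suc d))) (trans (cong +_ eq) (ℤ.pos-* c (suc b)))))

/-≤ : ∀ a b c d → a * suc d ≤ c * suc b → + a / suc b ℚ.≤ + c / suc d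
/-≤ a b c d le = ℚ.toℚᵘ-cancel-≤ (ℚᵘ.≤-respˡ-≃ (ℚᵘ.≃-sym (toℚᵘ-/ (+ a) b)) (ℚᵘ.≤-respʳ-≃ (ℚᵘ.≃-sym (toℚᵘ-/ (+ c) d))
  (ℚᵘ.*≤* (subst₂ ℤ._≤_ (ℤ.pos-* a (suc d)) (ℤ.pos-* c (suc b)) (ℤ.+≤+ le)))))

ι-* : ∀ m n → ι (m * n) ≡ ι m ℚ.* ι n
ι-* m n = sym (/-* m 0 n 0)

/-*-ι : ∀ a b → (+ a / suc b) ℚ.* ι (suc b) ≡ ι a
/-*-ι a b = trans (/-* a b (suc b) 0) (/-≡ (a * suc b) (0 + b * 1) a 0
  (trans (ℕ.*-identityʳ _) (cong (λ k → a * suc k) (sym (ℕ.*-identityʳ b)))))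

ι-mono-≤ : ∀ {m n} → m ≤ n → ι m ℚ.≤ ι n
ι-mono-≤ {m} {n} le = /-≤ m 0 n 0 (ℕ.*-monoˡ-≤ 1 le)

ι-pos : ∀ n .{{_ : NonZero n}} → ℚ.Positive (ι n)
ι-pos n@(suc _) = ℚ.normalize-pos n 1

ℚ-+-cancelʳ-≤ : ∀ r {p q} → p ℚ.+ r ℚ.≤ q ℚ.+ r → p ℚ.≤ q
ℚ-+-cancelʳ-≤ r {p} {q} le = subst₂ ℚ._≤_ (lemma p) (lemma q) (ℚ.+-monoˡ-≤ (ℚ.- r) le)
  where
  lemma : ∀ p → p ℚ.+ r ℚ.+ (ℚ.- r) ≡ p
  lemma p = trans (ℚ.+-assoc p r (ℚ.- r)) (trans (cong (p ℚ.+_) (ℚ.+-inverseʳ r)) (ℚ.+-identityʳ p))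

-- For q > 0 the n-th approximant of `log₂ q` is (k₋ - k₊) / (n + 1). The denominator carries the
-- plus sign because entropy is a sum of terms -q log₂ q.
k₊ k₋ : ℕ → ℚ → ℕ
k₊ n q = ⌊log₂ (ℚ.↧ₙ q ℕ.^ suc n) ⌋
k₋ n q = ⌊log₂ (ℤ.∣ ℚ.↥ q ∣ ℕ.^ suc n) ⌋

-- Reducing c / t to lowest terms a / b changes the integers under the logarithms, but only a t = c
-- b is used. The first component is the hypothesis of `rounded-entropy-bound`; the second clears
-- denominators in -q log₂ q and moves the negative part across, so that only images of naturals
-- remain.
log₂-ratio : ∀ n c t q → 0 < c → 0 < t → q ≡ ratio c t →
  (2 ℕ.^ k₊ n q * c ℕ.^ suc n ≤ t ℕ.^ suc n * 2 ℕ.^ suc (k₋ n q)) ×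
  ((ℚ.- q) ℚ.* seq (log₂ q) n) ℚ.* (ι t ℚ.* ι (suc n)) ℚ.+ ι (c * k₋ n q) ≡ ι (c * k₊ n q)
log₂-ratio n c (suc t) q c>0 _ q≡ = go q q≡ (subst (λ q → toℚᵘ q ℚᵘ.≃ mkℚᵘ (+ c) t) (sym q≡) (toℚᵘ-/ (+ c) t))
  where
  N = suc n
  open +-*-Solver
  -- Splitting on the normal form of `q` makes `log₂` compute; the nonpositive forms contradict q =
  -- c / t > 0.
  go : ∀ q → q ≡ ratio c (suc t) → toℚᵘ q ℚᵘ.≃ mkℚᵘ (+ c) t →
    (2 ℕ.^ k₊ n q * c ℕ.^ N ≤ suc t ℕ.^ N * 2 ℕ.^ suc (k₋ n q)) ×
    ((ℚ.- q) ℚ.* seq (log₂ q) n) ℚ.* (ι (suc t) ℚ.* ι N) ℚ.+ ι (c * k₋ n q) ≡ ι (c * k₊ n q)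
  go (mkℚ (+ zero) b _) _ (ℚᵘ.*≡* eq) = ⊥-elim (ℕ.<⇒≢ (ℕ.*-mono-< c>0 (s≤s (z≤n {b})))
    (ℤ.+-injective (trans eq (sym (ℤ.pos-* c (suc b))))))
  go (mkℚ ℤ.-[1+ a ] b _) _ (ℚᵘ.*≡* eq) with () ← trans eq (sym (ℤ.pos-* c (suc b)))
  go q@(mkℚ (+ suc a) b _) q≡ (ℚᵘ.*≡* eq) = bound , identity
    where
    ka = k₋ n q
    kb = k₊ n q
    a*t≡c*b : suc a * suc t ≡ c * suc b
    a*t≡c*b = ℤ.+-injective (trans (ℤ.pos-* (suc a) (suc t)) (trans eq (sym (ℤ.pos-* c (suc b)))))

    bound : 2 ℕ.^ kb * c ℕ.^ N ≤ suc t ℕ.^ N * 2 ℕ.^ suc ka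
    bound = begin
      2 ℕ.^ kb * c ℕ.^ N ≤⟨ ℕ.*-monoˡ-≤ (c ℕ.^ N) (2^⌊log₂n⌋≤n (suc b ℕ.^ N) {{ℕ.m^n≢0 (suc b) N}}) ⟩
      suc b ℕ.^ N * c ℕ.^ N ≡⟨ [m*n]^k (suc b) c N ⟨
      (suc b * c) ℕ.^ N
        ≡⟨ cong (ℕ._^ N) (trans (ℕ.*-comm (suc b) c) (trans (sym a*t≡c*b) (ℕ.*-comm (suc a) (suc t)))) ⟩
      (suc t * suc a) ℕ.^ N ≡⟨ [m*n]^k (suc t) (suc a) N ⟩
      suc t ℕ.^ N * suc a ℕ.^ N ≤⟨ ℕ.*-monoʳ-≤ (suc t ℕ.^ N) (ℕ.<⇒≤ (n<2^[1+⌊log₂n⌋] (suc a ℕ.^ N))) ⟩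
      suc t ℕ.^ N * 2 ℕ.^ suc ka ∎
      where open ℕ.≤-Reasoning

    sa sb : ℚ
    sa = + ka / N
    sb = + kb / N

    rearrange : ∀ q s s′ x y w → ((ℚ.- q) ℚ.* (s ℚ.+ (ℚ.- 1ℚ) ℚ.* s′)) ℚ.* (x ℚ.* y) ℚ.+ w ≡
      (q ℚ.* x) ℚ.* (s′ ℚ.* y) ℚ.+ (ℚ.- ((q ℚ.* x) ℚ.* (s ℚ.* y)) ℚ.+ w)
    rearrange = solve 6 (λ q s s′ x y w → ((:- q) :* (s :+ (:- con 1ℚ) :* s′)) :* (x :* y) :+ w :=
      (q :* x) :* (s′ :* y) :+ ((:- ((q :* x) :* (s :* y))) :+ w)) refl

    q*t≡c : q ℚ.* ι (suc t) ≡ ι c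
    q*t≡c = trans (cong (ℚ._* ι (suc t)) q≡) (/-*-ι c t)

    identity : ((ℚ.- q) ℚ.* (sa ℚ.+ (ℚ.- 1ℚ) ℚ.* sb)) ℚ.* (ι (suc t) ℚ.* ι N) ℚ.+ ι (c * ka) ≡ ι (c * kb)
    identity = begin
      ((ℚ.- q) ℚ.* (sa ℚ.+ (ℚ.- 1ℚ) ℚ.* sb)) ℚ.* (ι (suc t) ℚ.* ι N) ℚ.+ ι (c * ka)
        ≡⟨ rearrange q sa sb (ι (suc t)) (ι N) (ι (c * ka)) ⟩
      (q ℚ.* ι (suc t)) ℚ.* (sb ℚ.* ι N) ℚ.+ (ℚ.- ((q ℚ.* ι (suc t)) ℚ.* (sa ℚ.* ι N)) ℚ.+ ι (c * ka))
        ≡⟨ cong₂ (λ x y → x ℚ.+ (ℚ.- y ℚ.+ ι (c * ka))) (product≡ kb) (product≡ ka) ⟩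
      ι (c * kb) ℚ.+ (ℚ.- ι (c * ka) ℚ.+ ι (c * ka)) ≡⟨ cong (ι (c * kb) ℚ.+_) (ℚ.+-inverseˡ (ι (c * ka))) ⟩
      ι (c * kb) ℚ.+ 0ℚ ≡⟨ ℚ.+-identityʳ _ ⟩
      ι (c * kb) ∎
      where
      open ≡-Reasoning
      product≡ : ∀ k → (q ℚ.* ι (suc t)) ℚ.* ((+ k / N) ℚ.* ι N) ≡ ι (c * k)
      product≡ k = trans (cong₂ ℚ._*_ q*t≡c (/-*-ι k n)) (sym (ι-* c k))

seq-sumᴿ : ∀ (f : A → ℝ) (g₊ g₋ : A → ℕ) D n vs →
  (∀ v → v ∈ vs → seq (f v) n ℚ.* D ℚ.+ ι (g₋ v) ≡ ι (g₊ v)) →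
  seq (sumᴿ (map f vs)) n ℚ.* D ℚ.+ ι (∑ vs g₋) ≡ ι (∑ vs g₊)
seq-sumᴿ f g₊ g₋ D n []       eq = trans (ℚ.+-identityʳ (0ℚ ℚ.* D)) (ℚ.*-zeroˡ D)
seq-sumᴿ f g₊ g₋ D n (v ∷ vs) eq = begin
  (seq (f v) n ℚ.+ s) ℚ.* D ℚ.+ ι (g₋ v + ∑ vs g₋)
    ≡⟨ cong ((seq (f v) n ℚ.+ s) ℚ.* D ℚ.+_) (ι-+ (g₋ v) (∑ vs g₋)) ⟩
  (seq (f v) n ℚ.+ s) ℚ.* D ℚ.+ (ι (g₋ v) ℚ.+ ι (∑ vs g₋))
    ≡⟨ rearrange (seq (f v) n) s D (ι (g₋ v)) (ι (∑ vs g₋)) ⟩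
  (seq (f v) n ℚ.* D ℚ.+ ι (g₋ v)) ℚ.+ (s ℚ.* D ℚ.+ ι (∑ vs g₋))
    ≡⟨ cong₂ ℚ._+_ (eq v (here refl)) (seq-sumᴿ f g₊ g₋ D n vs λ w w∈ → eq w (there w∈)) ⟩
  ι (g₊ v) ℚ.+ ι (∑ vs g₊) ≡⟨ ι-+ (g₊ v) (∑ vs g₊) ⟨
  ι (g₊ v + ∑ vs g₊) ∎
  where
  open ≡-Reasoning
  s = seq (sumᴿ (map f vs)) n
  rearrange : ∀ a s d x y → (a ℚ.+ s) ℚ.* d ℚ.+ (x ℚ.+ y) ≡ (a ℚ.* d ℚ.+ x) ℚ.+ (s ℚ.* d ℚ.+ y)
  rearrange = solve 5 (λ a s d x y → (a :+ s) :* d :+ (x :+ y) := (a :* d :+ x) :+ (s :* d :+ y)) refl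
    where open +-*-Solver

-- After division by length · (n + 1): the n-th approximant exceeds the average codeword length by
-- at most 1 / (n + 1), the price of rounding the logarithms down.
entropy-bound : ∀ (_≟_ : DecidableEquality A) xs (enc : A → List Bool) → 0 < length xs → PrefixFree enc xs → ∀ n →
  seq (entropy _≟_ xs) n ℚ.* ι (length xs * suc n) ℚ.≤ ι (suc n * ∑ xs (length ∘ enc) + length xs)
entropy-bound {A} _≟_ xs enc xs>0 pf n = ℚ-+-cancelʳ-≤ (ι K₋) (begin
  seq (entropy _≟_ xs) n ℚ.* ι (length xs * N) ℚ.+ ι K₋
    ≡⟨ cong (λ d → seq (entropy _≟_ xs) n ℚ.* d ℚ.+ ι K₋) (ι-* (length xs) N) ⟩
  seq (entropy _≟_ xs) n ℚ.* (ι (length xs) ℚ.* ι N) ℚ.+ ι K₋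
    ≡⟨ seq-sumᴿ (λ v → (ℚ.- prob v) · log₂ (prob v)) (λ v → count v * k₊ n (prob v)) (λ v → count v * k₋ n (prob v))
        (ι (length xs) ℚ.* ι N) n distinct (λ v v∈ → proj₂ (fact v (∈.∈-deduplicate⁻ _≟_ xs v∈))) ⟩
  ι (∑ distinct (λ v → count v * k₊ n (prob v))) ≤⟨ ι-mono-≤ bound ⟩
  ι (N * ∑ xs (length ∘ enc) + length xs + K₋) ≡⟨ ι-+ (N * ∑ xs (length ∘ enc) + length xs) K₋ ⟩
  ι (N * ∑ xs (length ∘ enc) + length xs) ℚ.+ ι K₋ ∎)
  where
  open ℚ.≤-Reasoning
  N = suc n
  open Samples _≟_ xs using (distinct; count; count-pos; ∑-distinct; module Gibbs)
  prob : A → ℚ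
  prob v = ratio (count v) (length xs)
  K₋ = ∑ distinct (λ v → count v * k₋ n (prob v))
  fact = λ v v∈ → log₂-ratio n (count v) (length xs) (prob v) (count-pos {v} v∈) xs>0 refl
  bound : ∑ distinct (λ v → count v * k₊ n (prob v)) ≤ N * ∑ xs (length ∘ enc) + length xs + K₋
  bound = subst₂ (λ a b → a ≤ N * ∑ xs (length ∘ enc) + length xs + b)
    (sym (∑-distinct (k₊ n ∘ prob))) (sym (∑-distinct (k₋ n ∘ prob)))
    (Gibbs.rounded-entropy-bound enc pf N (k₊ n ∘ prob) (k₋ n ∘ prob) λ v v∈ → proj₁ (fact v v∈))

-- Shuffles and lattice paths

-- The binomial coefficient of m + n over m, as a count of lattice paths from (0,0) to (m,n). The
-- recursion splits on the first step, as `shuffles` does, where `true` is a step in the first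
-- coordinate.
B : ℕ → ℕ → ℕ
B zero    n       = 1
B (suc m) zero    = 1
B (suc m) (suc n) = B m (suc n) + B (suc m) n

shuffles : ℕ → ℕ → List (List Bool)
shuffles zero    n       = [ replicate n false ]
shuffles (suc m) zero    = [ replicate (suc m) true ]
shuffles (suc m) (suc n) = map (true ∷_) (shuffles m (suc n)) ++ map (false ∷_) (shuffles (suc m) n)

B-zeroʳ : ∀ m → B m 0 ≡ 1
B-zeroʳ zero    = refl
B-zeroʳ (suc m) = refl

shuffles-zeroʳ : ∀ m → shuffles m 0 ≡ [ replicate m true ]
shuffles-zeroʳ zero    = refl
shuffles-zeroʳ (suc m) = refl

B-pos : ∀ m n → 0 < B m n
B-pos zero    n       = s≤s z≤n
B-pos (suc m) zero    = s≤s z≤n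
B-pos (suc m) (suc n) = ℕ.≤-trans (B-pos m (suc n)) (ℕ.m≤m+n _ _)

B-comm : ∀ m n → B m n ≡ B n m
B-comm zero    zero    = refl
B-comm zero    (suc n) = refl
B-comm (suc m) zero    = refl
B-comm (suc m) (suc n) = trans (cong₂ _+_ (B-comm m (suc n)) (B-comm (suc m) n)) (ℕ.+-comm (B (suc n) m) _)

∑-shuffles : ∀ m n (f : List Bool → ℕ) → ∑ (shuffles (suc m) (suc n)) f ≡
  ∑ (shuffles m (suc n)) (f ∘ (true ∷_)) + ∑ (shuffles (suc m) n) (f ∘ (false ∷_))
∑-shuffles m n f = trans (∑-++ (map (true ∷_) (shuffles m (suc n))) _ f)
  (cong₂ _+_ (∑-map (true ∷_) (shuffles m (suc n)) f) (∑-map (false ∷_) (shuffles (suc m) n) f))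

length-shuffles : ∀ m n → length (shuffles m n) ≡ B m n
length-shuffles zero    n       = refl
length-shuffles (suc m) zero    = refl
length-shuffles (suc m) (suc n) = trans (length-++ (map (true ∷_) (shuffles m (suc n))))
  (cong₂ _+_ (trans (length-map (true ∷_) (shuffles m (suc n))) (length-shuffles m (suc n)))
    (trans (length-map (false ∷_) (shuffles (suc m) n)) (length-shuffles (suc m) n)))

-- 1-based position of the i-th true letter; 0 for i = 0.
position-true : ℕ → List Bool → ℕ
position-true zero    s           = 0
position-true (suc i) []          = 0
position-true (suc i) (true ∷ s)  = suc (position-true i s)
position-true (suc i) (false ∷ s) = suc (position-true (suc i) s)

-- By `B-absorb` this says that the i-th letter `true` has average position i (m + n + 1) / (m + 1).
-- In this division-free form it follows from Pascal's rule by splitting on the first letter.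
∑-position-true : ∀ i m n → i ≤ m → ∑ (shuffles m n) (position-true i) ≡ i * B (suc m) n
∑-position-true zero    m       n       _        = ∑-0 (shuffles m n)
∑-position-true (suc i) (suc m) zero    (s≤s le) =
    trans (ℕ.+-identityʳ _) (trans (cong suc (go i m le)) (sym (ℕ.*-identityʳ (suc i))))
  where
  go : ∀ i m → i ≤ m → position-true i (replicate m true) ≡ i
  go zero    m       _        = refl
  go (suc i) (suc m) (s≤s le) = cong suc (go i m le)
∑-position-true (suc i) (suc m) (suc n) (s≤s le) = begin
  ∑ (shuffles (suc m) (suc n)) (position-true (suc i))
    ≡⟨ ∑-shuffles m n (position-true (suc i)) ⟩
  ∑ S₁ (λ s → 1 + position-true i s) + ∑ S₂ (λ s → 1 + position-true (suc i) s)
    ≡⟨ cong₂ _+_ (split S₁ (position-true i)) (split S₂ (position-true (suc i))) ⟩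
  length S₁ + ∑ S₁ (position-true i) + (length S₂ + ∑ S₂ (position-true (suc i)))
    ≡⟨ cong₂ _+_ (cong₂ _+_ (length-shuffles m (suc n)) (∑-position-true i m (suc n) le))
                 (cong₂ _+_ (length-shuffles (suc m) n) (∑-position-true (suc i) (suc m) n (s≤s le))) ⟩
  B m (suc n) + i * (B m (suc n) + B (suc m) n) + (B (suc m) n + suc i * B (suc (suc m)) n)
    ≡⟨ lemma (B m (suc n)) (B (suc m) n) i (B (suc (suc m)) n) ⟩
  suc i * (B m (suc n) + B (suc m) n + B (suc (suc m)) n) ∎
  where
  open ≡-Reasoning
  S₁ = shuffles m (suc n)
  S₂ = shuffles (suc m) n
  split : ∀ S (f : List Bool → ℕ) → ∑ S (λ s → 1 + f s) ≡ length S + ∑ S f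
  split S f = trans (∑-+ S (λ _ → 1) f) (cong (_+ ∑ S f) (∑-1 S))
  lemma : ∀ a b i c → a + i * (a + b) + (b + suc i * c) ≡ suc i * (a + b + c)
  lemma = solve-∀

-- The absorption identity for binomial coefficients; with m = n it is the origin of the factor (2m
-- + 1) / (m + 1).
B-absorb : ∀ m n → suc m * B (suc m) n ≡ (m + n + 1) * B m n
B-absorb zero    zero    = refl
B-absorb zero    (suc n) = trans (cong (λ b → 1 * (1 + b)) (trans (sym (ℕ.+-identityʳ _)) (B-absorb zero n)))
    (lemma n)
  where
  lemma : ∀ n → 1 * (1 + (n + 1) * 1) ≡ (suc n + 1) * 1
  lemma = solve-∀
B-absorb (suc m) zero    = lemma m
  where
  lemma : ∀ m → suc (suc m) * 1 ≡ (suc m + 0 + 1) * 1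
  lemma = solve-∀
B-absorb (suc m) (suc n) = begin
  suc (suc m) * (B (suc m) (suc n) + B (suc (suc m)) n) ≡⟨ ℕ.*-distribˡ-+ (suc (suc m)) (B (suc m) (suc n)) _ ⟩
  suc (suc m) * B (suc m) (suc n) + suc (suc m) * B (suc (suc m)) n
    ≡⟨ cong (suc (suc m) * B (suc m) (suc n) ℕ.+_) (B-absorb (suc m) n) ⟩
  suc (suc m) * B (suc m) (suc n) + (suc m + n + 1) * B (suc m) n ≡⟨ l₁ m n (B (suc m) (suc n)) (B (suc m) n) ⟩
  B (suc m) (suc n) + (suc m * B (suc m) (suc n) + (suc m + n + 1) * B (suc m) n)
    ≡⟨ cong (λ k → B (suc m) (suc n) + (k + (suc m + n + 1) * B (suc m) n)) (B-absorb m (suc n)) ⟩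
  B (suc m) (suc n) + ((m + suc n + 1) * B m (suc n) + (suc m + n + 1) * B (suc m) n)
    ≡⟨ l₂ m n (B m (suc n)) (B (suc m) n) ⟩
  (suc m + suc n + 1) * B (suc m) (suc n) ∎
  where
  open ≡-Reasoning
  l₁ : ∀ m n x y → suc (suc m) * x + (suc m + n + 1) * y ≡ x + (suc m * x + (suc m + n + 1) * y)
  l₁ = solve-∀
  l₂ : ∀ m n a b → a + b + ((m + suc n + 1) * a + (suc m + n + 1) * b) ≡ (suc m + suc n + 1) * (a + b)
  l₂ = solve-∀

visits : ℕ → ℕ → List Bool → Bool
visits zero    zero    s           = true
visits (suc i) j       (true ∷ s)  = visits i j s
visits i       (suc j) (false ∷ s) = visits i j s
visits _       _       _           = false

-- A path through (i , j) consists of a path to that point and a path from it.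
∑-visits : ∀ i j m n → ∑ (shuffles (i + m) (j + n)) (𝟙 ∘ visits i j) ≤ B i j * B m n
∑-visits zero zero m n = ℕ.≤-reflexive (trans (∑-1 (shuffles m n))
    (trans (length-shuffles m n) (sym (ℕ.+-identityʳ _))))
∑-visits zero (suc j) zero n = ℕ.≤-trans (∑-visits zero j zero n) ℕ.≤-refl
∑-visits zero (suc j) (suc m) n = begin
  ∑ (shuffles (suc m) (suc (j + n))) (𝟙 ∘ visits 0 (suc j)) ≡⟨ ∑-shuffles m (j + n) _ ⟩
  ∑ (shuffles m (suc (j + n))) (λ _ → 0) + ∑ (shuffles (suc m) (j + n)) (𝟙 ∘ visits 0 j)
    ≡⟨ cong (_+ ∑ (shuffles (suc m) (j + n)) (𝟙 ∘ visits 0 j)) (∑-0 (shuffles m (suc (j + n)))) ⟩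
  ∑ (shuffles (suc m) (j + n)) (𝟙 ∘ visits 0 j) ≤⟨ ∑-visits zero j (suc m) n ⟩
  1 * B (suc m) n ∎
  where open ℕ.≤-Reasoning
∑-visits (suc i) zero m zero rewrite B-zeroʳ m = ℕ.≤-trans (ℕ.≤-reflexive (cong (_+ 0) refl)) (ones i)
  where
  ones : ∀ i → 𝟙 (visits (suc i) 0 (replicate (suc i + m) true)) + 0 ≤ 1
  ones i with visits (suc i) 0 (replicate (suc i + m) true)
  ... | true  = ℕ.≤-refl
  ... | false = z≤n
∑-visits (suc i) zero m (suc n) = begin
  ∑ (shuffles (suc (i + m)) (suc n)) (𝟙 ∘ visits (suc i) 0) ≡⟨ ∑-shuffles (i + m) n _ ⟩
  ∑ (shuffles (i + m) (suc n)) (𝟙 ∘ visits i 0) + ∑ (shuffles (suc (i + m)) n) (λ _ → 0)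
    ≡⟨ cong (∑ (shuffles (i + m) (suc n)) (𝟙 ∘ visits i 0) ℕ.+_) (∑-0 (shuffles (suc (i + m)) n)) ⟩
  ∑ (shuffles (i + m) (suc n)) (𝟙 ∘ visits i 0) + 0 ≡⟨ ℕ.+-identityʳ _ ⟩
  ∑ (shuffles (i + m) (suc n)) (𝟙 ∘ visits i 0) ≤⟨ ∑-visits i zero m (suc n) ⟩
  B i 0 * B m (suc n) ≡⟨ cong (_* B m (suc n)) (B-zeroʳ i) ⟩
  1 * B m (suc n) ∎
  where open ℕ.≤-Reasoning
∑-visits (suc i) (suc j) m n = begin
  ∑ (shuffles (suc (i + m)) (suc (j + n))) (𝟙 ∘ visits (suc i) (suc j)) ≡⟨ ∑-shuffles (i + m) (j + n) _ ⟩
  ∑ (shuffles (i + m) (suc j + n)) (𝟙 ∘ visits i (suc j)) + ∑ (shuffles (suc i + m) (j + n)) (𝟙 ∘ visits (suc i) j)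
    ≤⟨ ℕ.+-mono-≤ (∑-visits i (suc j) m n) (∑-visits (suc i) j m n) ⟩
  B i (suc j) * B m n + B (suc i) j * B m n ≡⟨ ℕ.*-distribʳ-+ (B m n) (B i (suc j)) _ ⟨
  B (suc i) (suc j) * B m n ∎
  where open ℕ.≤-Reasoning

-- Estimates for binomial coefficients

B-central : ∀ m → suc m * B (suc m) (suc m) ≡ 2 * (2 * m + 1) * B m m
B-central m = begin
  suc m * (B m (suc m) + B (suc m) m) ≡⟨ cong (λ b → suc m * (b + B (suc m) m)) (B-comm m (suc m)) ⟩
  suc m * (B (suc m) m + B (suc m) m) ≡⟨ l₁ (suc m) (B (suc m) m) ⟩
  2 * (suc m * B (suc m) m) ≡⟨ cong (2 *_) (B-absorb m m) ⟩
  2 * ((m + m + 1) * B m m) ≡⟨ l₂ m (B m m) ⟩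
  2 * (2 * m + 1) * B m m ∎
  where
  open ≡-Reasoning
  l₁ : ∀ a b → a * (b + b) ≡ 2 * (a * b)
  l₁ = solve-∀
  l₂ : ∀ m b → 2 * ((m + m + 1) * b) ≡ 2 * (2 * m + 1) * b
  l₂ = solve-∀

B-central-sq : ∀ m → suc m * suc m * (B (suc m) (suc m) * B (suc m) (suc m)) ≡
  4 * ((2 * m + 1) * (2 * m + 1)) * (B m m * B m m)
B-central-sq m = trans (l₁ (suc m) (B (suc m) (suc m)))
  (trans (cong₂ _*_ (B-central m) (B-central m)) (l₂ (2 * m + 1) (B m m)))
  where
  l₁ : ∀ a b → a * a * (b * b) ≡ a * b * (a * b)
  l₁ = solve-∀
  l₂ : ∀ a b → 2 * a * b * (2 * a * b) ≡ 4 * (a * a) * (b * b)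
  l₂ = solve-∀

-- By the exact ratio of consecutive squares, the induction step amounts to (2m + 1)(2m + 3) ≤ (2m +
-- 2)².
B-central-upper : ∀ m → B m m * B m m * (2 * m + 1) ≤ 16 ℕ.^ m
B-central-upper zero    = ℕ.≤-refl
B-central-upper (suc m) = ℕ.*-cancelˡ-≤ (suc m * suc m) (begin
  suc m * suc m * (b′ * b′ * (2 * suc m + 1)) ≡⟨ ℕ.*-assoc (suc m * suc m) (b′ * b′) _ ⟨
  suc m * suc m * (b′ * b′) * (2 * suc m + 1) ≡⟨ cong (_* (2 * suc m + 1)) (B-central-sq m) ⟩
  4 * ((2 * m + 1) * (2 * m + 1)) * (b * b) * (2 * suc m + 1) ≡⟨ l₁ m (b * b) ⟩
  4 * ((2 * m + 1) * (2 * m + 3)) * (b * b * (2 * m + 1))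
    ≤⟨ ℕ.*-mono-≤ (ℕ.≤-trans (ℕ.m≤m+n _ 4) (ℕ.≤-reflexive (l₂ m))) (B-central-upper m) ⟩
  16 * (suc m * suc m) * 16 ℕ.^ m ≡⟨ l₃ (suc m * suc m) (16 ℕ.^ m) ⟩
  suc m * suc m * (16 * 16 ℕ.^ m) ∎)
  where
  open ℕ.≤-Reasoning
  b  = B m m
  b′ = B (suc m) (suc m)
  l₁ : ∀ m c → 4 * ((2 * m + 1) * (2 * m + 1)) * c * (2 * suc m + 1) ≡
      4 * ((2 * m + 1) * (2 * m + 3)) * (c * (2 * m + 1))
  l₁ = solve-∀
  l₂ : ∀ m → 4 * ((2 * m + 1) * (2 * m + 3)) + 4 ≡ 16 * (suc m * suc m)
  l₂ = solve-∀
  l₃ : ∀ a b → 16 * a * b ≡ a * (16 * b)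
  l₃ = solve-∀

-- The induction step amounts to 4m(m + 1) ≤ (2m + 1)². The case m = 0 is false, so the induction
-- starts at 1.
B-central-lower : ∀ m .{{_ : NonZero m}} → 16 ℕ.^ m ≤ 4 * m * (B m m * B m m)
B-central-lower 1               = ℕ.≤-refl
B-central-lower (suc m@(suc _)) = ℕ.*-cancelˡ-≤ (m * (suc m * suc m)) (begin
  m * (suc m * suc m) * (16 * 16 ℕ.^ m) ≡⟨ l₀ m (suc m * suc m) (16 ℕ.^ m) ⟩
  16 * (m * (suc m * suc m)) * 16 ℕ.^ m ≤⟨ ℕ.*-monoʳ-≤ (16 * (m * (suc m * suc m))) (B-central-lower m) ⟩
  16 * (m * (suc m * suc m)) * (4 * m * (b * b)) ≤⟨ ℕ.m≤m+n _ (16 * (m * suc m) * (b * b)) ⟩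
  16 * (m * (suc m * suc m)) * (4 * m * (b * b)) + 16 * (m * suc m) * (b * b) ≡⟨ l₁ m (b * b) ⟩
  m * (4 * suc m) * (4 * ((2 * m + 1) * (2 * m + 1)) * (b * b)) ≡⟨ cong (m * (4 * suc m) *_) (B-central-sq m) ⟨
  m * (4 * suc m) * (suc m * suc m * (b′ * b′)) ≡⟨ l₂ m (4 * suc m) (suc m * suc m) (b′ * b′) ⟩
  m * (suc m * suc m) * (4 * suc m * (b′ * b′)) ∎)
  where
  open ℕ.≤-Reasoning
  b  = B m m
  b′ = B (suc m) (suc m)
  l₀ : ∀ m a c → m * a * (16 * c) ≡ 16 * (m * a) * c
  l₀ = solve-∀
  l₁ : ∀ m c → 16 * (m * (suc m * suc m)) * (4 * m * c) + 16 * (m * suc m) * c ≡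
    m * (4 * suc m) * (4 * ((2 * m + 1) * (2 * m + 1)) * c)
  l₁ = solve-∀
  l₂ : ∀ a b c d → a * b * (c * d) ≡ a * c * (b * d)
  l₂ = solve-∀

-- The ratio of the two coefficients is (a + b + 1) / (b + 1), which is at least 2 below the
-- diagonal.
B-double : ∀ a b → suc b ≤ a → 2 * B a b ≤ B a (suc b)
B-double a b b<a = ℕ.*-cancelˡ-≤ (suc b) (begin
  suc b * (2 * B a b) ≡⟨ l (suc b) (B a b) ⟩
  (suc b + suc b) * B a b ≤⟨ ℕ.*-monoˡ-≤ (B a b) (ℕ.+-monoʳ-≤ (suc b) b<a) ⟩
  (suc b + a) * B a b ≡⟨ cong₂ _*_ (ℕ.+-comm 1 (b + a)) (B-comm a b) ⟩
  (b + a + 1) * B b a ≡⟨ B-absorb b a ⟨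
  suc b * B (suc b) a ≡⟨ cong (suc b *_) (B-comm (suc b) a) ⟩
  suc b * B a (suc b) ∎)
  where
  open ℕ.≤-Reasoning
  l : ∀ a b → a * (2 * b) ≡ (a + a) * b
  l = solve-∀

-- Raising b towards the fixed a at least doubles `B a b`, so its square gains at least the factor 4
-- that the right-hand side gains. This reduces the bound to the diagonal.
B-upper-≥ : ∀ d b → let a = b + d in B a b * B a b * (2 * a + 1) ≤ 4 ℕ.^ (a + b)
B-upper-≥ zero b rewrite ℕ.+-identityʳ b = ℕ.≤-trans (B-central-upper b) (ℕ.≤-reflexive (trans (ℕ.^-*-assoc 4 2 b) (cong (λ k → 4 ℕ.^ (b + k)) (ℕ.+-identityʳ b))))
B-upper-≥ (suc d) b = subst (λ a → B a b * B a b * (2 * a + 1) ≤ 4 ℕ.^ (a + b)) (sym (ℕ.+-suc b d))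
    (ℕ.*-cancelˡ-≤ 4 (begin
  4 * (B a b * B a b * (2 * a + 1)) ≡⟨ l (B a b) (2 * a + 1) ⟩
  2 * B a b * (2 * B a b) * (2 * a + 1) ≤⟨ ℕ.*-monoˡ-≤ (2 * a + 1) (ℕ.*-mono-≤ dbl dbl) ⟩
  B a (suc b) * B a (suc b) * (2 * a + 1) ≤⟨ B-upper-≥ d (suc b) ⟩
  4 ℕ.^ (a + suc b) ≡⟨ cong (4 ℕ.^_) (ℕ.+-suc a b) ⟩
  4 * 4 ℕ.^ (a + b) ∎))
  where
  open ℕ.≤-Reasoning
  a = suc b + d
  dbl = B-double a b (ℕ.m≤m+n (suc b) d)
  l : ∀ x y → 4 * (x * x * y) ≡ 2 * x * (2 * x) * y
  l = solve-∀

-- It is enough that one coordinate is large, since the bound is governed by the larger of the two.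
-- The other coordinate will be the rank of an arbitrary selected point, possibly near the end of a
-- chain.
B-upper : ∀ ℓ i j → ℓ ≤ i → B i j * B i j * (2 * ℓ + 1) ≤ 4 ℕ.^ (i + j)
B-upper ℓ i j ℓ≤i with ℕ.≤-total j i
... | inj₁ j≤i with d , refl ← ℕ.m≤n⇒∃[o]m+o≡n j≤i =
  ℕ.≤-trans (ℕ.*-monoʳ-≤ (B i j * B i j) (ℕ.+-monoˡ-≤ 1 (ℕ.*-monoʳ-≤ 2 ℓ≤i))) (B-upper-≥ d j)
... | inj₂ i≤j with d , refl ← ℕ.m≤n⇒∃[o]m+o≡n i≤j =
  ℕ.≤-trans (ℕ.*-monoʳ-≤ (B i j * B i j) (ℕ.+-monoˡ-≤ 1 (ℕ.*-monoʳ-≤ 2 (ℕ.≤-trans ℓ≤i i≤j))))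
    (subst₂ _≤_ (cong (λ b → b * b * (2 * j + 1)) (B-comm j i)) (cong (4 ℕ.^_) (ℕ.+-comm j i)) (B-upper-≥ d i))

square-cancel-≤ : ∀ a b → a * a ≤ b * b → a ≤ b
square-cancel-≤ a b le = ℕ.≮⇒≥ λ b<a → ℕ.<⇒≱ (ℕ.*-mono-< b<a b<a) le

-- A given point is visited with probability O(ℓ^(-1/2)).
B-visit : ∀ D ℓ i i′ j j′ m → i + i′ ≡ m → j + j′ ≡ m → ℓ ≤ i → ℓ ≤ i′ → 0 < m →
  D * D * (4 * m) ≤ (2 * ℓ + 1) * (2 * ℓ + 1) → D * (B i j * B i′ j′) ≤ B m m
B-visit D ℓ i i′ j j′ m i+i′ j+j′ ℓ≤i ℓ≤i′ m>0 D≤ =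
    -- The bounds are for squares of binomial coefficients, so the inequality is squared. The powers
    -- of 4 from the two halves of the path multiply to 16^m, which the central lower bound absorbs.
    square-cancel-≤ _ _ (ℕ.*-cancelˡ-≤ (4 * m) {{ℕ.m*n≢0 4 m {{_}} {{ℕ.>-nonZero m>0}}}} (begin
  4 * m * (D * (x * y) * (D * (x * y))) ≡⟨ l₁ m D x y ⟩
  D * D * (4 * m) * (x * x * (y * y)) ≤⟨ ℕ.*-monoˡ-≤ (x * x * (y * y)) D≤ ⟩
  (2 * ℓ + 1) * (2 * ℓ + 1) * (x * x * (y * y)) ≡⟨ l₂ (2 * ℓ + 1) (x * x) (y * y) ⟩
  x * x * (2 * ℓ + 1) * (y * y * (2 * ℓ + 1)) ≤⟨ ℕ.*-mono-≤ (B-upper ℓ i j ℓ≤i) (B-upper ℓ i′ j′ ℓ≤i′) ⟩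
  4 ℕ.^ (i + j) * 4 ℕ.^ (i′ + j′) ≡⟨ ℕ.^-distribˡ-+-* 4 (i + j) (i′ + j′) ⟨
  4 ℕ.^ (i + j + (i′ + j′))
    ≡⟨ cong (4 ℕ.^_) (trans (l₃ i j i′ j′) (cong₂ _+_ i+i′ (trans j+j′ (sym (ℕ.+-identityʳ m))))) ⟩
  4 ℕ.^ (2 * m) ≡⟨ ℕ.^-*-assoc 4 2 m ⟨
  16 ℕ.^ m ≤⟨ B-central-lower m {{ℕ.>-nonZero m>0}} ⟩
  4 * m * (B m m * B m m) ∎))
  where
  open ℕ.≤-Reasoning
  x = B i j
  y = B i′ j′
  l₁ : ∀ m D x y → 4 * m * (D * (x * y) * (D * (x * y))) ≡ D * D * (4 * m) * (x * x * (y * y))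
  l₁ = solve-∀
  l₂ : ∀ a b c → a * a * (b * c) ≡ b * a * (c * a)
  l₂ = solve-∀
  l₃ : ∀ a b c d → a + b + (c + d) ≡ a + c + (b + d)
  l₃ = solve-∀

-- Coding the interleaving of two lists

data Shuffle {A C : Set} : List Bool → List A → List C → Set where
  []    : Shuffle [] [] []
  left  : ∀ {s x xs ys} → Shuffle s xs ys → Shuffle (true ∷ s) (x ∷ xs) ys
  right : ∀ {s xs y ys} → Shuffle s xs ys → Shuffle (false ∷ s) xs (y ∷ ys)

-- The marks m₁ and m₂ annotate the letters true and false still to be read; a mark true says
-- that the letter has to follow its predecessor on the same side immediately.
hot : List Bool → Bool
hot (true ∷ m) = true
hot _          = false

-- In a good word a hot mark or an exhausted side determines the next letter. Only when both sides
-- have a cold letter next is there a choice, and exactly these letters are emitted.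
contested : List Bool → List Bool → Bool
contested (false ∷ _) (false ∷ _) = true
contested _           _           = false

good : (t m₁ m₂ : List Bool) → Bool
good []          m₁ m₂ = true
good (true ∷ t)  m₁ m₂ = not (hot m₂) ∧ good t (drop 1 m₁) m₂
good (false ∷ t) m₁ m₂ = not (hot m₁) ∧ good t m₁ (drop 1 m₂)

emit : Bool → Bool → List Bool → List Bool
emit true  x u = x ∷ u
emit false x u = u

encode : (t m₁ m₂ : List Bool) → List Bool
encode []          m₁ m₂ = []
encode (true ∷ t)  m₁ m₂ = emit (contested m₁ m₂) true  (encode t (drop 1 m₁) m₂)
encode (false ∷ t) m₁ m₂ = emit (contested m₁ m₂) false (encode t m₁ (drop 1 m₂))

emit-injective : ∀ b x {u v s s′} → emit b x u ++ s ≡ emit b x v ++ s′ → u ++ s ≡ v ++ s′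
emit-injective true  x eq = ∷-injectiveʳ eq
emit-injective false x eq = eq

∧-elim : ∀ {a b} → T (a ∧ b) → T a × T b
∧-elim {true} p = _ , p

-- The decoder knows the marks and what has been read so far. If two good words differ at a letter,
-- goodness of both makes both next marks cold, so the letter was emitted and the code words differ
-- there.
encode-decodable : ∀ {t t′ m₁ m₂} → Shuffle t m₁ m₂ → Shuffle t′ m₁ m₂ → T (good t m₁ m₂) → T (good t′ m₁ m₂) →
  ∀ {s s′} → encode t m₁ m₂ ++ s ≡ encode t′ m₁ m₂ ++ s′ → t ≡ t′ × s ≡ s′
encode-decodable [] [] _ _ eq = refl , eq
encode-decodable {m₁ = m₁} {m₂} (left p) (left q) g g′ eq
  with refl , eq′ ← encode-decodable p q (proj₂ (∧-elim {not (hot m₂)} g)) (proj₂ (∧-elim {not (hot m₂)} g′)) (emit-injective (contested m₁ m₂) true eq) = refl , eq′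
encode-decodable {m₁ = m₁} {m₂} (right p) (right q) g g′ eq
  with refl , eq′ ← encode-decodable p q (proj₂ (∧-elim {not (hot m₁)} g)) (proj₂ (∧-elim {not (hot m₁)} g′)) (emit-injective (contested m₁ m₂) false eq) = refl , eq′
encode-decodable {m₁ = false ∷ _} {false ∷ _} (left p) (right q) g g′ ()
encode-decodable {m₁ = false ∷ _} {false ∷ _} (right p) (left q) g g′ ()

#_ : List Bool → ℕ
# m = ∑ m 𝟙

#false : List Bool → ℕ
#false m = # map not m

-- Each emitted bit consumes a cold mark while the other side still holds one, so the last cold mark
-- is never paid for. The bit saved is the room for the flag.
length-encode : ∀ {t m₁ m₂} → Shuffle t m₁ m₂ → length (encode t m₁ m₂) ≤ #false m₁ + #false m₂ ∸ 1
length-encode [] = z≤n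
length-encode {m₁ = true ∷ m₁} (left p) = length-encode p
length-encode {m₁ = false ∷ m₁} {[]} (left p) = ℕ.≤-trans (length-encode p) (ℕ.m∸n≤m _ 1)
length-encode {m₁ = false ∷ m₁} {true ∷ m₂} (left p) = ℕ.≤-trans (length-encode p) (ℕ.m∸n≤m _ 1)
length-encode {m₁ = false ∷ m₁} {false ∷ m₂} (left p) = ℕ.≤-trans
  (s≤s (ℕ.≤-trans (length-encode p) (ℕ.≤-reflexive (cong (_∸ 1) (ℕ.+-suc (#false m₁) (#false m₂))))))
  (ℕ.≤-reflexive (sym (ℕ.+-suc (#false m₁) (#false m₂))))
length-encode {m₁ = []} {true ∷ m₂} (right p) = length-encode p
length-encode {m₁ = true ∷ m₁} {true ∷ m₂} (right p) = length-encode p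
length-encode {m₁ = false ∷ m₁} {true ∷ m₂} (right p) = length-encode p
length-encode {m₁ = []} {false ∷ m₂} (right p) = ℕ.≤-trans (length-encode p) (ℕ.m∸n≤m _ 1)
length-encode {m₁ = true ∷ m₁} {false ∷ m₂} (right p) = ℕ.≤-trans (length-encode p)
  (ℕ.∸-monoˡ-≤ 1 (ℕ.+-monoʳ-≤ (#false m₁) (ℕ.n≤1+n (#false m₂))))
length-encode {m₁ = false ∷ m₁} {false ∷ m₂} (right p) = ℕ.≤-trans
  (s≤s (length-encode p)) (ℕ.≤-reflexive (sym (ℕ.+-suc (#false m₁) (#false m₂))))

plain : ℕ → List Bool
plain n = replicate n false

good-plain : ∀ t m n → T (good t (plain m) (plain n))
good-plain []          m       n       = _
good-plain (true ∷ t)  zero    zero    = good-plain t 0 0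
good-plain (true ∷ t)  zero    (suc n) = good-plain t 0 (suc n)
good-plain (true ∷ t)  (suc m) zero    = good-plain t m 0
good-plain (true ∷ t)  (suc m) (suc n) = good-plain t m (suc n)
good-plain (false ∷ t) zero    zero    = good-plain t 0 0
good-plain (false ∷ t) zero    (suc n) = good-plain t 0 n
good-plain (false ∷ t) (suc m) zero    = good-plain t (suc m) 0
good-plain (false ∷ t) (suc m) (suc n) = good-plain t (suc m) n

#false-plain : ∀ n → #false (plain n) ≡ n
#false-plain zero    = refl
#false-plain (suc n) = cong suc (#false-plain n)

-- The marks of the selected points of one copy: after the cold first point the others are forced,
-- so the copy counts as one point.
run : ℕ → List Bool
run zero    = []
run (suc k) = false ∷ replicate k true

sgn : ℕ → ℕ
sgn zero    = 0
sgn (suc _) = 1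

#false-run : ∀ k → #false (run k) ≡ sgn k
#false-run zero    = refl
#false-run (suc k) = cong suc (go k)
  where
  go : ∀ k → #false (replicate k true) ≡ 0
  go zero    = refl
  go (suc k) = go k

marks : ℕ → ℕ → ℕ → List Bool
marks a k b = plain a ++ run k ++ plain b

#false-++ : ∀ m m′ → #false (m ++ m′) ≡ #false m + #false m′
#false-++ m m′ = trans (cong (λ l → ∑ l 𝟙) (map-++ not m m′)) (∑-++ (map not m) (map not m′) 𝟙)

#false-marks : ∀ a k b → #false (marks a k b) ≡ a + (sgn k + b)
#false-marks a k b = trans (#false-++ (plain a) _) (cong₂ _+_ (#false-plain a)
  (trans (#false-++ (run k) _) (cong₂ _+_ (#false-run k) (#false-plain b))))

-- A list x of type List (Maybe Bool) describes one side: nothing for an unselected element,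
-- just m for a selected one with mark m.
restrictShuffle : List Bool → List (Maybe Bool) → List (Maybe Bool) → List Bool
restrictShuffle (true ∷ s)  (just _ ∷ x)  y             = true ∷ restrictShuffle s x y
restrictShuffle (true ∷ s)  (nothing ∷ x) y             = restrictShuffle s x y
restrictShuffle (false ∷ s) x             (just _ ∷ y)  = false ∷ restrictShuffle s x y
restrictShuffle (false ∷ s) x             (nothing ∷ y) = restrictShuffle s x y
restrictShuffle _           _             _             = []

Shuffle-restrict : ∀ {s x y} → Shuffle s x y → Shuffle (restrictShuffle s x y) (catMaybes x) (catMaybes y)
Shuffle-restrict []                            = []
Shuffle-restrict (left {x = just _} p)         = left (Shuffle-restrict p)
Shuffle-restrict (left {x = nothing} p)        = Shuffle-restrict p
Shuffle-restrict {x = []} (right {y = just _} p)       = right (Shuffle-restrict p)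
Shuffle-restrict {x = []} (right {y = nothing} p)      = Shuffle-restrict p
Shuffle-restrict {x = _ ∷ _} (right {y = just _} p)    = right (Shuffle-restrict p)
Shuffle-restrict {x = _ ∷ _} (right {y = nothing} p)   = Shuffle-restrict p

-- 1-based
Selected : List (Maybe Bool) → ℕ → Set
Selected (just _ ∷ x)  1             = T true
Selected (_ ∷ x)       (suc (suc i)) = Selected x (suc i)
Selected _             _             = ⊥

Hot : List (Maybe Bool) → ℕ → Set
Hot x i = T (hot (catMaybes (drop i x)))

-- Goodness fails when a selected letter is read while the other side is hot. The point (i , j) is
-- the one reached just after that letter: one coordinate is then a selected rank, and the other
-- lies where a run is under way.
BadVisit : List Bool → List (Maybe Bool) → List (Maybe Bool) → Set
BadVisit s x y = ∃₂ λ i j → T (visits i j s) × ((Selected x i × Hot y j) ⊎ (Hot x i × Selected y j))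

visits-true : ∀ i j {s} → T (visits i j s) → T (visits (suc i) j (true ∷ s))
visits-true i zero    v = v
visits-true i (suc j) v = v

visits-false : ∀ i j {s} → T (visits i j s) → T (visits i (suc j) (false ∷ s))
visits-false zero    j v = v
visits-false (suc i) j v = v

Selected-suc : ∀ a x i → Selected x i → Selected (a ∷ x) (suc i)
Selected-suc (just _)  x (suc i) p = p
Selected-suc nothing   x (suc i) p = p
Selected-suc (just _)  []            zero ()
Selected-suc nothing   []            zero ()
Selected-suc a         (just _ ∷ x)  zero ()
Selected-suc a         (nothing ∷ x) zero ()

BadVisit-left : ∀ {s a x y} → BadVisit s x y → BadVisit (true ∷ s) (a ∷ x) y
BadVisit-left {a = a} {x} (i , j , v , inj₁ (p , q)) = suc i , j , visits-true i j v , inj₁ (Selected-suc a x i p , q)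
BadVisit-left (i , j , v , inj₂ (p , q)) = suc i , j , visits-true i j v , inj₂ (p , q)

BadVisit-right : ∀ {s x a y} → BadVisit s x y → BadVisit (false ∷ s) x (a ∷ y)
BadVisit-right (i , j , v , inj₁ (p , q)) = i , suc j , visits-false i j v , inj₁ (p , q)
BadVisit-right {a = a} {y} (i , j , v , inj₂ (p , q)) =
    i , suc j , visits-false i j v , inj₂ (p , Selected-suc a y j q)

bad⇒BadVisit : ∀ {s x y} → Shuffle s x y →
  T (not (good (restrictShuffle s x y) (catMaybes x) (catMaybes y))) → BadVisit s x y
bad⇒BadVisit {y = y} (left {x = just _} p) b with hot (catMaybes y) in eq
... | true  = 1 , 0 , _ , inj₁ (_ , subst T (sym eq) _)
... | false = BadVisit-left (bad⇒BadVisit p b)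
bad⇒BadVisit (left {x = nothing} p) b = BadVisit-left (bad⇒BadVisit p b)
bad⇒BadVisit {x = []} (right {y = just _} p) b = BadVisit-right (bad⇒BadVisit p b)
bad⇒BadVisit {x = []} (right {y = nothing} p) b = BadVisit-right (bad⇒BadVisit p b)
bad⇒BadVisit {x = x@(_ ∷ _)} (right {y = just _} p) b with hot (catMaybes x) in eq
... | true  = 0 , 1 , _ , inj₂ (subst T (sym eq) _ , _)
... | false = BadVisit-right (bad⇒BadVisit p b)
bad⇒BadVisit {x = _ ∷ _} (right {y = nothing} p) b = BadVisit-right (bad⇒BadVisit p b)

-- Selected ranks and annotated sides

ranks : List (Maybe Bool) → List ℕ
ranks []            = []
ranks (just _ ∷ x)  = 1 ∷ map suc (ranks x)
ranks (nothing ∷ x) = map suc (ranks x)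

length-ranks : ∀ x → length (ranks x) ≡ length (catMaybes x)
length-ranks []            = refl
length-ranks (just _ ∷ x)  = cong suc (trans (length-map suc (ranks x)) (length-ranks x))
length-ranks (nothing ∷ x) = trans (length-map suc (ranks x)) (length-ranks x)

Selected⇒∈ranks : ∀ x i → Selected x i → i ∈ ranks x × i ≤ length x
Selected⇒∈ranks (just _ ∷ x)  1             _ = here refl , s≤s z≤n
Selected⇒∈ranks (just _ ∷ x)  (suc (suc i)) p with ∈r , le ← Selected⇒∈ranks x (suc i) p = there (∈.∈-map⁺ suc ∈r) , s≤s le
Selected⇒∈ranks (nothing ∷ x) (suc (suc i)) p with ∈r , le ← Selected⇒∈ranks x (suc i) p = ∈.∈-map⁺ suc ∈r , s≤s le

ranks≤ : ∀ x {i} → i ∈ ranks x → i ≤ length x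
ranks≤ (just _ ∷ x)  (here refl) = s≤s z≤n
ranks≤ (just _ ∷ x)  (there i∈) with _ , i∈′ , refl ← ∈.∈-map⁻ suc i∈ = s≤s (ranks≤ x i∈′)
ranks≤ (nothing ∷ x) i∈ with _ , i∈′ , refl ← ∈.∈-map⁻ suc i∈ = s≤s (ranks≤ x i∈′)

annotatePlain annotateRest annotateRun : List Bool → List (Maybe Bool)
annotatePlain = map (λ b → if b then just false else nothing)
annotateRest  = map (λ b → if b then just true else nothing)
annotateRun []          = []
annotateRun (true ∷ μ)  = just false ∷ annotateRest μ
annotateRun (false ∷ μ) = nothing ∷ annotateRun μ

catMaybes-annotatePlain : ∀ α → catMaybes (annotatePlain α) ≡ plain (# α)
catMaybes-annotatePlain []          = refl
catMaybes-annotatePlain (true ∷ α)  = cong (false ∷_) (catMaybes-annotatePlain α)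
catMaybes-annotatePlain (false ∷ α) = catMaybes-annotatePlain α

catMaybes-annotateRun : ∀ μ → catMaybes (annotateRun μ) ≡ run (# μ)
catMaybes-annotateRun []          = refl
catMaybes-annotateRun (true ∷ μ)  = cong (false ∷_) (go μ)
  where
  go : ∀ μ → catMaybes (annotateRest μ) ≡ replicate (# μ) true
  go []          = refl
  go (true ∷ μ)  = cong (true ∷_) (go μ)
  go (false ∷ μ) = go μ
catMaybes-annotateRun (false ∷ μ) = catMaybes-annotateRun μ

length-annotateRun : ∀ μ → length (annotateRun μ) ≡ length μ
length-annotateRun []          = refl
length-annotateRun (true ∷ μ)  = cong suc (length-map _ μ)
length-annotateRun (false ∷ μ) = cong suc (length-annotateRun μ)

-- `α` and `β` record the selection in the two chains, `μ` the selection in the copy between them,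
-- read along its linear extension.
annotate : List Bool → List Bool → List Bool → List (Maybe Bool)
annotate α μ β = annotatePlain α ++ annotateRun μ ++ annotatePlain β

catMaybes-annotate : ∀ α μ β → catMaybes (annotate α μ β) ≡ marks (# α) (# μ) (# β)
catMaybes-annotate α μ β = trans (catMaybes-++ (annotatePlain α) _) (cong₂ _++_ (catMaybes-annotatePlain α)
  (trans (catMaybes-++ (annotateRun μ) _) (cong₂ _++_ (catMaybes-annotateRun μ) (catMaybes-annotatePlain β))))

hot-plain : ∀ β → ¬ T (hot (catMaybes (annotatePlain β)))
hot-plain (true ∷ β)  ()
hot-plain (false ∷ β) = hot-plain β

hot-drop-plain : ∀ β i → ¬ Hot (annotatePlain β) i
hot-drop-plain β           zero    = hot-plain β
hot-drop-plain (b ∷ β)     (suc i) = hot-drop-plain β i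

hot-run : ∀ μ β → ¬ T (hot (catMaybes (annotateRun μ ++ annotatePlain β)))
hot-run []          β = hot-plain β
hot-run (true ∷ μ)  β ()
hot-run (false ∷ μ) β = hot-run μ β

Hot-++⁻ : ∀ (x : List (Maybe Bool)) {y} i → (∀ j → ¬ Hot y j) → Hot (x ++ y) i → i ≤ length x
Hot-++⁻ x       zero    none p = z≤n
Hot-++⁻ []      (suc i) none p = ⊥-elim (none (suc i) p)
Hot-++⁻ (_ ∷ x) (suc i) none p = s≤s (Hot-++⁻ x i none p)

-- Hot marks occur only inside a run, so a hot coordinate has only `length μ + 1` possible values,
-- however long the chains are.
Hot-annotate : ∀ α μ β i → Hot (annotate α μ β) i → length α ≤ i × i ≤ length α + length μ
Hot-annotate []          μ β i p = z≤n , ℕ.≤-trans (Hot-++⁻ (annotateRun μ) i (hot-drop-plain β) p)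
    (ℕ.≤-reflexive (length-annotateRun μ))
Hot-annotate (b ∷ α)     μ β (suc i) p with l , u ← Hot-annotate α μ β i p = s≤s l , s≤s u
Hot-annotate (true ∷ α)  μ β zero ()
Hot-annotate (false ∷ α) μ β zero p = ⊥-elim (go α p)
  where
  go : ∀ α → ¬ T (hot (catMaybes (annotate α μ β)))
  go []          = hot-run μ β
  go (true ∷ α)  ()
  go (false ∷ α) = go α

Shuffle-relabel : ∀ {s} {xs : List A} {ys : List C} {xs′ : List A′} {ys′ : List C′} →
  length xs ≡ length xs′ → length ys ≡ length ys′ → Shuffle s xs ys → Shuffle s xs′ ys′
Shuffle-relabel {xs′ = []}    {[]}    eq eq′ []        = []
Shuffle-relabel {xs′ = _ ∷ _}         eq eq′ (left p)  = left (Shuffle-relabel (ℕ.suc-injective eq) eq′ p)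
Shuffle-relabel {ys′ = _ ∷ _}         eq eq′ (right p) = right (Shuffle-relabel eq (ℕ.suc-injective eq′) p)

∈-shuffles⇒Shuffle : ∀ (xs : List A) (ys : List C) {s} → s ∈ shuffles (length xs) (length ys) → Shuffle s xs ys
∈-shuffles⇒Shuffle [] ys (here refl) = go ys
  where
  go : ∀ ys → Shuffle (replicate (length ys) false) [] ys
  go []       = []
  go (y ∷ ys) = right (go ys)
∈-shuffles⇒Shuffle (x ∷ xs) [] (here refl) = left (go xs)
  where
  go : ∀ xs → Shuffle (replicate (length xs) true) xs []
  go []       = []
  go (x ∷ xs) = left (go xs)
∈-shuffles⇒Shuffle (x ∷ xs) (y ∷ ys) s∈ with ∈.∈-++⁻ (map (true ∷_) (shuffles (length xs) (suc (length ys)))) s∈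
... | inj₁ p with s , s∈′ , refl ← ∈.∈-map⁻ (true ∷_) p = left (∈-shuffles⇒Shuffle xs (y ∷ ys) s∈′)
... | inj₂ p with s , s∈′ , refl ← ∈.∈-map⁻ (false ∷_) p = right (∈-shuffles⇒Shuffle (x ∷ xs) ys s∈′)

Shuffle⇒∈-shuffles : ∀ {xs : List A} {ys : List C} {s} → Shuffle s xs ys → s ∈ shuffles (length xs) (length ys)
Shuffle⇒∈-shuffles [] = here refl
Shuffle⇒∈-shuffles (left {xs = xs} {[]} p) with Shuffle⇒∈-shuffles p
... | q rewrite shuffles-zeroʳ (length xs) with here refl ← q = here refl
Shuffle⇒∈-shuffles (left {ys = _ ∷ _} p) = ∈.∈-++⁺ˡ (∈.∈-map⁺ (true ∷_) (Shuffle⇒∈-shuffles p))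
Shuffle⇒∈-shuffles (right {xs = []} p) with here refl ← Shuffle⇒∈-shuffles p = here refl
Shuffle⇒∈-shuffles (right {xs = _ ∷ xs} {ys = ys} p) =
  ∈.∈-++⁺ʳ (map (true ∷_) (shuffles (length xs) (suc (length ys)))) (∈.∈-map⁺ (false ∷_) (Shuffle⇒∈-shuffles p))

shuffles-unique : ∀ m n → Unique (shuffles m n)
shuffles-unique zero    n       = [] ∷ []
shuffles-unique (suc m) zero    = [] ∷ []
shuffles-unique (suc m) (suc n) = Unique.++⁺
  (Unique.map⁺ ∷-injectiveʳ (shuffles-unique m (suc n))) (Unique.map⁺ ∷-injectiveʳ (shuffles-unique (suc m) n))
  λ { (p , q) → disjoint (∈.∈-map⁻ (true ∷_) p) (∈.∈-map⁻ (false ∷_) q) }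
  where
  disjoint : ∀ {v : List Bool} {S S′} → (∃ λ s → s ∈ S × v ≡ true ∷ s) → (∃ λ s → s ∈ S′ × v ≡ false ∷ s) → ⊥
  disjoint (_ , _ , refl) (_ , _ , ())

-- The Boolean argument depends only on the set X, so the decoder knows it; the leading bit of the
-- flagged variant depends on the word.
codeShuffle : Bool → (M₁ M₂ t : List Bool) → List Bool
codeShuffle false M₁ M₂ t = encode t (plain (length M₁)) (plain (length M₂))
codeShuffle true  M₁ M₂ t = if good t M₁ M₂ then true ∷ encode t M₁ M₂ else false ∷ codeShuffle false M₁ M₂ t

Shuffle-plain : ∀ {t} {M₁ M₂ : List Bool} → Shuffle t M₁ M₂ → Shuffle t (plain (length M₁)) (plain (length M₂))
Shuffle-plain {M₁ = M₁} {M₂} = Shuffle-relabel (sym (length-replicate (length M₁)))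
    (sym (length-replicate (length M₂)))

codeShuffle-decodable : ∀ f {M₁ M₂ t t′} → Shuffle t M₁ M₂ → Shuffle t′ M₁ M₂ →
  ∀ {s s′} → codeShuffle f M₁ M₂ t ++ s ≡ codeShuffle f M₁ M₂ t′ ++ s′ → t ≡ t′ × s ≡ s′
codeShuffle-decodable false {M₁} {M₂} {t} {t′} p q eq = encode-decodable (Shuffle-plain p) (Shuffle-plain q)
  (good-plain t (length M₁) (length M₂)) (good-plain t′ (length M₁) (length M₂)) eq
codeShuffle-decodable true {M₁} {M₂} {t} {t′} p q eq with good t M₁ M₂ in g | good t′ M₁ M₂ in g′
... | true  | true  = encode-decodable p q (subst T (sym g) _) (subst T (sym g′) _) (∷-injectiveʳ eq)
... | false | false = codeShuffle-decodable false p q (∷-injectiveʳ eq)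
... | true  | false with () ← ∷-injectiveˡ eq
... | false | true  with () ← ∷-injectiveˡ eq

length-codeShuffle-false : ∀ {M₁ M₂ t} → Shuffle t M₁ M₂ → length (codeShuffle false M₁ M₂ t) ≤
    length M₁ + length M₂ ∸ 1
length-codeShuffle-false {M₁} {M₂} p = ℕ.≤-trans (length-encode (Shuffle-plain p))
  (ℕ.≤-reflexive (cong (_∸ 1) (cong₂ _+_ (#false-plain (length M₁)) (#false-plain (length M₂)))))

1+[n∸1]≡n : ∀ {n} → 0 < n → suc (n ∸ 1) ≡ n
1+[n∸1]≡n {suc n} _ = refl

-- A good word costs the flag and at most b - 1 bits. For a bad word the flag is charged to b, which
-- therefore has to be positive, and the full word to the second term.
length-codeShuffle-true : ∀ {M₁ M₂ t} → Shuffle t M₁ M₂ → let b = #false M₁ + #false M₂ in 0 < b →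
  length (codeShuffle true M₁ M₂ t) ≤ b + 𝟙 (not (good t M₁ M₂)) * (length M₁ + length M₂)
length-codeShuffle-true {M₁} {M₂} {t} p b>0 with good t M₁ M₂
... | true  = ℕ.≤-trans (s≤s (length-encode p)) (ℕ.≤-reflexive (trans (1+[n∸1]≡n b>0) (sym (ℕ.+-identityʳ _))))
... | false = ℕ.+-mono-≤ b>0 (ℕ.≤-trans (length-codeShuffle-false p)
                (ℕ.≤-trans (ℕ.m∸n≤m _ 1) (ℕ.≤-reflexive (sym (ℕ.+-identityʳ _)))))

-- The probability of a bad interleaving

window : ℕ → ℕ → List ℕ
window ℓ N = map (ℓ ℕ.+_) (upTo (suc N))

∈-window : ∀ {ℓ N i} → ℓ ≤ i → i ≤ ℓ + N → i ∈ window ℓ N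
∈-window {ℓ} {N} ℓ≤i i≤ with d , refl ← ℕ.m≤n⇒∃[o]m+o≡n ℓ≤i =
  ∈.∈-map⁺ (ℓ ℕ.+_) (∈.∈-upTo⁺ (s≤s (ℕ.+-cancelˡ-≤ ℓ d N i≤)))

window-bounds : ∀ {ℓ N i} → i ∈ window ℓ N → ℓ ≤ i × i ≤ ℓ + N
window-bounds {ℓ} i∈ with d , d∈ , refl ← ∈.∈-map⁻ (ℓ ℕ.+_) i∈ = ℕ.m≤m+n ℓ d , ℕ.+-monoʳ-≤ ℓ (ℕ.≤-pred (∈.∈-upTo⁻ d∈))

length-window : ∀ ℓ N → length (window ℓ N) ≡ suc N
length-window ℓ N = trans (length-map (ℓ ℕ.+_) (upTo (suc N))) (length-upTo (suc N))

∑-swap₃ : ∀ {A C D : Set} (ss : List A) (is : List C) (js : List D) (f : A → C → D → ℕ) →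
  ∑ ss (λ s → ∑ is λ i → ∑ js λ j → f s i j) ≡ ∑ is (λ i → ∑ js λ j → ∑ ss λ s → f s i j)
∑-swap₃ ss is js f = trans (∑-swap ss is _) (∑-cong is λ i → ∑-swap ss js _)

module NearCentre (D ℓ N : ℕ) (ℓ>0 : 0 < ℓ) (D≤ : D * D * (4 * (ℓ + (N + ℓ))) ≤ (2 * ℓ + 1) * (2 * ℓ + 1)) where

  private
    m : ℕ
    m = ℓ + (N + ℓ)

  -- Only the coordinate in the window is at distance at least ℓ from both ends; by `B-upper` that
  -- is enough. The two orientations serve the two alternatives of `BadVisit`.
  ∑-visits-near-centre : ∀ {i j} → ℓ ≤ i → i ≤ ℓ + N → j ≤ m →
    D * ∑ (shuffles m m) (𝟙 ∘ visits i j) ≤ B m m × D * ∑ (shuffles m m) (𝟙 ∘ visits j i) ≤ B m m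
  ∑-visits-near-centre {i} {j} ℓ≤i i≤ j≤m =
    ℕ.≤-trans (ℕ.*-monoʳ-≤ D (count i j i≤m j≤m)) point ,
    ℕ.≤-trans (ℕ.*-monoʳ-≤ D (ℕ.≤-trans (count j i j≤m i≤m)
        (ℕ.≤-reflexive (cong₂ _*_ (B-comm j i) (B-comm (m ∸ j) (m ∸ i)))))) point
    where
    ℓ+N+ℓ≡m : ℓ + N + ℓ ≡ m
    ℓ+N+ℓ≡m = ℕ.+-assoc ℓ N ℓ
    i≤m : i ≤ m
    i≤m = ℕ.≤-trans i≤ (ℕ.≤-trans (ℕ.m≤m+n (ℓ + N) ℓ) (ℕ.≤-reflexive ℓ+N+ℓ≡m))
    count : ∀ i j → i ≤ m → j ≤ m → ∑ (shuffles m m) (𝟙 ∘ visits i j) ≤ B i j * B (m ∸ i) (m ∸ j)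
    count i j i≤m j≤m = subst₂ (λ a b → ∑ (shuffles a b) (𝟙 ∘ visits i j) ≤ B i j * B (m ∸ i) (m ∸ j))
      (ℕ.m+[n∸m]≡n i≤m) (ℕ.m+[n∸m]≡n j≤m) (∑-visits i j (m ∸ i) (m ∸ j))
    point : D * (B i j * B (m ∸ i) (m ∸ j)) ≤ B m m
    point = B-visit D ℓ i (m ∸ i) j (m ∸ j) m (ℕ.m+[n∸m]≡n i≤m) (ℕ.m+[n∸m]≡n j≤m) ℓ≤i
      (ℕ.m+n≤o⇒m≤o∸n ℓ (ℕ.≤-trans (ℕ.≤-reflexive (ℕ.+-comm ℓ i))
          (ℕ.≤-trans (ℕ.+-monoˡ-≤ ℓ i≤) (ℕ.≤-reflexive ℓ+N+ℓ≡m)))) (ℕ.≤-trans ℓ>0 (ℕ.m≤m+n ℓ _)) D≤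

  module Sides {α₁ μ₁ β₁ α₂ μ₂ β₂ : List Bool}
    (|α₁| : length α₁ ≡ ℓ) (|μ₁| : length μ₁ ≡ N) (|β₁| : length β₁ ≡ ℓ)
    (|α₂| : length α₂ ≡ ℓ) (|μ₂| : length μ₂ ≡ N) (|β₂| : length β₂ ≡ ℓ) where

    private
      x₁ x₂ : List (Maybe Bool)
      x₁ = annotate α₁ μ₁ β₁
      x₂ = annotate α₂ μ₂ β₂

      length-annotate : ∀ α μ β → length α ≡ ℓ → length μ ≡ N → length β ≡ ℓ → length (annotate α μ β) ≡ m
      length-annotate α μ β refl refl eq = trans (length-++ (annotatePlain α)) (cong₂ _+_ (length-map _ α)
        (trans (length-++ (annotateRun μ)) (cong₂ _+_ (length-annotateRun μ) (trans (length-map _ β) eq))))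

    length-x₁ : length x₁ ≡ m
    length-x₁ = length-annotate α₁ μ₁ β₁ |α₁| |μ₁| |β₁|

    length-x₂ : length x₂ ≡ m
    length-x₂ = length-annotate α₂ μ₂ β₂ |α₂| |μ₂| |β₂|

    isBad : List Bool → Bool
    isBad s = not (good (restrictShuffle s x₁ x₂) (catMaybes x₁) (catMaybes x₂))

    private
      W J₁ J₂ : List ℕ
      W  = window ℓ N
      J₁ = ranks x₁
      J₂ = ranks x₂

      hot-window : ∀ α μ β → length α ≡ ℓ → length μ ≡ N → ∀ i → Hot (annotate α μ β) i → i ∈ W
      hot-window α μ β refl refl i p with l , u ← Hot-annotate α μ β i p = ∈-window l u

      one≤ : ∀ b → T b → 1 ≤ 𝟙 b
      one≤ true _ = ℕ.≤-refl

      V₁ V₂ : List Bool → ℕ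
      V₁ s = ∑ J₁ λ i → ∑ W λ j → 𝟙 (visits i j s)
      V₂ s = ∑ W λ i → ∑ J₂ λ j → 𝟙 (visits i j s)

    isBad≤ : ∀ s → s ∈ shuffles m m → 𝟙 (isBad s) ≤ V₁ s + V₂ s
    isBad≤ s s∈ with isBad s in eq
    ... | false = z≤n
    ... | true with bad⇒BadVisit (∈-shuffles⇒Shuffle x₁ x₂ (subst₂ (λ a b → s ∈ shuffles a b) (sym length-x₁) (sym length-x₂) s∈)) (subst T (sym eq) _)
    ... | i , j , v , inj₁ (sel , h) = ℕ.≤-trans (ℕ.≤-trans (one≤ _ v)
            (ℕ.≤-trans (term≤∑ (λ j → 𝟙 (visits i j s)) (hot-window α₂ μ₂ β₂ |α₂| |μ₂| j h))
                       (term≤∑ (λ i → ∑ W λ j → 𝟙 (visits i j s)) (proj₁ (Selected⇒∈ranks x₁ i sel)))))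
                           (ℕ.m≤m+n (V₁ s) (V₂ s))
    ... | i , j , v , inj₂ (h , sel) = ℕ.≤-trans (ℕ.≤-trans (one≤ _ v)
            (ℕ.≤-trans (term≤∑ (λ j → 𝟙 (visits i j s)) (proj₁ (Selected⇒∈ranks x₂ j sel)))
                       (term≤∑ (λ i → ∑ J₂ λ j → 𝟙 (visits i j s)) (hot-window α₁ μ₁ β₁ |α₁| |μ₁| i h))))
                           (ℕ.m≤n+m (V₂ s) (V₁ s))

    -- Union bound over the pairs of a selected rank on one side and a window value on the other.
    -- Since the window has `suc N` values, the number of pairs is free of ℓ apart from the number
    -- of selected points.
    ∑-isBad : D * ∑ (shuffles m m) (𝟙 ∘ isBad) ≤ suc N * (length (catMaybes x₁) + length (catMaybes x₂)) * B m m
    ∑-isBad = begin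
      D * ∑ S (𝟙 ∘ isBad)
        ≤⟨ ℕ.*-monoʳ-≤ D (∑-mono-∈ S isBad≤) ⟩
      D * ∑ S (λ s → V₁ s + V₂ s)
        ≡⟨ cong (D *_) (trans (∑-+ S V₁ V₂) (cong₂ _+_ (∑-swap₃ S J₁ W _) (∑-swap₃ S W J₂ _))) ⟩
      D * (∑ J₁ (λ i → ∑ W λ j → V i j) + ∑ W (λ i → ∑ J₂ λ j → V i j))
        ≡⟨ ℕ.*-distribˡ-+ D (∑ J₁ λ i → ∑ W λ j → V i j) _ ⟩
      D * ∑ J₁ (λ i → ∑ W λ j → V i j) + D * ∑ W (λ i → ∑ J₂ λ j → V i j)
        ≤⟨ ℕ.+-mono-≤ (bound J₁ W λ i i∈ j j∈ →
            proj₂ (∑-visits-near-centre (proj₁ (window-bounds j∈)) (proj₂ (window-bounds j∈))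
                                (ℕ.≤-trans (ranks≤ x₁ i∈) (ℕ.≤-reflexive length-x₁))))
                      (bound W J₂ λ i i∈ j j∈ →
                          proj₁ (∑-visits-near-centre (proj₁ (window-bounds i∈)) (proj₂ (window-bounds i∈))
                                (ℕ.≤-trans (ranks≤ x₂ j∈) (ℕ.≤-reflexive length-x₂)))) ⟩
      length J₁ * (length W * B m m) + length W * (length J₂ * B m m)
        ≡⟨ cong₂ (λ a b → a * (length W * B m m) + length W * (b * B m m)) (length-ranks x₁) (length-ranks x₂) ⟩
      length (catMaybes x₁) * (length W * B m m) + length W * (length (catMaybes x₂) * B m m)
        ≡⟨ cong (λ w → length (catMaybes x₁) * (w * B m m) + w * (length (catMaybes x₂) * B m m))
            (length-window ℓ N) ⟩
      length (catMaybes x₁) * (suc N * B m m) + suc N * (length (catMaybes x₂) * B m m)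
        ≡⟨ lemma (length (catMaybes x₁)) (length (catMaybes x₂)) (suc N) (B m m) ⟩
      suc N * (length (catMaybes x₁) + length (catMaybes x₂)) * B m m ∎
      where
      open ℕ.≤-Reasoning
      S = shuffles m m
      V : ℕ → ℕ → ℕ
      V i j = ∑ S λ s → 𝟙 (visits i j s)
      lemma : ∀ a b w c → a * (w * c) + w * (b * c) ≡ w * (a + b) * c
      lemma = solve-∀
      bound : ∀ is js → (∀ i → i ∈ is → ∀ j → j ∈ js → D * V i j ≤ B m m) →
        D * ∑ is (λ i → ∑ js λ j → V i j) ≤ length is * (length js * B m m)
      bound is js le = begin
        D * ∑ is (λ i → ∑ js λ j → V i j) ≡⟨ ∑-*ˡ is D _ ⟨
        ∑ is (λ i → D * ∑ js λ j → V i j) ≡⟨ ∑-cong is (λ i → sym (∑-*ˡ js D _)) ⟩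
        ∑ is (λ i → ∑ js λ j → D * V i j) ≤⟨ ∑-mono-∈ is (λ i i∈ → ∑-mono-∈ js λ j j∈ → le i i∈ j j∈) ⟩
        ∑ is (λ i → ∑ js λ j → B m m) ≡⟨ trans (∑-cong is λ i → ∑-const js (B m m)) (∑-const is _) ⟩
        length is * (length js * B m m) ∎

-- Linear extensions as total orderings

-- Because `_⊑_` is reflexive, the pairwise condition also excludes repetitions.
IsOrdering : (Q : FinPoset) → List (Fin (size Q)) → Set
IsOrdering Q w = AllPairs (λ x y → ¬ (y ⊑ x)) w × (∀ x → x ∈ w)
  where open FinPoset Q using (_⊑_)

unique-set⇒↭ : {xs ys : List A} → Unique xs → Unique ys →
  (∀ {x} → x ∈ xs → x ∈ ys) → (∀ {x} → x ∈ ys → x ∈ xs) → xs ↭ ys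
unique-set⇒↭ u v to from = ∼bag⇒↭ (∈.unique∧set⇒bag u v (mk⇔ to from))

unique-map : ∀ (f : A → C) {xs} → (∀ {x y} → x ∈ xs → y ∈ xs → f x ≡ f y → x ≡ y) → Unique xs → Unique (map f xs)
unique-map f {[]}     inj []       = []
unique-map f {x ∷ xs} inj (x∉ ∷ u) =
  All.map⁺ (All.tabulate λ y∈ eq → All.lookup x∉ y∈ (inj (here refl) (there y∈) eq)) ∷
  unique-map f (λ a b → inj (there a) (there b)) u

filter-singleton : ∀ {p} {P : A → Set p} (P? : ∀ x → Dec (P x)) {xs y} → Unique xs → y ∈ xs → P y →
  (∀ {x} → P x → x ≡ y) → filter P? xs ≡ [ y ]
filter-singleton P? {x ∷ xs} (x∉ ∷ u) (here refl) py only = trans (filter-accept P? py)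
  (cong (x ∷_) (filter-none P? (All.map (λ x≢z pz → x≢z (sym (only pz))) x∉)))
filter-singleton P? {x ∷ xs} (x∉ ∷ u) (there y∈) py only =
  trans (filter-reject P? λ px → All.lookup x∉ y∈ (only px)) (filter-singleton P? u y∈ py only)

-- 0-based; the length of the list for absent elements.
index : ∀ {n} → Fin n → List (Fin n) → ℕ
index x []      = 0
index x (y ∷ w) = if does (x Fin.≟ y) then 0 else suc (index x w)

index-here : ∀ {n} (x : Fin n) w → index x (x ∷ w) ≡ 0
index-here x w with x Fin.≟ x
... | yes _   = refl
... | no  x≢x = ⊥-elim (x≢x refl)

index-there : ∀ {n} {x y : Fin n} w → x ≢ y → index x (y ∷ w) ≡ suc (index x w)
index-there {x = x} {y} w x≢y with x Fin.≟ y
... | yes x≡y = ⊥-elim (x≢y x≡y)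
... | no  _   = refl

index-< : ∀ {n} {x : Fin n} {w} → x ∈ w → index x w < length w
index-< {x = x} {y ∷ w} x∈ with x Fin.≟ y
... | yes _   = s≤s z≤n
index-< {w = y ∷ w} (here x≡y) | no x≢y = ⊥-elim (x≢y x≡y)
index-< {w = y ∷ w} (there x∈) | no x≢y = s≤s (index-< x∈)

index-∉ : ∀ {n} {x : Fin n} w → x ∉ w → index x w ≡ length w
index-∉ []      x∉ = refl
index-∉ (y ∷ w) x∉ = trans (index-there w (x∉ ∘ here)) (cong suc (index-∉ w (x∉ ∘ there)))

index-tabulate : ∀ {k n} (g : Fin k → Fin n) → Injective _≡_ _≡_ g → ∀ i → index (g i) (tabulate g) ≡ toℕ i
index-tabulate g inj zero    = index-here (g zero) (tabulate (g ∘ suc))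
index-tabulate g inj (suc i) = trans (index-there (tabulate (g ∘ suc)) λ eq → Fin.0≢1+n (sym (inj eq)))
  (cong suc (index-tabulate (g ∘ suc) (Fin.suc-injective ∘ inj) i))

index-injective : ∀ {n} {x y : Fin n} w → x ∈ w → index x w ≡ index y w → x ≡ y
index-injective {x = x} {y} (z ∷ w) x∈ eq with x Fin.≟ z | y Fin.≟ z
... | yes refl | yes refl = refl
index-injective (z ∷ w) x∈ () | yes _ | no _
index-injective (z ∷ w) x∈ () | no _ | yes _
index-injective (z ∷ w) (here x≡z) eq | no x≢z | no _ = ⊥-elim (x≢z x≡z)
index-injective (z ∷ w) (there x∈) eq | no _   | no _ = index-injective w x∈ (ℕ.suc-injective eq)

index-ext : ∀ {n} (u w : List (Fin n)) → Unique u → Unique w → length u ≡ length w →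
  (∀ x → index x u ≡ index x w) → u ≡ w
index-ext []      []      _        _        _  _  = refl
index-ext (x ∷ u) (y ∷ w) (x∉ ∷ uu) (y∉ ∷ uw) le eq with x Fin.≟ y
... | no x≢y with () ← trans (sym (index-here x u)) (trans (eq x) (index-there w x≢y))
... | yes refl = cong (x ∷_) (index-ext u w uu uw (ℕ.suc-injective le) onTails)
  where
  onTails : ∀ z → index z u ≡ index z w
  onTails z with z Fin.≟ x
  ... | yes refl = trans (index-∉ u λ x∈ → All.lookup x∉ x∈ refl)
                     (trans (ℕ.suc-injective le) (sym (index-∉ w λ x∈ → All.lookup y∉ x∈ refl)))
  ... | no  z≢x  = ℕ.suc-injective (trans (sym (index-there u z≢x)) (trans (eq z) (index-there w z≢x)))

AllPairs-index : ∀ {n} {R : Fin n → Fin n → Set} {w x y} → AllPairs R w → x ∈ w → y ∈ w →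
    index x w < index y w → R x y
AllPairs-index {w = z ∷ w} {x} {y} (rz ∷ rs) x∈ y∈ lt with x Fin.≟ z | y Fin.≟ z
AllPairs-index (rz ∷ rs) x∈ y∈ () | _ | yes _
AllPairs-index (rz ∷ rs) x∈ (here y≡z) lt | _ | no y≢z = ⊥-elim (y≢z y≡z)
AllPairs-index (rz ∷ rs) x∈ (there y∈) lt | yes refl | no _ = All.lookup rz y∈
AllPairs-index (rz ∷ rs) (here x≡z) (there y∈) lt | no x≢z | no _ = ⊥-elim (x≢z x≡z)
AllPairs-index (rz ∷ rs) (there x∈) (there y∈) (s≤s lt) | no _ | no _ = AllPairs-index rs x∈ y∈ lt

∈-index : ∀ {n} {w : List (Fin n)} → Unique w → ∀ {i} → i < length w → ∃ λ x → x ∈ w × index x w ≡ i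
∈-index {w = x ∷ w} (x∉ ∷ u) {zero}  _        = x , here refl , index-here x w
∈-index {w = x ∷ w} (x∉ ∷ u) {suc i} (s≤s lt) with y , y∈ , eq ← ∈-index u lt =
  y , there y∈ , trans (index-there w λ { refl → All.lookup x∉ y∈ refl }) (cong suc eq)

∈-allVecs : ∀ {n} (xs : List A) (v : Vec A n) → (∀ i → Vec.lookup v i ∈ xs) → v ∈ allVecs xs n
∈-allVecs xs []      all = here refl
∈-allVecs xs (x ∷ v) all = ∈.∈-cartesianProductWith⁺ _∷_ (all zero) (∈-allVecs xs v (all ∘ suc))

allVecs-unique : ∀ {xs : List A} n → Unique xs → Unique (allVecs xs n)
allVecs-unique zero    u = [] ∷ []
allVecs-unique (suc n) u = Unique.cartesianProductWith⁺ _∷_ Vec.∷-injective u (allVecs-unique n u)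

module _ (Q : FinPoset) where
  open FinPoset Q using (_⊑_; isPartialOrder)
  private
    n : ℕ
    n = size Q

    ⊑-refl : ∀ {x} → x ⊑ x
    ⊑-refl = IsPartialOrder.refl isPartialOrder

  IsOrdering⇒Unique : ∀ {w} → IsOrdering Q w → Unique w
  IsOrdering⇒Unique (pairs , _) = AllPairs.map (λ { ¬y⊑x refl → ¬y⊑x ⊑-refl }) pairs

  IsOrdering⇒length : ∀ {w} → IsOrdering Q w → length w ≡ n
  IsOrdering⇒length {w} ord = trans (↭.↭-length
      (unique-set⇒↭ {xs = w} {allFin n} (IsOrdering⇒Unique ord) (Unique.allFin⁺ n)
    (λ {x} _ → ∈.∈-allFin x) (λ {x} _ → proj₂ ord x))) (length-tabulate id)

  module _ (f : Labelling Q) (le : IsLinearExtension Q f) where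
    private
      inverse : Fin n → Fin n
      inverse i = proj₁ (proj₂ (proj₁ le) i)

      f-inverse : ∀ i → Vec.lookup f (inverse i) ≡ i
      f-inverse i = proj₂ (proj₂ (proj₁ le) i) refl

      inverse-injective : Injective _≡_ _≡_ inverse
      inverse-injective {i} {j} eq = trans (sym (f-inverse i)) (trans (cong (Vec.lookup f) eq) (f-inverse j))

      inverse-f : ∀ x → inverse (Vec.lookup f x) ≡ x
      inverse-f x = proj₁ (proj₁ le) (f-inverse (Vec.lookup f x))

    -- A bijection puts exactly one element at each position, so every filter in `ordering` returns
    -- a singleton.
    ordering≡tabulate : ordering Q f ≡ tabulate inverse
    ordering≡tabulate = trans (concatMap-cong
        (λ i → filter-singleton (λ x → Vec.lookup f x Fin.≟ i) (Unique.allFin⁺ n)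
        (∈.∈-allFin (inverse i)) (f-inverse i) (λ { refl → sym (inverse-f _) })) (allFin n))
      (trans (concatMap-pure-map (allFin n)) (map-tabulate id inverse))
      where
      concatMap-pure-map : ∀ is → concatMap (λ i → [ inverse i ]) is ≡ map inverse is
      concatMap-pure-map []       = refl
      concatMap-pure-map (i ∷ is) = cong (inverse i ∷_) (concatMap-pure-map is)

    index-ordering : ∀ x → index x (ordering Q f) ≡ toℕ (Vec.lookup f x)
    index-ordering x = trans (cong₂ index (sym (inverse-f x)) ordering≡tabulate)
      (index-tabulate inverse inverse-injective (Vec.lookup f x))

    ordering-isOrdering : IsOrdering Q (ordering Q f)
    ordering-isOrdering = subst (IsOrdering Q) (sym ordering≡tabulate)
      ( AllPairs.tabulate⁺-< (λ {i} {j} i<j gj⊑gi → ℕ.<⇒≱ i<j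
          (subst₂ Fin._≤_ (f-inverse j) (f-inverse i) (proj₂ le (inverse j) (inverse i) gj⊑gi)))
      , λ x → subst (_∈ tabulate inverse) (inverse-f x) (∈.∈-tabulate⁺ (Vec.lookup f x)) )

  ∈-linearExtensions⁻ : ∀ {f} → f ∈ linearExtensions Q → IsLinearExtension Q f
  ∈-linearExtensions⁻ f∈ = proj₂ (∈.∈-filter⁻ (isLinearExtension? Q) {xs = allVecs (allFin n) n} f∈)

  ordering-injective : ∀ {f f′} → f ∈ linearExtensions Q → f′ ∈ linearExtensions Q → ordering Q f ≡
      ordering Q f′ → f ≡ f′
  ordering-injective {f} {f′} f∈ f′∈ eq = trans (sym (Vec.tabulate∘lookup f))
      (trans (Vec.tabulate-cong same) (Vec.tabulate∘lookup f′))
    where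
    same : ∀ x → Vec.lookup f x ≡ Vec.lookup f′ x
    same x = Fin.toℕ-injective (trans (sym (index-ordering f (∈-linearExtensions⁻ f∈) x))
      (trans (cong (index x) eq) (index-ordering f′ (∈-linearExtensions⁻ f′∈) x)))

  module _ (w : List (Fin n)) (ord : IsOrdering Q w) where
    private
      index<n : ∀ x → index x w < n
      index<n x = subst (index x w <_) (IsOrdering⇒length ord) (index-< (proj₂ ord x))

    labelling : Labelling Q
    labelling = Vec.tabulate (λ x → Fin.fromℕ< (index<n x))

    toℕ-labelling : ∀ x → toℕ (Vec.lookup labelling x) ≡ index x w
    toℕ-labelling x = trans (cong toℕ (Vec.lookup∘tabulate _ x)) (Fin.toℕ-fromℕ< (index<n x))

    labelling-isLinearExtension : IsLinearExtension Q labelling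
    labelling-isLinearExtension =
      ( (λ {x} {y} eq → index-injective w (proj₂ ord x)
          (trans (sym (toℕ-labelling x)) (trans (cong toℕ eq) (toℕ-labelling y))))
      , λ i → surjective i (∈-index (IsOrdering⇒Unique ord)
          (subst (toℕ i <_) (sym (IsOrdering⇒length ord)) (Fin.toℕ<n i))) ) ,
      λ x y x⊑y → ℕ.≮⇒≥ λ fy<fx → AllPairs-index (proj₁ ord) (proj₂ ord y) (proj₂ ord x)
        (subst₂ _<_ (toℕ-labelling y) (toℕ-labelling x) fy<fx) x⊑y
      where
      surjective : ∀ i → (∃ λ x → x ∈ w × index x w ≡ toℕ i) → ∃ λ x → ∀ {z} → z ≡ x → Vec.lookup labelling z ≡ i
      surjective i (x , _ , eq) = x , λ { refl → Fin.toℕ-injective (trans (toℕ-labelling x) eq) }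

    labelling∈ : labelling ∈ linearExtensions Q
    labelling∈ = ∈.∈-filter⁺ (isLinearExtension? Q)
        (∈-allVecs (allFin n) labelling λ i → ∈.∈-allFin _) labelling-isLinearExtension

    ordering-labelling : ordering Q labelling ≡ w
    ordering-labelling = index-ext (ordering Q labelling) w (IsOrdering⇒Unique ord′) (IsOrdering⇒Unique ord)
      (trans (IsOrdering⇒length ord′) (sym (IsOrdering⇒length ord)))
      λ x → trans (index-ordering labelling labelling-isLinearExtension x) (toℕ-labelling x)
      where ord′ = ordering-isOrdering labelling labelling-isLinearExtension

-- `linearExtensions` filters all tables and has no structure along sums of posets. A duplicate-free
-- complete list of orderings built along the sums is a permutation of it, and positions and code
-- costs depend only on sums over the list.
record Enumeration (Q : FinPoset) : Set where
  no-eta-equality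
  field
    orderings : List (List (Fin (size Q)))
    unique    : Unique orderings
    sound     : ∀ {w} → w ∈ orderings → IsOrdering Q w
    complete  : ∀ {w} → IsOrdering Q w → w ∈ orderings

  map-ordering-↭ : map (ordering Q) (linearExtensions Q) ↭ orderings
  map-ordering-↭ = unique-set⇒↭ (unique-map (ordering Q) (ordering-injective Q)
      (Unique.filter⁺ (isLinearExtension? Q) (allVecs-unique (size Q) (Unique.allFin⁺ (size Q)))))
    unique to from
    where
    to : ∀ {w} → w ∈ map (ordering Q) (linearExtensions Q) → w ∈ orderings
    to w∈ with f , f∈ , refl ← ∈.∈-map⁻ (ordering Q) w∈ = complete (ordering-isOrdering Q f (∈-linearExtensions⁻ Q f∈))
    from : ∀ {w} → w ∈ orderings → w ∈ map (ordering Q) (linearExtensions Q)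
    from {w} w∈ = subst (_∈ map (ordering Q) (linearExtensions Q)) (ordering-labelling Q w (sound w∈))
        (∈.∈-map⁺ (ordering Q) (labelling∈ Q w (sound w∈)))

  totalPosition : Fin (size Q) → ℕ
  totalPosition x = ∑ orderings (λ w → suc (index x w))

  h≡ratio : ∀ x → h Q x ≡ ratio (totalPosition x) (length orderings)
  h≡ratio x = cong₂ ratio
    (trans (∑-cong-∈ (linearExtensions Q) λ f f∈ → cong suc (sym (index-ordering Q f (∈-linearExtensions⁻ Q f∈) x)))
      (trans (sym (∑-map (ordering Q) (linearExtensions Q) λ w → suc (index x w)))
          (∑-↭ (λ w → suc (index x w)) map-ordering-↭)))
    (trans (sym (length-map (ordering Q) (linearExtensions Q))) (↭.↭-length map-ordering-↭))

-- Orderings of ordinal and parallel sums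

merge : List Bool → List A → List C → List (A ⊎ C)
merge (true ∷ s)  (x ∷ xs) ys       = inj₁ x ∷ merge s xs ys
merge (false ∷ s) xs       (y ∷ ys) = inj₂ y ∷ merge s xs ys
merge _           _        _        = []

isLeft : A ⊎ C → Bool
isLeft (inj₁ _) = true
isLeft (inj₂ _) = false

shape : List (A ⊎ C) → List Bool
shape = map isLeft

lefts : List (A ⊎ C) → List A
lefts []           = []
lefts (inj₁ x ∷ w) = x ∷ lefts w
lefts (inj₂ _ ∷ w) = lefts w

rights : List (A ⊎ C) → List C
rights []           = []
rights (inj₁ _ ∷ w) = rights w
rights (inj₂ y ∷ w) = y ∷ rights w

Shuffle-shape : (w : List (A ⊎ C)) → Shuffle (shape w) (lefts w) (rights w)
Shuffle-shape []           = []
Shuffle-shape (inj₁ x ∷ w) = left (Shuffle-shape w)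
Shuffle-shape (inj₂ y ∷ w) = right (Shuffle-shape w)

merge-right : ∀ s (xs : List A) (y : C) ys → merge (false ∷ s) xs (y ∷ ys) ≡ inj₂ y ∷ merge s xs ys
merge-right s []       y ys = refl
merge-right s (_ ∷ _)  y ys = refl

merge-shape : (w : List (A ⊎ C)) → merge (shape w) (lefts w) (rights w) ≡ w
merge-shape []           = refl
merge-shape (inj₁ x ∷ w) = cong (inj₁ x ∷_) (merge-shape w)
merge-shape (inj₂ y ∷ w) = trans (merge-right (shape w) (lefts w) y (rights w)) (cong (inj₂ y ∷_) (merge-shape w))

unmerge : ∀ {s} {xs : List A} {ys : List C} → Shuffle s xs ys → let w = merge s xs ys in
  shape w ≡ s × lefts w ≡ xs × rights w ≡ ys
unmerge [] = refl , refl , refl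
unmerge (left {x = x} p) with a , b , c ← unmerge p = cong (true ∷_) a , cong (x ∷_) b , c
unmerge (right {s = s} {xs} {y} {ys} p) rewrite merge-right s xs y ys with a , b , c ← unmerge p =
  cong (false ∷_) a , b , cong (y ∷_) c

∈-lefts : ∀ {w : List (A ⊎ C)} {x} → inj₁ x ∈ w → x ∈ lefts w
∈-lefts {w = inj₁ _ ∷ w} (here refl) = here refl
∈-lefts {w = inj₁ _ ∷ w} (there p)   = there (∈-lefts p)
∈-lefts {w = inj₂ _ ∷ w} (there p)   = ∈-lefts p

∈-rights : ∀ {w : List (A ⊎ C)} {y} → inj₂ y ∈ w → y ∈ rights w
∈-rights {w = inj₂ _ ∷ w} (here refl) = here refl
∈-rights {w = inj₂ _ ∷ w} (there p)   = there (∈-rights p)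
∈-rights {w = inj₁ _ ∷ w} (there p)   = ∈-rights p

∈-merge-inj₁ : ∀ {s} {xs : List A} {ys : List C} → Shuffle s xs ys → ∀ {x} → x ∈ xs → inj₁ x ∈ merge s xs ys
∈-merge-inj₁ (left p) (here refl) = here refl
∈-merge-inj₁ (left p) (there x∈)  = there (∈-merge-inj₁ p x∈)
∈-merge-inj₁ (right {s = s} {xs} {y} {ys} p) x∈ rewrite merge-right s xs y ys = there (∈-merge-inj₁ p x∈)

∈-merge-inj₂ : ∀ {s} {xs : List A} {ys : List C} → Shuffle s xs ys → ∀ {y} → y ∈ ys → inj₂ y ∈ merge s xs ys
∈-merge-inj₂ (left p) y∈ = there (∈-merge-inj₂ p y∈)
∈-merge-inj₂ (right {s = s} {xs} {y} {ys} p) y∈ rewrite merge-right s xs y ys with y∈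
... | here refl = here refl
... | there y∈′ = there (∈-merge-inj₂ p y∈′)

module _ {R : A ⊎ C → A ⊎ C → Set} {Rₗ : A → A → Set} (f : ∀ {x y} → R (inj₁ x) (inj₁ y) → Rₗ x y) where

  All-lefts : ∀ {x w} → All (R (inj₁ x)) w → All (Rₗ x) (lefts w)
  All-lefts {w = []}         []       = []
  All-lefts {w = inj₁ _ ∷ w} (r ∷ rs) = f r ∷ All-lefts rs
  All-lefts {w = inj₂ _ ∷ w} (r ∷ rs) = All-lefts rs

  AllPairs-lefts : ∀ {w} → AllPairs R w → AllPairs Rₗ (lefts w)
  AllPairs-lefts {w = []}         []       = []
  AllPairs-lefts {w = inj₁ _ ∷ w} (r ∷ rs) = All-lefts r ∷ AllPairs-lefts rs
  AllPairs-lefts {w = inj₂ _ ∷ w} (r ∷ rs) = AllPairs-lefts rs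

module _ {R : A ⊎ C → A ⊎ C → Set} {Rᵣ : C → C → Set} (f : ∀ {x y} → R (inj₂ x) (inj₂ y) → Rᵣ x y) where

  All-rights : ∀ {x w} → All (R (inj₂ x)) w → All (Rᵣ x) (rights w)
  All-rights {w = []}         []       = []
  All-rights {w = inj₂ _ ∷ w} (r ∷ rs) = f r ∷ All-rights rs
  All-rights {w = inj₁ _ ∷ w} (r ∷ rs) = All-rights rs

  AllPairs-rights : ∀ {w} → AllPairs R w → AllPairs Rᵣ (rights w)
  AllPairs-rights {w = []}         []       = []
  AllPairs-rights {w = inj₂ _ ∷ w} (r ∷ rs) = All-rights r ∷ AllPairs-rights rs
  AllPairs-rights {w = inj₁ _ ∷ w} (r ∷ rs) = AllPairs-rights rs

module _ {P : A ⊎ C → Set} where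

  All-merge : ∀ s (xs : List A) (ys : List C) → All (P ∘ inj₁) xs → All (P ∘ inj₂) ys → All P (merge s xs ys)
  All-merge []          _        _        _        _        = []
  All-merge (true ∷ s)  []       _        _        _        = []
  All-merge (true ∷ s)  (x ∷ xs) ys       (p ∷ ps) qs       = p ∷ All-merge s xs ys ps qs
  All-merge (false ∷ s) []       []       _        _        = []
  All-merge (false ∷ s) (_ ∷ _)  []       _        _        = []
  All-merge (false ∷ s) []       (y ∷ ys) ps       (q ∷ qs) = q ∷ All-merge s [] ys ps qs
  All-merge (false ∷ s) xs@(_ ∷ _) (y ∷ ys) ps     (q ∷ qs) = q ∷ All-merge s xs ys ps qs

module _ {R : A ⊎ C → A ⊎ C → Set} where

  AllPairs-merge : ∀ {s} {xs : List A} {ys : List C} → Shuffle s xs ys →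
    (∀ x y → R (inj₁ x) (inj₂ y)) → (∀ x y → R (inj₂ y) (inj₁ x)) →
    AllPairs (λ x y → R (inj₁ x) (inj₁ y)) xs → AllPairs (λ x y → R (inj₂ x) (inj₂ y)) ys → AllPairs R (merge s xs ys)
  AllPairs-merge [] lr rl [] [] = []
  AllPairs-merge (left {s = s} {x} {xs} {ys} p) lr rl (r ∷ rs) qs =
    All-merge s xs ys r (All.tabulate λ _ → lr x _) ∷ AllPairs-merge p lr rl rs qs
  AllPairs-merge (right {s = s} {xs} {y} {ys} p) lr rl rs (q ∷ qs) rewrite merge-right s xs y ys =
    All-merge s xs ys (All.tabulate λ _ → rl _ y) q ∷ AllPairs-merge p lr rl rs qs

blocks : ℕ → ℕ → List Bool
blocks m n = replicate m true ++ replicate n false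

Shuffle-blocks : (xs : List A) (ys : List C) → Shuffle (blocks (length xs) (length ys)) xs ys
Shuffle-blocks []       []       = []
Shuffle-blocks []       (y ∷ ys) = right (Shuffle-blocks [] ys)
Shuffle-blocks (x ∷ xs) ys       = left (Shuffle-blocks xs ys)

merge-blocks : (xs : List A) (ys : List C) → merge (blocks (length xs) (length ys)) xs ys ≡ map inj₁ xs ++ map inj₂ ys
merge-blocks []       []       = refl
merge-blocks []       (y ∷ ys) = cong (inj₂ y ∷_) (merge-blocks [] ys)
merge-blocks (x ∷ xs) ys       = cong (inj₁ x ∷_) (merge-blocks xs ys)

module _ (m n : ℕ) where

  assemble : List Bool × List (Fin m) × List (Fin n) → List (Fin (m + n))
  assemble (s , u , v) = map (join m n) (merge s u v)

  map-splitAt-join : ∀ w → map (splitAt m) (map (join m n) w) ≡ w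
  map-splitAt-join w = trans (sym (map-∘ w)) (trans (map-cong (Fin.splitAt-join m n) w) (map-id w))

  map-join-splitAt : ∀ w → map (join m n) (map (splitAt m) w) ≡ w
  map-join-splitAt w = trans (sym (map-∘ w)) (trans (map-cong (Fin.join-splitAt m n) w) (map-id w))

  disassemble : List (Fin (m + n)) → List Bool × List (Fin m) × List (Fin n)
  disassemble w = let w′ = map (splitAt m) w in shape w′ , lefts w′ , rights w′

  disassemble-assemble : ∀ {s u v} → Shuffle s u v → disassemble (assemble (s , u , v)) ≡ (s , u , v)
  disassemble-assemble {s} {u} {v} p rewrite map-splitAt-join (merge s u v) with a , b , c ← unmerge p =
    cong₂ _,_ a (cong₂ _,_ b c)

  assemble-disassemble : ∀ w → assemble (disassemble w) ≡ w
  assemble-disassemble w = trans (cong (map (join m n)) (merge-shape (map (splitAt m) w))) (map-join-splitAt w)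

  suc-index-↑ˡ : ∀ {s u v x} → Shuffle s u v → x ∈ u → suc (index (x ↑ˡ n) (assemble (s , u , v))) ≡
      position-true (suc (index x u)) s
  suc-index-↑ˡ {x = x} (left {s} {y} {u} {v} p) x∈ with x Fin.≟ y
  ... | yes refl = cong suc (index-here (x ↑ˡ n) (assemble (s , u , v)))
  suc-index-↑ˡ {x = x} (left {s} {y} {u} {v} p) (here x≡y) | no x≢y = ⊥-elim (x≢y x≡y)
  suc-index-↑ˡ {x = x} (left {s} {y} {u} {v} p) (there x∈) | no x≢y =
    cong suc (trans (index-there (assemble (s , u , v)) (x≢y ∘ Fin.↑ˡ-injective n x y)) (suc-index-↑ˡ p x∈))
  suc-index-↑ˡ {x = x} (right {s} {u} {y} {v} p) x∈ rewrite merge-right s u y v =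
    cong suc (trans (index-there (assemble (s , u , v)) x≢y) (suc-index-↑ˡ p x∈))
    where
    x≢y : x ↑ˡ n ≢ m ↑ʳ y
    x≢y eq with () ← trans (sym (Fin.splitAt-↑ˡ m x n)) (trans (cong (splitAt m) eq) (Fin.splitAt-↑ʳ m n y))

  suc-index-↑ʳ : ∀ {s u v y} → Shuffle s u v → y ∈ v → suc (index (m ↑ʳ y) (assemble (s , u , v))) ≡
      position-true (suc (index y v)) (map not s)
  suc-index-↑ʳ {y = y} (right {s} {u} {z} {v} p) y∈ rewrite merge-right s u z v with y Fin.≟ z
  ... | yes refl = cong suc (index-here (m ↑ʳ y) (assemble (s , u , v)))
  suc-index-↑ʳ {y = y} (right {s} {u} {z} {v} p) (here y≡z) | no y≢z = ⊥-elim (y≢z y≡z)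
  suc-index-↑ʳ {y = y} (right {s} {u} {z} {v} p) (there y∈) | no y≢z =
    cong suc (trans (index-there (assemble (s , u , v)) (y≢z ∘ Fin.↑ʳ-injective m y z)) (suc-index-↑ʳ p y∈))
  suc-index-↑ʳ {y = y} (left {s} {x} {u} {v} p) y∈ =
    cong suc (trans (index-there (assemble (s , u , v)) y≢x) (suc-index-↑ʳ p y∈))
    where
    y≢x : m ↑ʳ y ≢ x ↑ˡ n
    y≢x eq with () ← trans (sym (Fin.splitAt-↑ʳ m n y)) (trans (cong (splitAt m) eq) (Fin.splitAt-↑ˡ m x n))

open Enumeration public

-- The orderings of a sum are the merges of orderings of the summands along the words in S.
module SumOrderings {Q R : FinPoset} (EQ : Enumeration Q) (ER : Enumeration R)
  (S : List (List Bool)) (S-unique : Unique S) (S⊆ : ∀ {s} → s ∈ S → s ∈ shuffles (size Q) (size R)) where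

  private
    m n : ℕ
    m = size Q
    n = size R

  triples : List (List Bool × List (Fin m) × List (Fin n))
  triples = cartesianProduct S (cartesianProduct (orderings EQ) (orderings ER))

  merged : List (List (Fin (m + n)))
  merged = map (assemble m n) triples

  triple-Shuffle : ∀ {s u v} → s ∈ S → u ∈ orderings EQ → v ∈ orderings ER → Shuffle s u v
  triple-Shuffle {s} {u} {v} s∈ u∈ v∈ = ∈-shuffles⇒Shuffle u v (subst₂ (λ a b → s ∈ shuffles a b)
    (sym (IsOrdering⇒length Q (sound EQ u∈))) (sym (IsOrdering⇒length R (sound ER v∈))) (S⊆ s∈))

  ∈-triples⁻ : ∀ {s u v} → (s , u , v) ∈ triples → s ∈ S × u ∈ orderings EQ × v ∈ orderings ER
  ∈-triples⁻ ∈t with s∈ , uv∈ ← ∈.∈-cartesianProduct⁻ S (cartesianProduct (orderings EQ) (orderings ER)) ∈t =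
    s∈ , ∈.∈-cartesianProduct⁻ (orderings EQ) (orderings ER) uv∈

  merged-unique : Unique merged
  merged-unique = unique-map (assemble m n) inj
    (Unique.cartesianProduct⁺ S-unique (Unique.cartesianProduct⁺ (unique EQ) (unique ER)))
    where
    inj : ∀ {x y} → x ∈ triples → y ∈ triples → assemble m n x ≡ assemble m n y → x ≡ y
    inj {_ , _ , _} {_ , _ , _} x∈ y∈ eq with s∈ , u∈ , v∈ ← ∈-triples⁻ x∈ | s∈′ , u∈′ , v∈′ ← ∈-triples⁻ y∈ =
      trans (sym (disassemble-assemble m n (triple-Shuffle s∈ u∈ v∈)))
        (trans (cong (disassemble m n) eq) (disassemble-assemble m n (triple-Shuffle s∈′ u∈′ v∈′)))

  ∑-merged : ∀ (f : List (Fin (m + n)) → ℕ) → ∑ merged f ≡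
    ∑ S λ s → ∑ (orderings EQ) λ u → ∑ (orderings ER) λ v → f (assemble m n (s , u , v))
  ∑-merged f = trans (∑-map (assemble m n) triples f)
    (trans (∑-cartesianProductWith _,_ S _ _)
        (∑-cong S λ s → ∑-cartesianProductWith _,_ (orderings EQ) (orderings ER) _))

  length-merged : length merged ≡ length S * (length (orderings EQ) * length (orderings ER))
  length-merged = begin
    length merged ≡⟨ ∑-1 merged ⟨
    ∑ merged (λ _ → 1) ≡⟨ ∑-merged (λ _ → 1) ⟩
    ∑ S (λ _ → ∑ (orderings EQ) λ _ → ∑ (orderings ER) λ _ → 1) ≡⟨ ∑-const S _ ⟩
    length S * ∑ (orderings EQ) (λ _ → ∑ (orderings ER) λ _ → 1)
      ≡⟨ cong (length S *_) (∑-const (orderings EQ) _) ⟩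
    length S * (length (orderings EQ) * ∑ (orderings ER) (λ _ → 1))
      ≡⟨ cong (λ k → length S * (length (orderings EQ) * k)) (∑-1 (orderings ER)) ⟩
    length S * (length (orderings EQ) * length (orderings ER)) ∎
    where open ≡-Reasoning

  module _ {_≲_ : Fin m ⊎ Fin n → Fin m ⊎ Fin n → Set}
    (fromQ : ∀ {x y} → FinPoset._⊑_ Q x y → inj₁ x ≲ inj₁ y) (fromR : ∀ {x y} → FinPoset._⊑_ R x y → inj₂ x ≲ inj₂ y)
    {w : List (Fin (m + n))}
    (pairs : AllPairs (λ x y → ¬ (splitAt m y ≲ splitAt m x)) w) (all : ∀ x → x ∈ w)
    (shape∈ : shape (map (splitAt m) w) ∈ S) where

    merged-complete : w ∈ merged
    merged-complete = subst (_∈ merged) (assemble-disassemble m n w)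
      (∈.∈-map⁺ (assemble m n) (∈.∈-cartesianProduct⁺ shape∈ (∈.∈-cartesianProduct⁺
        (complete EQ (AllPairs-lefts (λ ¬r → ¬r ∘ fromQ) pairs′ , λ x → ∈-lefts (all′ (inj₁ x))))
        (complete ER (AllPairs-rights (λ ¬r → ¬r ∘ fromR) pairs′ , λ x → ∈-rights (all′ (inj₂ x)))))))
      where
      pairs′ : AllPairs (λ x y → ¬ (y ≲ x)) (map (splitAt m) w)
      pairs′ = AllPairs.map⁺ pairs
      all′ : ∀ x → x ∈ map (splitAt m) w
      all′ x = subst (_∈ map (splitAt m) w) (Fin.splitAt-join m n x) (∈.∈-map⁺ (splitAt m) (all (join m n x)))

  module _ {_≲_ : Fin m ⊎ Fin n → Fin m ⊎ Fin n → Set} where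

    merged-sound : (∀ {s u v} → s ∈ S → u ∈ orderings EQ → v ∈ orderings ER →
        AllPairs (λ x y → ¬ (y ≲ x)) (merge s u v)) →
      ∀ {w} → w ∈ merged → AllPairs (λ x y → ¬ (splitAt m y ≲ splitAt m x)) w × (∀ x → x ∈ w)
    merged-sound pairs w∈ with (s , u , v) , t∈ , refl ← ∈.∈-map⁻ (assemble m n) w∈ with s∈ , u∈ , v∈ ← ∈-triples⁻ t∈ =
      AllPairs.map⁺ (AllPairs.map (λ {x} {y} ¬r r →
          ¬r (subst₂ _≲_ (Fin.splitAt-join m n y) (Fin.splitAt-join m n x) r)) (pairs s∈ u∈ v∈)) ,
      λ x → subst (_∈ assemble m n (s , u , v)) (Fin.join-splitAt m n x) (∈.∈-map⁺ (join m n) (member (splitAt m x)))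
      where
      p = triple-Shuffle (proj₁ (∈-triples⁻ t∈)) (proj₁ (proj₂ (∈-triples⁻ t∈))) (proj₂ (proj₂ (∈-triples⁻ t∈)))
      member : ∀ x → x ∈ merge s u v
      member (inj₁ x) = ∈-merge-inj₁ p (proj₂ (sound EQ (proj₁ (proj₂ (∈-triples⁻ t∈)))) x)
      member (inj₂ y) = ∈-merge-inj₂ p (proj₂ (sound ER (proj₂ (proj₂ (∈-triples⁻ t∈)))) y)

module _ {Q R : FinPoset} where

  private
    m n : ℕ
    m = size Q
    n = size R

  module ⊔-Orderings (EQ : Enumeration Q) (ER : Enumeration R) =
    SumOrderings EQ ER (shuffles m n) (shuffles-unique m n) id

  ⊔-enumeration : Enumeration Q → Enumeration R → Enumeration (Q ⊔ᴾ R)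
  ⊔-enumeration EQ ER = record
    { orderings = merged
    ; unique    = merged-unique
    ; sound     = merged-sound {_≲_ = Pointwise (FinPoset._⊑_ Q) (FinPoset._⊑_ R)} λ s∈ u∈ v∈ →
        AllPairs-merge (triple-Shuffle s∈ u∈ v∈) (λ _ _ ()) (λ _ _ ())
                    (AllPairs.map (λ ¬r → λ { (Pointwise.inj₁ r) → ¬r r }) (proj₁ (sound EQ u∈)))
                    (AllPairs.map (λ ¬r → λ { (Pointwise.inj₂ r) → ¬r r }) (proj₁ (sound ER v∈)))
    ; complete  = λ {w} (pairs , all) → merged-complete
        {_≲_ = Pointwise (FinPoset._⊑_ Q) (FinPoset._⊑_ R)} Pointwise.inj₁ Pointwise.inj₂ pairs all
        (shape∈ w pairs all)
    }
    where
    open ⊔-Orderings EQ ER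
    shape∈ : ∀ w → AllPairs (λ x y → ¬ (FinPoset._⊑_ (Q ⊔ᴾ R) y x)) w → (∀ x → x ∈ w) →
      shape (map (splitAt m) w) ∈ shuffles m n
    shape∈ w pairs all = subst₂ (λ a b → shape w′ ∈ shuffles a b)
      (IsOrdering⇒length Q (AllPairs-lefts (λ ¬r → ¬r ∘ Pointwise.inj₁) pairs′ , λ x → ∈-lefts (all′ (inj₁ x))))
      (IsOrdering⇒length R (AllPairs-rights (λ ¬r → ¬r ∘ Pointwise.inj₂) pairs′ , λ x → ∈-rights (all′ (inj₂ x))))
      (Shuffle⇒∈-shuffles (Shuffle-shape w′))
      where
      w′ = map (splitAt m) w
      pairs′ : AllPairs (λ x y → ¬ (Pointwise (FinPoset._⊑_ Q) (FinPoset._⊑_ R) y x)) w′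
      pairs′ = AllPairs.map⁺ pairs
      all′ : ∀ x → x ∈ w′
      all′ x = subst (_∈ w′) (Fin.splitAt-join m n x) (∈.∈-map⁺ (splitAt m) (all (join m n x)))

  blocks∈shuffles : blocks m n ∈ shuffles m n
  blocks∈shuffles = subst₂ (λ a b → blocks a b ∈ shuffles a b) (length-tabulate {n = m} id)
      (length-tabulate {n = n} id)
    (Shuffle⇒∈-shuffles (Shuffle-blocks (allFin m) (allFin n)))

  blocks⊆shuffles : ∀ {s} → s ∈ [ blocks m n ] → s ∈ shuffles m n
  blocks⊆shuffles (here refl) = blocks∈shuffles

  module ⊕-Orderings (EQ : Enumeration Q) (ER : Enumeration R) =
    SumOrderings EQ ER [ blocks m n ] ([] ∷ []) blocks⊆shuffles

  ⊕-enumeration : Enumeration Q → Enumeration R → Enumeration (Q ⊕ R)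
  ⊕-enumeration EQ ER = record
    { orderings = merged
    ; unique    = merged-unique
    ; sound     = merged-sound {_≲_ = _≲_} pairs-merge
    ; complete  = λ {w} (pairs , all) → merged-complete {_≲_ = _≲_} ₁∼₁ ₂∼₂ pairs all (here (shape≡ w pairs all))
    }
    where
    open ⊕-Orderings EQ ER
    _≲_ : Fin m ⊎ Fin n → Fin m ⊎ Fin n → Set
    _≲_ = FinPoset._⊑_ Q ⊎-< FinPoset._⊑_ R

    pairs-merge : ∀ {s u v} → s ∈ [ blocks m n ] → u ∈ orderings EQ → v ∈ orderings ER →
        AllPairs (λ x y → ¬ (y ≲ x)) (merge s u v)
    pairs-merge {u = u} {v} (here refl) u∈ v∈ = subst (AllPairs _)
      (trans (sym (merge-blocks u v)) (cong₂ (λ a b → merge (blocks a b) u v)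
          (IsOrdering⇒length Q (sound EQ u∈)) (IsOrdering⇒length R (sound ER v∈))))
      (AllPairs.++⁺ (AllPairs.map⁺ (AllPairs.map (λ ¬r → λ { (₁∼₁ r) → ¬r r }) (proj₁ (sound EQ u∈))))
                    (AllPairs.map⁺ (AllPairs.map (λ ¬r → λ { (₂∼₂ r) → ¬r r }) (proj₁ (sound ER v∈))))
                    (All.map⁺ (All.tabulate λ _ → All.map⁺ (All.tabulate λ _ ()))))

    no-lefts : ∀ {y} w → All (λ z → ¬ (z ≲ inj₂ y)) w → lefts w ≡ []
    no-lefts []           _        = refl
    no-lefts (inj₁ x ∷ w) (¬r ∷ _) = ⊥-elim (¬r ₁∼₂)
    no-lefts (inj₂ x ∷ w) (_ ∷ rs) = no-lefts w rs

    -- Once an element of the second summand has occurred, every element of the first would be below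
    -- it, hence no letter `true` can follow.
    shape-blocks : ∀ w → AllPairs (λ x y → ¬ (y ≲ x)) w → shape w ≡ blocks (length (lefts w)) (length (rights w))
    shape-blocks []           _        = refl
    shape-blocks (inj₁ x ∷ w) (_ ∷ rs) = cong (true ∷_) (shape-blocks w rs)
    shape-blocks (inj₂ y ∷ w) (r ∷ rs) with eq ← shape-blocks w rs rewrite no-lefts w r = cong (false ∷_) eq

    shape≡ : ∀ w → AllPairs (λ x y → ¬ (FinPoset._⊑_ (Q ⊕ R) y x)) w → (∀ x → x ∈ w) →
        shape (map (splitAt m) w) ≡ blocks m n
    shape≡ w pairs all = trans (shape-blocks w′ pairs′) (cong₂ blocks
      (IsOrdering⇒length Q (AllPairs-lefts (λ ¬r → ¬r ∘ ₁∼₁) pairs′ , λ x → ∈-lefts (all′ (inj₁ x))))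
      (IsOrdering⇒length R (AllPairs-rights (λ ¬r → ¬r ∘ ₂∼₂) pairs′ , λ x → ∈-rights (all′ (inj₂ x)))))
      where
      w′ = map (splitAt m) w
      pairs′ : AllPairs (λ x y → ¬ (y ≲ x)) w′
      pairs′ = AllPairs.map⁺ pairs
      all′ : ∀ x → x ∈ w′
      all′ x = subst (_∈ w′) (Fin.splitAt-join m n x) (∈.∈-map⁺ (splitAt m) (all (join m n x)))

sorted-unique : ∀ {R : A → A → Set} {u w : List A} → (∀ {x} → ¬ R x x) → (∀ {x y} → R x y → ¬ R y x) →
  AllPairs R u → AllPairs R w → (∀ {x} → x ∈ u → x ∈ w) → (∀ {x} → x ∈ w → x ∈ u) → u ≡ w
sorted-unique {u = []}    {[]}    _ _ _ _ _ _ = refl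
sorted-unique {u = []}    {y ∷ w} _ _ _ _ _ from with () ← from (here refl)
sorted-unique {u = x ∷ u} {[]}    _ _ _ _ to _ with () ← to (here refl)
sorted-unique {u = x ∷ u} {y ∷ w} irr asym (rx ∷ ru) (ry ∷ rw) to from = helper (to (here refl)) (from (here refl))
  where
  helper : x ∈ y ∷ w → y ∈ x ∷ u → x ∷ u ≡ y ∷ w
  helper (there x∈) (there y∈) = ⊥-elim (asym (All.lookup rx y∈) (All.lookup ry x∈))
  helper (there x∈) (here refl) = ⊥-elim (irr (All.lookup ry x∈))
  helper (here refl) _ = cong (x ∷_) (sorted-unique irr asym ru rw (λ z∈ → strip ru rx z∈ (to (there z∈)))
      (λ z∈ → strip rw ry z∈ (from (there z∈))))
    where
    strip : ∀ {u v z} → AllPairs _ u → All _ u → z ∈ u → z ∈ x ∷ v → z ∈ v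
    strip _ rx z∈ (here refl) = ⊥-elim (irr (All.lookup rx z∈))
    strip _ rx z∈ (there z∈′) = z∈′

chain-enumeration : ∀ k → Enumeration (Chain k)
chain-enumeration k = record
  { orderings = [ allFin k ]
  ; unique    = [] ∷ []
  ; sound     = λ { (here refl) → isOrdering }
  ; complete  = λ (pairs , all) → here (sorted-unique (λ ¬x≤x → ¬x≤x (Fin.≤-refl {k}))
      (λ {x} {y} ¬y≤x ¬x≤y → case (Fin.≤-total x y) ¬y≤x ¬x≤y)
                  pairs (proj₁ isOrdering) (λ {x} _ → ∈.∈-allFin x) (λ {x} _ → all x))
  }
  where
  isOrdering : IsOrdering (Chain k) (allFin k)
  isOrdering = AllPairs.tabulate⁺-< (λ i<j j≤i → ℕ.<⇒≱ i<j j≤i) , ∈.∈-allFin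
  case : ∀ {x y : Fin k} → x Fin.≤ y ⊎ y Fin.≤ x → ¬ (y Fin.≤ x) → ¬ (x Fin.≤ y) → ⊥
  case (inj₁ x≤y) _ ¬x≤y = ¬x≤y x≤y
  case (inj₂ y≤x) ¬y≤x _ = ¬y≤x y≤x

-- Average positions in sums

ratio-unique : ∀ {e f} q → 0 < f → q ℚ.* ι f ≡ ι e → ratio e f ≡ q
ratio-unique {e} {suc f} q _ eq = ℚ.≤-antisym (cancel (ℚ.≤-reflexive eq′)) (cancel (ℚ.≤-reflexive (sym eq′)))
  where
  instance
    pos : ℚ.Positive (ι (suc f))
    pos = ι-pos (suc f)
  eq′ : ratio e (suc f) ℚ.* ι (suc f) ≡ q ℚ.* ι (suc f)
  eq′ = trans (/-*-ι e f) (sym eq)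
  cancel : ∀ {p r} → p ℚ.* ι (suc f) ℚ.≤ r ℚ.* ι (suc f) → p ℚ.≤ r
  cancel = ℚ.*-cancelʳ-≤-pos (ι (suc f))

ratio-*-ι : ∀ a {b} → 0 < b → ratio a b ℚ.* ι b ≡ ι a
ratio-*-ι a {suc b} _ = /-*-ι a b

-- Exchanging the letters reflects the lattice paths, which reduces positions in the second summand
-- to positions in the first.
∑-shuffles-not : ∀ m n (f : List Bool → ℕ) → ∑ (shuffles m n) (f ∘ map not) ≡ ∑ (shuffles n m) f
∑-shuffles-not zero    zero    f = refl
∑-shuffles-not zero    (suc n) f = cong (λ s → f s + 0) (map-replicate not (suc n) false)
∑-shuffles-not (suc m) zero    f = cong (λ s → f s + 0) (map-replicate not (suc m) true)
∑-shuffles-not (suc m) (suc n) f = begin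
  ∑ (shuffles (suc m) (suc n)) (f ∘ map not) ≡⟨ ∑-shuffles m n (f ∘ map not) ⟩
  ∑ (shuffles m (suc n)) (f ∘ (false ∷_) ∘ map not) + ∑ (shuffles (suc m) n) (f ∘ (true ∷_) ∘ map not)
    ≡⟨ cong₂ _+_ (∑-shuffles-not m (suc n) (f ∘ (false ∷_))) (∑-shuffles-not (suc m) n (f ∘ (true ∷_))) ⟩
  ∑ (shuffles (suc n) m) (f ∘ (false ∷_)) + ∑ (shuffles n (suc m)) (f ∘ (true ∷_))
    ≡⟨ ℕ.+-comm (∑ (shuffles (suc n) m) (f ∘ (false ∷_))) _ ⟩
  ∑ (shuffles n (suc m)) (f ∘ (true ∷_)) + ∑ (shuffles (suc n) m) (f ∘ (false ∷_)) ≡⟨ ∑-shuffles n m f ⟨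
  ∑ (shuffles (suc n) (suc m)) f ∎
  where open ≡-Reasoning

position-true-blocks : ∀ i m n → i ≤ m → position-true i (blocks m n) ≡ i
position-true-blocks zero    m       n _        = refl
position-true-blocks (suc i) (suc m) n (s≤s le) = cong suc (position-true-blocks i m n le)

position-true-not-blocks : ∀ i m n → i < n → position-true (suc i) (map not (blocks m n)) ≡ m + suc i
position-true-not-blocks i       (suc m) n       lt       = cong suc (position-true-not-blocks i m n lt)
position-true-not-blocks zero    zero    (suc n) _        = refl
position-true-not-blocks (suc i) zero    (suc n) (s≤s lt) = cong suc (position-true-not-blocks i zero n lt)

module _ {Q R : FinPoset} (EQ : Enumeration Q) (ER : Enumeration R) (eQ>0 : 0 < length (orderings EQ)) (eR>0 : 0 < length (orderings ER)) where

  private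
    m n eQ eR : ℕ
    m  = size Q
    n  = size R
    eQ = length (orderings EQ)
    eR = length (orderings ER)

    index<m : ∀ {u} x → u ∈ orderings EQ → index x u < m
    index<m {u} x u∈ = subst (index x u <_) (IsOrdering⇒length Q (sound EQ u∈)) (index-< (proj₂ (sound EQ u∈) x))

    index<n : ∀ {v} y → v ∈ orderings ER → index y v < n
    index<n {v} y v∈ = subst (index y v <_) (IsOrdering⇒length R (sound ER v∈)) (index-< (proj₂ (sound ER v∈) y))

    module _ (S : List (List Bool)) (S-unique : Unique S) (S⊆ : ∀ {s} → s ∈ S → s ∈ shuffles m n) where
      open SumOrderings EQ ER S S-unique S⊆

      ∑-merged′ : ∀ F (G : List (Fin m) → List (Fin n) → List Bool → ℕ) →
        (∀ {s u v} → s ∈ S → u ∈ orderings EQ → v ∈ orderings ER → F (assemble m n (s , u , v)) ≡ G u v s) →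
        ∑ merged F ≡ ∑ (orderings EQ) λ u → ∑ (orderings ER) λ v → ∑ S (G u v)
      ∑-merged′ F G eq = trans (∑-merged F) (trans
        (∑-cong-∈ S λ s s∈ → ∑-cong-∈ (orderings EQ) λ u u∈ → ∑-cong-∈ (orderings ER) λ v v∈ → eq s∈ u∈ v∈)
        (∑-swap₃ S (orderings EQ) (orderings ER) λ s u v → G u v s))

      total-↑ˡ : ∀ x (pos : ℕ → ℕ) → (∀ {i} → i < m → ∑ S (position-true (suc i)) ≡ pos i) →
        ∑ merged (λ w → suc (index (x ↑ˡ n) w)) ≡ eR * ∑ (orderings EQ) (λ u → pos (index x u))
      total-↑ˡ x pos eq = trans
        (∑-merged′ _ (λ u _ → position-true (suc (index x u))) λ s∈ u∈ v∈ →
          suc-index-↑ˡ m n (triple-Shuffle s∈ u∈ v∈) (proj₂ (sound EQ u∈) x))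
        (trans (∑-cong-∈ (orderings EQ) λ u u∈ → trans (∑-const (orderings ER) _) (cong (eR *_) (eq (index<m x u∈))))
          (∑-*ˡ (orderings EQ) eR _))

      total-↑ʳ : ∀ y (pos : ℕ → ℕ) → (∀ {i} → i < n → ∑ S (position-true (suc i) ∘ map not) ≡ pos i) →
        ∑ merged (λ w → suc (index (m ↑ʳ y) w)) ≡ eQ * ∑ (orderings ER) (λ v → pos (index y v))
      total-↑ʳ y pos eq = trans
        (∑-merged′ _ (λ _ v → position-true (suc (index y v)) ∘ map not) λ s∈ u∈ v∈ →
          suc-index-↑ʳ m n (triple-Shuffle s∈ u∈ v∈) (proj₂ (sound ER v∈) y))
        (trans (∑-const (orderings EQ) _) (cong (eQ *_) (∑-cong-∈ (orderings ER) λ v v∈ → eq (index<n y v∈))))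

  length-⊔ : length (orderings (⊔-enumeration EQ ER)) ≡ B m n * (eQ * eR)
  length-⊔ = trans (⊔-Orderings.length-merged EQ ER) (cong (_* (eQ * eR)) (length-shuffles m n))

  length-⊕ : length (orderings (⊕-enumeration EQ ER)) ≡ eQ * eR
  length-⊕ = trans (⊕-Orderings.length-merged EQ ER) (ℕ.+-identityʳ (eQ * eR))

  private
    -- The number d of orderings of the other summand cancels, and `absorb` evaluates the remaining
    -- quotient of binomial coefficients.
    scaled : ∀ a b t e d → 0 < e → 0 < d → suc a * B (suc a) b ≡ (a + b + 1) * B a b →
      ratio (d * (t * B (suc a) b)) (B a b * (e * d)) ≡ (+ (a + b + 1) / suc a) ℚ.* ratio t e
    scaled a b t e d e>0 d>0 absorb = ratio-unique _ (ℕ.*-mono-< (B-pos a b) (ℕ.*-mono-< e>0 d>0)) (cancel (begin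
      c ℚ.* ratio t e ℚ.* ι (B a b * (e * d)) ℚ.* ι (suc a)
        ≡⟨ cong (λ z → c ℚ.* ratio t e ℚ.* z ℚ.* ι (suc a))
            (trans (ι-* (B a b) (e * d)) (cong (ι (B a b) ℚ.*_) (ι-* e d))) ⟩
      c ℚ.* ratio t e ℚ.* (ι (B a b) ℚ.* (ι e ℚ.* ι d)) ℚ.* ι (suc a)
        ≡⟨ rearrange c (ratio t e) (ι (B a b)) (ι e) (ι d) (ι (suc a)) ⟩
      c ℚ.* ι (suc a) ℚ.* (ratio t e ℚ.* ι e) ℚ.* (ι (B a b) ℚ.* ι d)
        ≡⟨ cong₂ (λ x y → x ℚ.* y ℚ.* (ι (B a b) ℚ.* ι d)) (/-*-ι (a + b + 1) a) (ratio-*-ι t e>0) ⟩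
      ι (a + b + 1) ℚ.* ι t ℚ.* (ι (B a b) ℚ.* ι d)
        ≡⟨ cong₂ ℚ._*_ (ι-* (a + b + 1) t) (ι-* (B a b) d) ⟨
      ι ((a + b + 1) * t) ℚ.* ι (B a b * d)
        ≡⟨ ι-* ((a + b + 1) * t) (B a b * d) ⟨
      ι ((a + b + 1) * t * (B a b * d))
        ≡⟨ cong ι (trans (l₁ (a + b + 1) t (B a b) d)
            (trans (cong (_* (t * d)) (sym absorb)) (l₂ (suc a) (B (suc a) b) t d))) ⟩
      ι (d * (t * B (suc a) b) * suc a)
        ≡⟨ ι-* (d * (t * B (suc a) b)) (suc a) ⟩
      ι (d * (t * B (suc a) b)) ℚ.* ι (suc a) ∎))
      where
      open ≡-Reasoning
      c = + (a + b + 1) / suc a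
      cancel : ∀ {p q} → p ℚ.* ι (suc a) ≡ q ℚ.* ι (suc a) → p ≡ q
      cancel eq = ℚ.≤-antisym (ℚ.*-cancelʳ-≤-pos (ι (suc a)) {{ι-pos (suc a)}} (ℚ.≤-reflexive eq))
        (ℚ.*-cancelʳ-≤-pos (ι (suc a)) {{ι-pos (suc a)}} (ℚ.≤-reflexive (sym eq)))
      l₁ : ∀ a t b d → a * t * (b * d) ≡ a * b * (t * d)
      l₁ = solve-∀
      l₂ : ∀ a b t d → a * b * (t * d) ≡ d * (t * b) * a
      l₂ = solve-∀
      rearrange : ∀ c r b e d a → c ℚ.* r ℚ.* (b ℚ.* (e ℚ.* d)) ℚ.* a ≡ c ℚ.* a ℚ.* (r ℚ.* e) ℚ.* (b ℚ.* d)
      rearrange = solve 6 (λ c r b e d a → c :* r :* (b :* (e :* d)) :* a := c :* a :* (r :* e) :* (b :* d)) refl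
        where open +-*-Solver

  h-⊔-↑ˡ : ∀ x → h (Q ⊔ᴾ R) (x ↑ˡ n) ≡ (+ (m + n + 1) / suc m) ℚ.* h Q x
  h-⊔-↑ˡ x = begin
    h (Q ⊔ᴾ R) (x ↑ˡ n) ≡⟨ h≡ratio (⊔-enumeration EQ ER) (x ↑ˡ n) ⟩
    ratio (totalPosition (⊔-enumeration EQ ER) (x ↑ˡ n)) (length (orderings (⊔-enumeration EQ ER)))
      ≡⟨ cong₂ ratio (trans (total-↑ˡ (shuffles m n) (shuffles-unique m n) id x (λ i → suc i * B (suc m) n)
          (λ {i} i<m → ∑-position-true (suc i) m n i<m))
           (cong (eR *_) (∑-*ʳ (orderings EQ) (B (suc m) n) _))) length-⊔ ⟩
    ratio (eR * (totalPosition EQ x * B (suc m) n)) (B m n * (eQ * eR))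
      ≡⟨ scaled m n (totalPosition EQ x) eQ eR eQ>0 eR>0 (B-absorb m n) ⟩
    (+ (m + n + 1) / suc m) ℚ.* ratio (totalPosition EQ x) eQ
      ≡⟨ cong ((+ (m + n + 1) / suc m) ℚ.*_) (h≡ratio EQ x) ⟨
    (+ (m + n + 1) / suc m) ℚ.* h Q x ∎
    where open ≡-Reasoning

  h-⊔-↑ʳ : ∀ y → h (Q ⊔ᴾ R) (m ↑ʳ y) ≡ (+ (n + m + 1) / suc n) ℚ.* h R y
  h-⊔-↑ʳ y = begin
    h (Q ⊔ᴾ R) (m ↑ʳ y) ≡⟨ h≡ratio (⊔-enumeration EQ ER) (m ↑ʳ y) ⟩
    ratio (totalPosition (⊔-enumeration EQ ER) (m ↑ʳ y)) (length (orderings (⊔-enumeration EQ ER)))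
      ≡⟨ cong₂ ratio (trans (total-↑ʳ (shuffles m n) (shuffles-unique m n) id y (λ i → suc i * B (suc n) m)
           (λ {i} i<n → trans (∑-shuffles-not m n (position-true (suc i))) (∑-position-true (suc i) n m i<n)))
           (cong (eQ *_) (∑-*ʳ (orderings ER) (B (suc n) m) _)))
               (trans length-⊔ (cong₂ _*_ (B-comm m n) (ℕ.*-comm eQ eR))) ⟩
    ratio (eQ * (totalPosition ER y * B (suc n) m)) (B n m * (eR * eQ))
      ≡⟨ scaled n m (totalPosition ER y) eR eQ eR>0 eQ>0 (B-absorb n m) ⟩
    (+ (n + m + 1) / suc n) ℚ.* ratio (totalPosition ER y) eR
      ≡⟨ cong ((+ (n + m + 1) / suc n) ℚ.*_) (h≡ratio ER y) ⟨
    (+ (n + m + 1) / suc n) ℚ.* h R y ∎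
    where open ≡-Reasoning

  h-⊕-↑ˡ : ∀ x → h (Q ⊕ R) (x ↑ˡ n) ≡ h Q x
  h-⊕-↑ˡ x = begin
    h (Q ⊕ R) (x ↑ˡ n) ≡⟨ h≡ratio (⊕-enumeration EQ ER) (x ↑ˡ n) ⟩
    ratio (totalPosition (⊕-enumeration EQ ER) (x ↑ˡ n)) (length (orderings (⊕-enumeration EQ ER)))
      ≡⟨ cong₂ ratio (total-↑ˡ [ blocks m n ] ([] ∷ []) (blocks⊆shuffles {Q} {R}) x suc
          (λ {i} i<m → trans (ℕ.+-identityʳ _) (position-true-blocks (suc i) m n i<m))) length-⊕ ⟩
    ratio (eR * totalPosition EQ x) (eQ * eR) ≡⟨ ratio-unique _ (ℕ.*-mono-< eQ>0 eR>0) cancel ⟩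
    ratio (totalPosition EQ x) eQ ≡⟨ h≡ratio EQ x ⟨
    h Q x ∎
    where
    open ≡-Reasoning
    cancel : ratio (totalPosition EQ x) eQ ℚ.* ι (eQ * eR) ≡ ι (eR * totalPosition EQ x)
    cancel = trans (cong (ratio (totalPosition EQ x) eQ ℚ.*_) (ι-* eQ eR))
        (trans (sym (ℚ.*-assoc (ratio (totalPosition EQ x) eQ) (ι eQ) (ι eR)))
      (trans (cong (ℚ._* ι eR) (ratio-*-ι (totalPosition EQ x) eQ>0))
          (trans (sym (ι-* (totalPosition EQ x) eR)) (cong ι (ℕ.*-comm (totalPosition EQ x) eR)))))

  h-⊕-↑ʳ : ∀ y → h (Q ⊕ R) (m ↑ʳ y) ≡ ι m ℚ.+ h R y
  h-⊕-↑ʳ y = begin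
    h (Q ⊕ R) (m ↑ʳ y) ≡⟨ h≡ratio (⊕-enumeration EQ ER) (m ↑ʳ y) ⟩
    ratio (totalPosition (⊕-enumeration EQ ER) (m ↑ʳ y)) (length (orderings (⊕-enumeration EQ ER)))
      ≡⟨ cong₂ ratio (trans (total-↑ʳ [ blocks m n ] ([] ∷ []) (blocks⊆shuffles {Q} {R}) y (λ i → m + suc i)
          (λ {i} i<n → trans (ℕ.+-identityʳ _) (position-true-not-blocks i m n i<n)))
           (cong (eQ *_) (trans (∑-+ (orderings ER) (λ _ → m) _) (cong (_+ t) (∑-const (orderings ER) m)))))
               length-⊕ ⟩
    ratio (eQ * (eR * m + t)) (eQ * eR) ≡⟨ ratio-unique _ (ℕ.*-mono-< eQ>0 eR>0) cancel ⟩
    ι m ℚ.+ ratio t eR ≡⟨ cong (ι m ℚ.+_) (h≡ratio ER y) ⟨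
    ι m ℚ.+ h R y ∎
    where
    open ≡-Reasoning
    t = totalPosition ER y
    rearrange : ∀ m r e d → (m ℚ.+ r) ℚ.* (e ℚ.* d) ≡ e ℚ.* (d ℚ.* m ℚ.+ r ℚ.* d)
    rearrange = solve 4 (λ m r e d → (m :+ r) :* (e :* d) := e :* (d :* m :+ r :* d)) refl
      where open +-*-Solver
    cancel : (ι m ℚ.+ ratio t eR) ℚ.* ι (eQ * eR) ≡ ι (eQ * (eR * m + t))
    cancel = begin
      (ι m ℚ.+ ratio t eR) ℚ.* ι (eQ * eR) ≡⟨ cong ((ι m ℚ.+ ratio t eR) ℚ.*_) (ι-* eQ eR) ⟩
      (ι m ℚ.+ ratio t eR) ℚ.* (ι eQ ℚ.* ι eR) ≡⟨ rearrange (ι m) (ratio t eR) (ι eQ) (ι eR) ⟩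
      ι eQ ℚ.* (ι eR ℚ.* ι m ℚ.+ ratio t eR ℚ.* ι eR)
        ≡⟨ cong₂ (λ a b → ι eQ ℚ.* (a ℚ.+ b)) (sym (ι-* eR m)) (ratio-*-ι t eR>0) ⟩
      ι eQ ℚ.* (ι (eR * m) ℚ.+ ι t) ≡⟨ cong (ι eQ ℚ.*_) (ι-+ (eR * m) t) ⟨
      ι eQ ℚ.* ι (eR * m + t) ≡⟨ ι-* eQ (eR * m + t) ⟨
      ι (eQ * (eR * m + t)) ∎

h-Chain : ∀ k (x : Fin k) → h (Chain k) x ≡ ι (suc (toℕ x))
h-Chain k x = trans (h≡ratio (chain-enumeration k) x)
    (cong ι (trans (ℕ.+-identityʳ _) (cong suc (index-tabulate id id x))))

-- Gaps

maxgap : ℚ → List ℚ → ℚ → ℚ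
maxgap a xs b = foldr₁ ℚ._⊔_ (spacings a xs b)

Ascending : ℚ → List ℚ → ℚ → Set
Ascending a []       b = a ℚ.≤ b
Ascending a (x ∷ xs) b = a ℚ.≤ x × Ascending x xs b

Ascending-lower : ∀ {a a′ b} xs → a ℚ.≤ a′ → Ascending a′ xs b → Ascending a xs b
Ascending-lower []       le p       = ℚ.≤-trans le p
Ascending-lower (x ∷ xs) le (p , q) = ℚ.≤-trans le p , q

Ascending-++ : ∀ {a b c} xs ys → Ascending a xs b → Ascending b ys c → Ascending a (xs ++ ys) c
Ascending-++ []       ys p       q = Ascending-lower ys p q
Ascending-++ (x ∷ xs) ys (p , r) q = p , Ascending-++ xs ys r q

Ascending-map : ∀ {f : ℚ → ℚ} → (∀ {x y} → x ℚ.≤ y → f x ℚ.≤ f y) → ∀ {a b} xs → Ascending a xs b →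
    Ascending (f a) (map f xs) (f b)
Ascending-map mono []       p       = mono p
Ascending-map mono (x ∷ xs) (p , q) = mono p , Ascending-map mono xs q

Ascending⇒Linked : ∀ {a b} xs → Ascending a xs b → Linked ℚ._≤_ xs
Ascending⇒Linked []           p           = []
Ascending⇒Linked (x ∷ [])     p           = [-]
Ascending⇒Linked (x ∷ y ∷ xs) (_ , q , r) = q ∷ Ascending⇒Linked (y ∷ xs) (q , r)

dup : List ℚ → List ℚ
dup []       = []
dup (x ∷ xs) = x ∷ x ∷ dup xs

dup-↭ : ∀ xs → xs ++ xs ↭ dup xs
dup-↭ []       = ↭-refl
dup-↭ (x ∷ xs) = ↭.prep x (↭-trans (↭.shift x xs xs) (↭.prep x (dup-↭ xs)))

Ascending-dup : ∀ {a b} xs → Ascending a xs b → Ascending a (dup xs) b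
Ascending-dup []       p       = p
Ascending-dup (x ∷ xs) (p , q) = p , ℚ.≤-refl , Ascending-dup xs q

-- Doubling every value inserts spacings x - x = 0. The maxima are compared after taking the maximum
-- with 0, because nothing here excludes negative spacings; `0⊔-cancel` removes it for a positive
-- gap.
maxgap-dup : ∀ a xs b → 0ℚ ℚ.⊔ maxgap a (dup xs) b ≡ 0ℚ ℚ.⊔ maxgap a xs b
maxgap-dup a []       b = refl
maxgap-dup a (x ∷ xs) b = begin
  0ℚ ℚ.⊔ (d ℚ.⊔ ((x ℚ.- x) ℚ.⊔ maxgap x (dup xs) b))
    ≡⟨ cong (λ z → 0ℚ ℚ.⊔ (d ℚ.⊔ (z ℚ.⊔ maxgap x (dup xs) b))) (ℚ.+-inverseʳ x) ⟩
  0ℚ ℚ.⊔ (d ℚ.⊔ (0ℚ ℚ.⊔ maxgap x (dup xs) b)) ≡⟨ cong (λ z → 0ℚ ℚ.⊔ (d ℚ.⊔ z)) (maxgap-dup x xs b) ⟩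
  0ℚ ℚ.⊔ (d ℚ.⊔ (0ℚ ℚ.⊔ maxgap x xs b)) ≡⟨ ℚ.⊔-assoc 0ℚ d _ ⟨
  (0ℚ ℚ.⊔ d) ℚ.⊔ (0ℚ ℚ.⊔ maxgap x xs b) ≡⟨ cong (ℚ._⊔ (0ℚ ℚ.⊔ maxgap x xs b)) (ℚ.⊔-comm 0ℚ d) ⟩
  (d ℚ.⊔ 0ℚ) ℚ.⊔ (0ℚ ℚ.⊔ maxgap x xs b) ≡⟨ ℚ.⊔-triangulate d 0ℚ _ ⟨
  d ℚ.⊔ 0ℚ ℚ.⊔ maxgap x xs b ≡⟨ cong (ℚ._⊔ maxgap x xs b) (ℚ.⊔-comm d 0ℚ) ⟩
  0ℚ ℚ.⊔ d ℚ.⊔ maxgap x xs b ≡⟨ ℚ.⊔-assoc 0ℚ d _ ⟩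
  0ℚ ℚ.⊔ (d ℚ.⊔ maxgap x xs b) ∎
  where
  open ≡-Reasoning
  d = x ℚ.- a

0⊔-cancel : ∀ {p g} → 0ℚ ℚ.< g → 0ℚ ℚ.⊔ p ≡ g → p ≡ g
0⊔-cancel {p} g>0 eq with ℚ.⊔-sel 0ℚ p
... | inj₁ 0⊔p≡0 = ⊥-elim (ℚ.<-irrefl (trans (sym 0⊔p≡0) eq) g>0)
... | inj₂ 0⊔p≡p = trans (sym 0⊔p≡p) eq

-- `d` is the action of `f` on differences: the identity for a shift, multiplication by c for a
-- scaling by c.
maxgap-map : ∀ (f d : ℚ → ℚ) → (∀ x y → f x ℚ.- f y ≡ d (x ℚ.- y)) → (∀ p q → d (p ℚ.⊔ q) ≡ d p ℚ.⊔ d q) →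
  ∀ a xs b → maxgap (f a) (map f xs) (f b) ≡ d (maxgap a xs b)
maxgap-map f d diff dist a []       b = diff b a
maxgap-map f d diff dist a (x ∷ xs) b =
  trans (cong₂ ℚ._⊔_ (diff x a) (maxgap-map f d diff dist x xs b)) (sym (dist (x ℚ.- a) (maxgap x xs b)))

chainUp : ℚ → ℕ → List ℚ
chainUp a zero    = []
chainUp a (suc k) = a ℚ.+ 1ℚ ∷ chainUp (a ℚ.+ 1ℚ) k

module ℚLemmas where
  open +-*-Solver

  a+1-a≡1 : ∀ a → a ℚ.+ 1ℚ ℚ.- a ≡ 1ℚ
  a+1-a≡1 = solve 1 (λ a → a :+ con 1ℚ :- a := con 1ℚ) refl

  shift-diff : ∀ t x y → (t ℚ.+ x) ℚ.- (t ℚ.+ y) ≡ x ℚ.- y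
  shift-diff = solve 3 (λ t x y → (t :+ x) :- (t :+ y) := x :- y) refl

  scale-diff : ∀ c x y → c ℚ.* x ℚ.- c ℚ.* y ≡ c ℚ.* (x ℚ.- y)
  scale-diff = solve 3 (λ c x y → c :* x :- c :* y := c :* (x :- y)) refl

open ℚLemmas

a≤a+1 : ∀ a → a ℚ.≤ a ℚ.+ 1ℚ
a≤a+1 a = subst (ℚ._≤ a ℚ.+ 1ℚ) (ℚ.+-identityʳ a) (ℚ.+-monoʳ-≤ a (ℚ.nonNegative⁻¹ 1ℚ))

+ι-suc : ∀ a k → a ℚ.+ 1ℚ ℚ.+ ι k ≡ a ℚ.+ ι (suc k)
+ι-suc a k = trans (ℚ.+-assoc a 1ℚ (ι k)) (cong (a ℚ.+_) (sym (ι-+ 1 k)))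

Ascending-chainUp : ∀ a k → Ascending a (chainUp a k) (a ℚ.+ ι k)
Ascending-chainUp a zero    = ℚ.≤-reflexive (sym (ℚ.+-identityʳ a))
Ascending-chainUp a (suc k) = a≤a+1 a , subst (Ascending (a ℚ.+ 1ℚ) (chainUp (a ℚ.+ 1ℚ) k)) (+ι-suc a k)
    (Ascending-chainUp (a ℚ.+ 1ℚ) k)

-- The chain adds only spacings 1, absorbed by 1 ≤ g, and moves the lower end of the remaining list
-- from a to a + k.
maxgap-chainUp-++ : ∀ {g} → 1ℚ ℚ.≤ g → ∀ a k xs b → maxgap (a ℚ.+ ι k) xs b ≡ g → maxgap a (chainUp a k ++ xs) b ≡ g
maxgap-chainUp-++ 1≤g a zero    xs b eq = subst (λ z → maxgap z xs b ≡ _) (ℚ.+-identityʳ a) eq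
maxgap-chainUp-++ 1≤g a (suc k) xs b eq = trans (cong₂ ℚ._⊔_ (a+1-a≡1 a)
  (maxgap-chainUp-++ 1≤g (a ℚ.+ 1ℚ) k xs b (subst (λ z → maxgap z xs b ≡ _) (sym (+ι-suc a k)) eq))) (ℚ.p≤q⇒p⊔q≡q 1≤g)

maxgap-chainUp : ∀ a k → maxgap a (chainUp a k) (a ℚ.+ ι (suc k)) ≡ 1ℚ
maxgap-chainUp a zero    = a+1-a≡1 a
maxgap-chainUp a (suc k) = trans (cong₂ ℚ._⊔_ (a+1-a≡1 a)
  (trans (cong (maxgap (a ℚ.+ 1ℚ) (chainUp (a ℚ.+ 1ℚ) k)) (sym (+ι-suc a (suc k))))
      (maxgap-chainUp (a ℚ.+ 1ℚ) k))) (ℚ.⊔-idem 1ℚ)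

-- `b` has two roles: it is the upper end n + 1 for the values of the first summand and the position
-- of the first chain element above it. No spacing is merged or lost.
maxgap-++-chainUp : ∀ a xs b k → maxgap a (xs ++ b ∷ chainUp b k) (b ℚ.+ ι (suc k)) ≡ maxgap a xs b ℚ.⊔ 1ℚ
maxgap-++-chainUp a []       b k = cong ((b ℚ.- a) ℚ.⊔_) (maxgap-chainUp b k)
maxgap-++-chainUp a (x ∷ xs) b k = trans (cong ((x ℚ.- a) ℚ.⊔_) (maxgap-++-chainUp x xs b k))
    (sym (ℚ.⊔-assoc (x ℚ.- a) (maxgap x xs b) 1ℚ))

map-+-chainUp : ∀ t a k → map (t ℚ.+_) (chainUp a k) ≡ chainUp (t ℚ.+ a) k
map-+-chainUp t a zero    = refl
map-+-chainUp t a (suc k) = cong₂ _∷_ (sym (ℚ.+-assoc t a 1ℚ))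
  (trans (map-+-chainUp t (a ℚ.+ 1ℚ) k) (cong (λ z → chainUp z k) (sym (ℚ.+-assoc t a 1ℚ))))

allFin-+ : ∀ m n → allFin (m + n) ≡ map (_↑ˡ n) (allFin m) ++ map (m ↑ʳ_) (allFin n)
allFin-+ m n = trans (tabulate-+ m id) (sym (cong₂ _++_ (map-tabulate id (_↑ˡ n)) (map-tabulate id (m ↑ʳ_))))
  where
  tabulate-+ : ∀ m {D : Set} (f : Fin (m + n) → D) → tabulate f ≡ tabulate (f ∘ (_↑ˡ n)) ++ tabulate (f ∘ (m ↑ʳ_))
  tabulate-+ zero    f = refl
  tabulate-+ (suc m) f = cong (f zero ∷_) (tabulate-+ m (f ∘ suc))

map-allFin-+ : ∀ m n {D : Set} (f : Fin (m + n) → D) (g : Fin m → D) (k : Fin n → D) →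
  (∀ x → f (x ↑ˡ n) ≡ g x) → (∀ y → f (m ↑ʳ y) ≡ k y) → map f (allFin (m + n)) ≡ map g (allFin m) ++ map k (allFin n)
map-allFin-+ m n f g k eq eq′ = trans (cong (map f) (allFin-+ m n)) (trans (map-++ f (map (_↑ˡ n) (allFin m)) _)
  (cong₂ _++_ (trans (sym (map-∘ (allFin m))) (map-cong eq (allFin m)))
      (trans (sym (map-∘ (allFin n))) (map-cong eq′ (allFin n)))))

-- `gap` sorts the list of average positions. An ascending rearrangement is unique, so one obtained
-- along the construction of the poset can replace the output of `sort`.
record Profile (Q : FinPoset) (g : ℚ) : Set where
  no-eta-equality
  field
    values  : List ℚ
    values↭ : map (h Q) (allFin (size Q)) ↭ values
    asc     : Ascending 0ℚ values (ι (suc (size Q)))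
    maxgap≡ : maxgap 0ℚ values (ι (suc (size Q))) ≡ g

  gap≡ : gap Q ≡ g
  gap≡ = trans (cong (λ xs → maxgap 0ℚ xs (ι (suc (size Q)))) sorted≡) maxgap≡
    where
    module S = Sort ℚ.≤-decTotalOrder
    sorted≡ : S.sort (map (h Q) (allFin (size Q))) ≡ values
    sorted≡ = ≋⇒≡ (↗↭↗⇒≋ (DecTotalOrder.totalOrder ℚ.≤-decTotalOrder) (S.sort-↗ (map (h Q) (allFin (size Q))))
        (Ascending⇒Linked values asc)
      (↭.↭⇒↭ₛ (↭-trans (S.sort-↭ (map (h Q) (allFin (size Q)))) values↭)))

open Profile

map-h-Chain : ∀ k → map (h (Chain k)) (allFin k) ≡ chainUp 0ℚ k
map-h-Chain k = trans (map-cong (h-Chain k) (allFin k))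
    (trans (map-tabulate id _) (go k 0ℚ _ (λ x → sym (ℚ.+-identityˡ _))))
  where
  go : ∀ k a (f : Fin k → ℚ) → (∀ x → f x ≡ a ℚ.+ ι (suc (toℕ x))) → tabulate f ≡ chainUp a k
  go zero    a f eq = refl
  go (suc k) a f eq = cong₂ _∷_ (eq zero) (go k (a ℚ.+ 1ℚ) (f ∘ suc) λ x →
      trans (eq (suc x)) (sym (+ι-suc a (suc (toℕ x)))))

Chain-profile : ∀ k → Profile (Chain (suc k)) 1ℚ
Chain-profile k = record
  { values  = chainUp 0ℚ (suc k)
  ; values↭ = ↭.↭-reflexive (map-h-Chain (suc k))
  ; asc     = subst (λ xs → Ascending 0ℚ xs (ι (suc (suc k)))) (++-identityʳ (chainUp 0ℚ (suc k)))
      (Ascending-++ (chainUp 0ℚ (suc k)) [] (Ascending-chainUp 0ℚ (suc k))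
                (ℚ.≤-trans (ℚ.≤-reflexive (ℚ.+-identityˡ (ι (suc k)))) (ι-mono-≤ (ℕ.n≤1+n (suc k)))))
  ; maxgap≡ = trans (cong (maxgap 0ℚ (chainUp 0ℚ (suc k))) (sym (ℚ.+-identityˡ (ι (suc (suc k))))))
      (maxgap-chainUp 0ℚ (suc k))
  }

module _ {Q : FinPoset} (EQ : Enumeration Q) (eQ>0 : 0 < length (orderings EQ)) {g : ℚ} (prof : Profile Q g) where

  private
    n : ℕ
    n = size Q

  Chain⊕-profile : 1ℚ ℚ.≤ g → ∀ k → Profile (Chain k ⊕ Q) g
  Chain⊕-profile 1≤g k = record
    { values  = chainUp 0ℚ k ++ map (ι k ℚ.+_) (values prof)
    ; values↭ = subst (_↭ (chainUp 0ℚ k ++ map (ι k ℚ.+_) (values prof)))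
        (sym (trans (map-allFin-+ k n (h (Chain k ⊕ Q)) (h (Chain k)) (λ y → ι k ℚ.+ h Q y)
                (h-⊕-↑ˡ (chain-enumeration k) EQ (s≤s z≤n) eQ>0) (h-⊕-↑ʳ (chain-enumeration k) EQ (s≤s z≤n) eQ>0))
              (cong₂ _++_ (map-h-Chain k) (map-∘ (allFin n)))))
        (↭.++⁺ˡ (chainUp 0ℚ k) (↭.map⁺ (ι k ℚ.+_) (values↭ prof)))
    ; asc     = Ascending-++ (chainUp 0ℚ k) _ (Ascending-chainUp 0ℚ k)
        (subst₂ (λ a b → Ascending a (map (ι k ℚ.+_) (values prof)) b) start end
            (Ascending-map (ℚ.+-monoʳ-≤ (ι k)) (values prof) (asc prof)))
    ; maxgap≡ = maxgap-chainUp-++ 1≤g 0ℚ k _ _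
        (trans (cong₂ (λ a b → maxgap a (map (ι k ℚ.+_) (values prof)) b) (sym start) (sym end))
          (trans (maxgap-map (ι k ℚ.+_) id (shift-diff (ι k)) (λ _ _ → refl) 0ℚ (values prof) (ι (suc n)))
              (maxgap≡ prof)))
    }
    where
    start : ι k ℚ.+ 0ℚ ≡ 0ℚ ℚ.+ ι k
    start = ℚ.+-comm (ι k) 0ℚ
    end : ι k ℚ.+ ι (suc n) ≡ ι (suc (k + n))
    end = trans (sym (ι-+ k (suc n))) (cong ι (ℕ.+-suc k n))

  ⊕Chain-profile : 1ℚ ℚ.≤ g → ∀ k → Profile (Q ⊕ Chain (suc k)) g
  ⊕Chain-profile 1≤g k = record
    { values  = vs
    ; values↭ = subst (_↭ vs)
        (sym (map-allFin-+ n (suc k) (h (Q ⊕ Chain (suc k))) (h Q) (λ y → ι n ℚ.+ h (Chain (suc k)) y)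
                (h-⊕-↑ˡ EQ (chain-enumeration (suc k)) eQ>0 (s≤s z≤n))
                    (h-⊕-↑ʳ EQ (chain-enumeration (suc k)) eQ>0 (s≤s z≤n))))
        (↭.++⁺ (values↭ prof) (↭.↭-reflexive (trans (map-∘ (allFin (suc k)))
            (trans (cong (map (ι n ℚ.+_)) (map-h-Chain (suc k))) top≡))))
    ; asc     = Ascending-++ (values prof) _ (asc prof)
        (ℚ.≤-refl , subst (Ascending (ι (suc n)) (chainUp (ι (suc n)) k)) last≡
                  (subst (λ xs → Ascending (ι (suc n)) xs (ι (suc n) ℚ.+ ι (suc k)))
                      (++-identityʳ (chainUp (ι (suc n)) k))
                    (Ascending-++ (chainUp (ι (suc n)) k) [] (Ascending-chainUp (ι (suc n)) k)
                        (ℚ.+-monoʳ-≤ (ι (suc n)) (ι-mono-≤ (ℕ.n≤1+n k))))))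
    ; maxgap≡ = trans (cong (maxgap 0ℚ vs) (sym last≡)) (trans (maxgap-++-chainUp 0ℚ (values prof) (ι (suc n)) k)
                  (trans (cong (ℚ._⊔ 1ℚ) (maxgap≡ prof)) (ℚ.p≥q⇒p⊔q≡p 1≤g)))
    }
    where
    vs = values prof ++ ι (suc n) ∷ chainUp (ι (suc n)) k
    next : ι n ℚ.+ 0ℚ ℚ.+ 1ℚ ≡ ι (suc n)
    next = trans (cong (ℚ._+ 1ℚ) (ℚ.+-identityʳ (ι n))) (trans (sym (ι-+ n 1)) (cong ι (ℕ.+-comm n 1)))
    top≡ : map (ι n ℚ.+_) (chainUp 0ℚ (suc k)) ≡ ι (suc n) ∷ chainUp (ι (suc n)) k
    top≡ = trans (map-+-chainUp (ι n) 0ℚ (suc k)) (cong (λ z → z ∷ chainUp z k) next)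
    last≡ : ι (suc n) ℚ.+ ι (suc k) ≡ ι (suc (n + suc k))
    last≡ = sym (ι-+ (suc n) (suc k))

  -- Both copies take the same average positions, c times the old ones. As c (n + 1) = 2n + 1, the
  -- ends scale too, so the two extreme spacings grow by the same factor as the inner ones.
  ⊔-profile : 0ℚ ℚ.< g → Profile (Q ⊔ᴾ Q) ((+ (2 * n + 1) / suc n) ℚ.* g)
  ⊔-profile g>0 = record
    { values  = dup cs
    ; values↭ = subst (_↭ dup cs)
        (sym (trans (map-allFin-+ n n (h (Q ⊔ᴾ Q)) (λ x → c ℚ.* h Q x) (λ x → c ℚ.* h Q x)
                (λ x → trans (h-⊔-↑ˡ EQ EQ eQ>0 eQ>0 x) (cong (ℚ._* h Q x) c≡))
                    (λ x → trans (h-⊔-↑ʳ EQ EQ eQ>0 eQ>0 x) (cong (ℚ._* h Q x) c≡)))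
              (cong₂ _++_ (map-∘ (allFin n)) (map-∘ (allFin n)))))
        (↭-trans (↭.++⁺ (↭.map⁺ (c ℚ.*_) (values↭ prof)) (↭.map⁺ (c ℚ.*_) (values↭ prof)))
            (dup-↭ cs))
    ; asc     = Ascending-dup cs
        (subst₂ (λ a b → Ascending a cs b) (ℚ.*-zeroʳ c) end
                  (Ascending-map (ℚ.*-monoˡ-≤-nonNeg c {{ℚ.pos⇒nonNeg c}}) (values prof) (asc prof)))
    ; maxgap≡ = 0⊔-cancel c*g>0 (begin
        0ℚ ℚ.⊔ maxgap 0ℚ (dup cs) (ι (suc (n + n)))  ≡⟨ maxgap-dup 0ℚ cs (ι (suc (n + n))) ⟩
        0ℚ ℚ.⊔ maxgap 0ℚ cs (ι (suc (n + n)))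
          ≡⟨ cong (0ℚ ℚ.⊔_) (cong₂ (λ a b → maxgap a cs b) (sym (ℚ.*-zeroʳ c)) (sym end)) ⟩
        0ℚ ℚ.⊔ maxgap (c ℚ.* 0ℚ) cs (c ℚ.* ι (suc n))
          ≡⟨ cong (0ℚ ℚ.⊔_) (maxgap-map (c ℚ.*_) (c ℚ.*_) (scale-diff c)
              (ℚ.*-distribˡ-⊔-nonNeg c {{ℚ.pos⇒nonNeg c}}) 0ℚ (values prof) (ι (suc n))) ⟩
        0ℚ ℚ.⊔ c ℚ.* maxgap 0ℚ (values prof) (ι (suc n))  ≡⟨ cong (λ g → 0ℚ ℚ.⊔ c ℚ.* g) (maxgap≡ prof) ⟩
        0ℚ ℚ.⊔ c ℚ.* g  ≡⟨ ℚ.p≤q⇒p⊔q≡q (ℚ.<⇒≤ c*g>0) ⟩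
        c ℚ.* g ∎)
    }
    where
    open ≡-Reasoning
    c = + (2 * n + 1) / suc n
    cs = map (c ℚ.*_) (values prof)
    c≡ : + (n + n + 1) / suc n ≡ c
    c≡ = cong (λ k → + (n + k + 1) / suc n) (sym (ℕ.+-identityʳ n))
    instance
      c-pos : ℚ.Positive c
      c-pos = ℚ.normalize-pos (2 * n + 1) (suc n) {{_}} {{ℕ.≢-nonZero λ eq → ℕ.1+n≢0 (trans (ℕ.+-comm 1 (2 * n)) eq)}}
    c*g>0 : 0ℚ ℚ.< c ℚ.* g
    c*g>0 = ℚ.positive⁻¹ (c ℚ.* g) {{ℚ.pos*pos⇒pos c g {{ℚ.positive g>0}}}}
    end : c ℚ.* ι (suc n) ≡ ι (suc (n + n))
    end = trans (/-*-ι (2 * n + 1) n) (cong ι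
        (trans (ℕ.+-comm (2 * n) 1) (cong (λ k → suc (n + k)) (ℕ.+-identityʳ n))))

-- Restricted orderings

filterᵇ-++ : ∀ (p : A → Bool) xs ys → filterᵇ p (xs ++ ys) ≡ filterᵇ p xs ++ filterᵇ p ys
filterᵇ-++ p []       ys = refl
filterᵇ-++ p (x ∷ xs) ys with p x
... | true  = cong (x ∷_) (filterᵇ-++ p xs ys)
... | false = filterᵇ-++ p xs ys

filterᵇ-map : ∀ (p : C → Bool) (f : A → C) xs → filterᵇ p (map f xs) ≡ map f (filterᵇ (p ∘ f) xs)
filterᵇ-map p f []       = refl
filterᵇ-map p f (x ∷ xs) with p (f x)
... | true  = cong (f x ∷_) (filterᵇ-map p f xs)
... | false = filterᵇ-map p f xs

length-filterᵇ : ∀ (p : A → Bool) xs → length (filterᵇ p xs) ≡ ∑ xs (𝟙 ∘ p)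
length-filterᵇ p []       = refl
length-filterᵇ p (x ∷ xs) with p x
... | true  = cong suc (length-filterᵇ p xs)
... | false = length-filterᵇ p xs

lefts-filterᵇ : ∀ (p : A ⊎ C → Bool) w → lefts (filterᵇ p w) ≡ filterᵇ (p ∘ inj₁) (lefts w)
lefts-filterᵇ p []           = refl
lefts-filterᵇ p (inj₁ x ∷ w) with p (inj₁ x)
... | true  = cong (x ∷_) (lefts-filterᵇ p w)
... | false = lefts-filterᵇ p w
lefts-filterᵇ p (inj₂ y ∷ w) with p (inj₂ y)
... | true  = lefts-filterᵇ p w
... | false = lefts-filterᵇ p w

rights-filterᵇ : ∀ (p : A ⊎ C → Bool) w → rights (filterᵇ p w) ≡ filterᵇ (p ∘ inj₂) (rights w)
rights-filterᵇ p []           = refl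
rights-filterᵇ p (inj₂ y ∷ w) with p (inj₂ y)
... | true  = cong (y ∷_) (rights-filterᵇ p w)
... | false = rights-filterᵇ p w
rights-filterᵇ p (inj₁ x ∷ w) with p (inj₁ x)
... | true  = rights-filterᵇ p w
... | false = rights-filterᵇ p w

restrict-right : ∀ s x b y → restrictShuffle (false ∷ s) x (b ∷ y) ≡
  (if is-just b then false ∷ restrictShuffle s x y else restrictShuffle s x y)
restrict-right s []      (just _) y = refl
restrict-right s []      nothing  y = refl
restrict-right s (_ ∷ _) (just _) y = refl
restrict-right s (_ ∷ _) nothing  y = refl

shape-filterᵇ : ∀ (p : A ⊎ C → Bool) {s u v} x y → Shuffle s u v →
  map is-just x ≡ map (p ∘ inj₁) u → map is-just y ≡ map (p ∘ inj₂) v →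
  shape (filterᵇ p (merge s u v)) ≡ restrictShuffle s x y
shape-filterᵇ p []       []       []       eq eq′ = refl
shape-filterᵇ p (a ∷ x) y (left {x = z} q) eq eq′ with p (inj₁ z) | a | ∷-injective eq
... | true  | just _  | _ , eqs = cong (true ∷_) (shape-filterᵇ p x y q eqs eq′)
... | false | nothing | _ , eqs = shape-filterᵇ p x y q eqs eq′
... | true  | nothing | () , _
... | false | just _  | () , _
shape-filterᵇ p x (b ∷ y) (right {s = s} {u} {z} {v} q) eq eq′ rewrite merge-right s u z v | restrict-right s x b y
  with p (inj₂ z) | b | ∷-injective eq′
... | true  | just _  | _ , eqs = cong (false ∷_) (shape-filterᵇ p x y q eq eqs)
... | false | nothing | _ , eqs = shape-filterᵇ p x y q eq eqs
... | true  | nothing | () , _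
... | false | just _  | () , _

card : ∀ {n} → (Fin n → Bool) → ℕ
card {n} X = ∑ (allFin n) (𝟙 ∘ X)

card-+ : ∀ m n (X : Fin (m + n) → Bool) → card X ≡ card (X ∘ (_↑ˡ n)) + card (X ∘ (m ↑ʳ_))
card-+ m n X = trans (cong (λ l → ∑ l (𝟙 ∘ X)) (allFin-+ m n)) (trans (∑-++ (map (_↑ˡ n) (allFin m)) _ _)
  (cong₂ _+_ (∑-map _ (allFin m) _) (∑-map _ (allFin n) _)))

card≤n : ∀ {n} (X : Fin n → Bool) → card X ≤ n
card≤n {n} X = ℕ.≤-trans (∑-mono-∈ (allFin n) λ x _ → 𝟙≤1 (X x))
    (ℕ.≤-reflexive (trans (∑-1 (allFin n)) (length-tabulate {n = n} id)))
  where
  𝟙≤1 : ∀ b → 𝟙 b ≤ 1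
  𝟙≤1 true  = ℕ.≤-refl
  𝟙≤1 false = z≤n

module _ (Q : FinPoset) where

  ∑-ordering : ∀ {w} → IsOrdering Q w → ∀ f → ∑ w f ≡ ∑ (allFin (size Q)) f
  ∑-ordering {w} ord f = ∑-↭ f (unique-set⇒↭ (IsOrdering⇒Unique Q {w} ord) (Unique.allFin⁺ (size Q))
      (λ {x} _ → ∈.∈-allFin x) (λ {x} _ → proj₂ ord x))

  #-ordering : ∀ {w} → IsOrdering Q w → ∀ X → # map X w ≡ card X
  #-ordering {w} ord X = trans (∑-map X w 𝟙) (∑-ordering {w} ord (𝟙 ∘ X))

module _ (m n : ℕ) (X : Fin (m + n) → Bool) where

  disassemble-filterᵇ : ∀ {s u v} x y → Shuffle s u v → map is-just x ≡ map (X ∘ (_↑ˡ n)) u → map is-just y ≡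
      map (X ∘ (m ↑ʳ_)) v →
    disassemble m n (filterᵇ X (assemble m n (s , u , v))) ≡
    (restrictShuffle s x y , filterᵇ (X ∘ (_↑ˡ n)) u , filterᵇ (X ∘ (m ↑ʳ_)) v)
  disassemble-filterᵇ {s} {u} {v} x y p eq eq′
    rewrite filterᵇ-map X (join m n) (merge s u v) | map-splitAt-join m n (filterᵇ (X ∘ join m n) (merge s u v)) =
    cong₂ _,_ (shape-filterᵇ (X ∘ join m n) x y p eq eq′) (cong₂ _,_
      (trans (lefts-filterᵇ (X ∘ join m n) (merge s u v)) (cong (filterᵇ _) (proj₁ (proj₂ (unmerge p)))))
      (trans (rights-filterᵇ (X ∘ join m n) (merge s u v)) (cong (filterᵇ _) (proj₂ (proj₂ (unmerge p))))))

concatenate : ∀ {m n} → List (Fin m) → List (Fin n) → List (Fin (m + n))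
concatenate {m} {n} u v = map (_↑ˡ n) u ++ map (m ↑ʳ_) v

assemble-blocks : ∀ m n u v → assemble m n (blocks (length u) (length v) , u , v) ≡ concatenate u v
assemble-blocks m n u v = trans (cong (map (join m n)) (merge-blocks u v))
  (trans (map-++ (join m n) (map inj₁ u) (map inj₂ v)) (cong₂ _++_ (sym (map-∘ u)) (sym (map-∘ v))))

filterᵇ-concatenate : ∀ {m n} (X : Fin (m + n) → Bool) u v →
  filterᵇ X (concatenate u v) ≡ concatenate (filterᵇ (X ∘ (_↑ˡ n)) u) (filterᵇ (X ∘ (m ↑ʳ_)) v)
filterᵇ-concatenate {m} {n} X u v = trans (filterᵇ-++ X (map (_↑ˡ n) u) _)
    (cong₂ _++_ (filterᵇ-map X _ u) (filterᵇ-map X _ v))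

map-concatenate : ∀ {m n} (X : Fin (m + n) → C) u v → map X (concatenate u v) ≡
    map (X ∘ (_↑ˡ n)) u ++ map (X ∘ (m ↑ʳ_)) v
map-concatenate {m = m} {n} X u v = trans (map-++ X (map (_↑ˡ n) u) _) (cong₂ _++_ (sym (map-∘ u)) (sym (map-∘ v)))

disassemble-concatenate : ∀ {m n} (u : List (Fin m)) (v : List (Fin n)) → disassemble m n (concatenate u v) ≡
    (blocks (length u) (length v) , u , v)
disassemble-concatenate {m} {n} u v = trans (cong (disassemble m n) (sym (assemble-blocks m n u v)))
    (disassemble-assemble m n (Shuffle-blocks u v))

module _ {Q R : FinPoset} (EQ : Enumeration Q) (ER : Enumeration R) where

  orderings-⊕ : orderings (⊕-enumeration EQ ER) ≡ cartesianProductWith concatenate (orderings EQ) (orderings ER)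
  orderings-⊕ = begin
    map (assemble (size Q) (size R)) (cartesianProduct [ b ] (cartesianProduct (orderings EQ) (orderings ER)))
      ≡⟨ cong (map (assemble (size Q) (size R))) (++-identityʳ (map (b ,_) pairs)) ⟩
    map (assemble (size Q) (size R)) (map (b ,_) pairs)
      ≡⟨ map-∘ pairs ⟨
    map (λ uv → assemble (size Q) (size R) (b , uv)) pairs
      ≡⟨ map-cong-local (All.tabulate λ {uv} uv∈ → rewrite-pair uv uv∈) ⟩
    map (λ (u , v) → concatenate u v) pairs
      ≡⟨ map-cartesianProduct (orderings EQ) ⟩
    cartesianProductWith concatenate (orderings EQ) (orderings ER) ∎
    where
    open ≡-Reasoning
    b = blocks (size Q) (size R)
    pairs = cartesianProduct (orderings EQ) (orderings ER)
    rewrite-pair : ∀ uv → uv ∈ pairs → assemble (size Q) (size R) (b , uv) ≡ concatenate (proj₁ uv) (proj₂ uv)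
    rewrite-pair (u , v) uv∈ with u∈ , v∈ ← ∈.∈-cartesianProduct⁻ (orderings EQ) (orderings ER) uv∈ =
      trans (cong₂ (λ i j → assemble (size Q) (size R) (blocks i j , u , v))
          (sym (IsOrdering⇒length Q (sound EQ u∈))) (sym (IsOrdering⇒length R (sound ER v∈))))
        (assemble-blocks (size Q) (size R) u v)
    map-cartesianProduct : ∀ us → map (λ (u , v) → concatenate u v) (cartesianProduct us (orderings ER)) ≡
        cartesianProductWith concatenate us (orderings ER)
    map-cartesianProduct []       = refl
    map-cartesianProduct (u ∷ us) = trans (map-++ _ (map (u ,_) (orderings ER)) _)
        (cong₂ _++_ (sym (map-∘ (orderings ER))) (map-cartesianProduct us))

module Sandwich {Q : FinPoset} (EQ : Enumeration Q) (ℓ : ℕ) where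

  private
    N : ℕ
    N = size Q

  sandwich : List (Fin N) → List (Fin (ℓ + (N + ℓ)))
  sandwich q = concatenate (allFin ℓ) (concatenate q (allFin ℓ))

  abstract
    enumeration : Enumeration (Chain ℓ ⊕ Q ⊕ Chain ℓ)
    enumeration = ⊕-enumeration (chain-enumeration ℓ) (⊕-enumeration EQ (chain-enumeration ℓ))

    orderings≡ : orderings enumeration ≡ map sandwich (orderings EQ)
    orderings≡ = begin
      orderings enumeration ≡⟨ orderings-⊕ (chain-enumeration ℓ) (⊕-enumeration EQ (chain-enumeration ℓ)) ⟩
      map (concatenate (allFin ℓ)) (orderings (⊕-enumeration EQ (chain-enumeration ℓ))) ++ [] ≡⟨ ++-identityʳ _ ⟩
      map (concatenate (allFin ℓ)) (orderings (⊕-enumeration EQ (chain-enumeration ℓ)))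
        ≡⟨ cong (map (concatenate (allFin ℓ))) (trans (orderings-⊕ EQ (chain-enumeration ℓ))
            (singleton (orderings EQ))) ⟩
      map (concatenate (allFin ℓ)) (map (λ q → concatenate q (allFin ℓ)) (orderings EQ)) ≡⟨ map-∘ (orderings EQ) ⟨
      map sandwich (orderings EQ) ∎
      where
      open ≡-Reasoning
      singleton : ∀ (qs : List (List (Fin N))) → cartesianProductWith (concatenate {N} {ℓ}) qs [ allFin ℓ ] ≡
          map (λ q → concatenate q (allFin ℓ)) qs
      singleton []       = refl
      singleton (q ∷ qs) = cong (concatenate q (allFin ℓ) ∷_) (singleton qs)

  middle : List (Fin (ℓ + (N + ℓ))) → List (Fin N)
  middle w = proj₁ (proj₂ (disassemble N ℓ (proj₂ (proj₂ (disassemble ℓ (N + ℓ) w)))))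

  module _ (X : Fin (ℓ + (N + ℓ)) → Bool) where

    Xα Xβ : Fin ℓ → Bool
    Xα = X ∘ (_↑ˡ (N + ℓ))
    Xβ = X ∘ (ℓ ↑ʳ_) ∘ (N ↑ʳ_)

    Xμ : Fin N → Bool
    Xμ = X ∘ (ℓ ↑ʳ_) ∘ (_↑ˡ ℓ)

    filterᵇ-sandwich : ∀ q → filterᵇ X (sandwich q) ≡
        concatenate (filterᵇ Xα (allFin ℓ)) (concatenate (filterᵇ Xμ q) (filterᵇ Xβ (allFin ℓ)))
    filterᵇ-sandwich q = trans (filterᵇ-concatenate X (allFin ℓ) _)
      (cong (concatenate (filterᵇ Xα (allFin ℓ))) (filterᵇ-concatenate (X ∘ (ℓ ↑ʳ_)) q (allFin ℓ)))

    middle-filterᵇ : ∀ q → middle (filterᵇ X (sandwich q)) ≡ filterᵇ Xμ q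
    middle-filterᵇ q = begin
      middle (filterᵇ X (sandwich q)) ≡⟨ cong middle (filterᵇ-sandwich q) ⟩
      middle (concatenate a (concatenate b c))
        ≡⟨ cong (λ d → proj₁ (proj₂ (disassemble N ℓ (proj₂ (proj₂ d)))))
            (disassemble-concatenate a (concatenate b c)) ⟩
      proj₁ (proj₂ (disassemble N ℓ (concatenate b c)))
        ≡⟨ cong (λ d → proj₁ (proj₂ d)) (disassemble-concatenate b c) ⟩
      b ∎
      where
      open ≡-Reasoning
      a = filterᵇ Xα (allFin ℓ)
      b = filterᵇ Xμ q
      c = filterᵇ Xβ (allFin ℓ)

    map-sandwich : ∀ q → map X (sandwich q) ≡ map Xα (allFin ℓ) ++ map Xμ q ++ map Xβ (allFin ℓ)
    map-sandwich q = trans (map-concatenate X (allFin ℓ) _)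
        (cong (map Xα (allFin ℓ) ++_) (map-concatenate (X ∘ (ℓ ↑ʳ_)) q (allFin ℓ)))

    card-sandwich : card X ≡ card Xα + (card Xμ + card Xβ)
    card-sandwich = trans (card-+ ℓ (N + ℓ) X) (cong (card Xα ℕ.+_) (card-+ N ℓ (X ∘ (ℓ ↑ʳ_))))

-- Codes for restricted orderings

-- For a nonempty set this is p times the subtrahend 2 + k/p. For the empty set the code has length
-- 0 and nothing may be subtracted; a copy missed by X therefore brings no -2, which is why the
-- modes treat such copies separately.
slack : ℕ → ℕ → ℕ
slack p zero      = 0
slack p k@(suc _) = 2 * p + k

-- With p = 2^r, the bound says that the average code length is at most (3 − 1/p) |X| − 2
-- for nonempty X, and 0 for empty X.
record Code (p : ℕ) {Q : FinPoset} (E : Enumeration Q) (X : Fin (size Q) → Bool) : Set where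
  no-eta-equality
  field
    enc       : List (Fin (size Q)) → List Bool
    decodable : ∀ {u v} → u ∈ orderings E → v ∈ orderings E → ∀ {s t} →
                enc (filterᵇ X u) ++ s ≡ enc (filterᵇ X v) ++ t → filterᵇ X u ≡ filterᵇ X v × s ≡ t

  cost : ℕ
  cost = ∑ (orderings E) (λ u → length (enc (filterᵇ X u)))

  field
    bound : p * cost + length (orderings E) * slack p (card X) ≤ length (orderings E) * (3 * p * card X)

-- `K` bounds 2p times the average length of the interleaving code. The inequality is the target
-- with 2p for p, after inserting the bounds for both copies and moving the subtracted slacks
-- across; `2 * (2 * p) + x` is `slack (2 * p) x` for positive x.
StepBound : (p a k₁ k₂ K : ℕ) → Set
StepBound p a k₁ k₂ K = let x = a + (k₁ + k₂) in
  K + (2 * (2 * p) + x) + 2 * (3 * p * k₁ + 3 * p * k₂) ≤ 3 * (2 * p) * x + 2 * (slack p k₁ + slack p k₂)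

-- How the interleaving is coded: with all marks plain; or with a flag for the good case; or,
-- when one side is empty, not at all.
data Mode (p a k₁ k₂ : ℕ) : Set where
  unflagged : StepBound p a k₁ k₂ (2 * p * (a + (k₁ + k₂) ∸ 1)) → Mode p a k₁ k₂
  flagged   : let x = a + (k₁ + k₂); b = a + (sgn k₁ + sgn k₂) in
              x ≤ 3 * (k₁ + k₂) → 0 < b → StepBound p a k₁ k₂ (2 * p * b + x) → Mode p a k₁ k₂
  one-sided : a ≡ 0 → k₁ ≡ 0 ⊎ k₂ ≡ 0 → StepBound p a k₁ k₂ 0 → Mode p a k₁ k₂

private
  -- The explicit remainder `d` turns the polynomial inequalities of the modes into ring identities.
  ≤-by : ∀ {m n} d → m + d ≡ n → m ≤ n
  ≤-by {m} d refl = ℕ.m≤m+n m d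

StepBound-swap : ∀ p a k₁ k₂ K → StepBound p a k₁ k₂ K → StepBound p a k₂ k₁ K
StepBound-swap p a k₁ k₂ K h
  rewrite ℕ.+-comm k₂ k₁ | ℕ.+-comm (3 * p * k₂) (3 * p * k₁) | ℕ.+-comm (slack p k₂) (slack p k₁) = h

Mode-swap : ∀ {p a k₁ k₂} → Mode p a k₁ k₂ → Mode p a k₂ k₁
Mode-swap {p} {a} {k₁} {k₂} (unflagged h) = unflagged (subst (λ k → StepBound p a k₂ k₁ (2 * p * (a + k ∸ 1)))
  (ℕ.+-comm k₁ k₂) (StepBound-swap p a k₁ k₂ (2 * p * (a + (k₁ + k₂) ∸ 1)) h))
Mode-swap {p} {a} {k₁} {k₂} (flagged x≤ b>0 h) = flagged
  (subst (λ k → a + k ≤ 3 * k) (ℕ.+-comm k₁ k₂) x≤) (subst (λ k → 0 < a + k) (ℕ.+-comm (sgn k₁) (sgn k₂)) b>0)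
  (subst₂ (λ g k → StepBound p a k₂ k₁ (2 * p * (a + g) + (a + k))) (ℕ.+-comm (sgn k₁) (sgn k₂)) (ℕ.+-comm k₁ k₂)
    (StepBound-swap p a k₁ k₂ (2 * p * (a + (sgn k₁ + sgn k₂)) + (a + (k₁ + k₂))) h))
Mode-swap {p} {a} {k₁} {k₂} (one-sided a≡0 (inj₁ e) h) = one-sided a≡0 (inj₂ e) (StepBound-swap p a k₁ k₂ 0 h)
Mode-swap {p} {a} {k₁} {k₂} (one-sided a≡0 (inj₂ e) h) = one-sided a≡0 (inj₁ e) (StepBound-swap p a k₁ k₂ 0 h)

-- With a = 0 the interleaving has to be free: only one copy supplies a -2, and a flag bit would
-- spoil it. From a = 1 on, the chain points pay for the flag; for p = 1 and a = 1 the flagged bound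
-- is an equality.
mode-one : ∀ p a i → Mode (suc p) a (suc i) 0
mode-one p zero i = one-sided refl (inj₂ refl) (≤-by (suc i) (lemma p i))
  where
  lemma : ∀ p i → 0 + (2 * (2 * suc p) + (0 + (suc i + 0))) + 2 * (3 * suc p * suc i + 3 * suc p * 0) + suc i ≡
    3 * (2 * suc p) * (0 + (suc i + 0)) + 2 * (2 * suc p + suc i + 0)
  lemma = solve-∀
mode-one p a@(suc a′) i with ℕ.≤-total (2 * suc i) a
... | inj₁ le = unflagged (subst (λ a → StepBound (suc p) a (suc i) 0 (2 * suc p * (a + (suc i + 0) ∸ 1)))
    (ℕ.m+[n∸m]≡n le) (≤-by (6 * (p * suc i) + 5 * suc i + 4 * (p * d) + 3 * d + 2 * p + 2) (lemma p i d)))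
  where
  d = a ∸ 2 * suc i
  lemma : ∀ p i d → 2 * suc p * (i + suc (i + 0) + d + (suc i + 0)) +
      (2 * (2 * suc p) + (2 * suc i + d + (suc i + 0))) + 2 * (3 * suc p * suc i + 3 * suc p * 0)
    + (6 * (p * suc i) + 5 * suc i + 4 * (p * d) + 3 * d + 2 * p + 2) ≡
    3 * (2 * suc p) * (2 * suc i + d + (suc i + 0)) + 2 * (2 * suc p + suc i + 0)
  lemma = solve-∀
... | inj₂ le = flagged (ℕ.≤-trans (ℕ.+-monoˡ-≤ (suc i + 0) le) (ℕ.≤-reflexive (l (suc i)))) (s≤s z≤n)
    (≤-by (4 * (p * a′) + 2 * p + 2 * a′) (lemma p i a′))
  where
  l : ∀ k → 2 * k + (k + 0) ≡ 3 * (k + 0)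
  l = solve-∀
  lemma : ∀ p i a → 2 * suc p * (suc a + (1 + 0)) + (suc a + (suc i + 0)) +
      (2 * (2 * suc p) + (suc a + (suc i + 0))) + 2 * (3 * suc p * suc i + 3 * suc p * 0)
    + (4 * (p * a) + 2 * p + 2 * a) ≡
    3 * (2 * suc p) * (suc a + (suc i + 0)) + 2 * (2 * suc p + suc i + 0)
  lemma = solve-∀

-- Below the threshold a = 2 (k₁ + k₂) the set has at most 3 (k₁ + k₂) points, as the flagged mode
-- demands; above it one bit per point is affordable. When both copies are met and a = 0, the
-- flagged bound is an equality.
mode : ∀ p a k₁ k₂ → 0 < a + (k₁ + k₂) → Mode (suc p) a k₁ k₂
mode p (suc a) zero zero _ = unflagged (≤-by (4 * (p * a) + 3 * a + 2 * p + 1)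
    (trans (cong (λ n → 2 * suc p * n + (2 * (2 * suc p) + suc n) + 2 * (3 * suc p * 0 + 3 * suc p * 0) +
    (4 * (p * a) + 3 * a + 2 * p + 1)) (ℕ.+-identityʳ a)) (lemma p a)))
  where
  lemma : ∀ p a → 2 * suc p * a + (2 * (2 * suc p) + suc a) + 2 * (3 * suc p * 0 + 3 * suc p * 0) +
      (4 * (p * a) + 3 * a + 2 * p + 1) ≡
    3 * (2 * suc p) * (suc a + (0 + 0)) + 2 * (0 + 0)
  lemma = solve-∀
mode p a (suc i) zero    _ = mode-one p a i
mode p a zero    (suc j) _ = Mode-swap (mode-one p a j)
mode p a k₁@(suc i) k₂@(suc j) _ with ℕ.≤-total (2 * (suc i + suc j)) a
... | inj₁ le = unflagged (subst (λ a → StepBound (suc p) a k₁ k₂ (2 * suc p * (a + (k₁ + k₂) ∸ 1)))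
    (ℕ.m+[n∸m]≡n le) (≤-by (6 * (p * (suc i + suc j)) + 5 * (suc i + suc j) + 4 * (p * d) + 3 * d + 6 * p + 6)
    (lemma p i j d)))
  where
  d = a ∸ 2 * (suc i + suc j)
  lemma : ∀ p i j d → 2 * suc p * (i + suc j + (suc i + suc j + 0) + d + (suc i + suc j)) +
      (2 * (2 * suc p) + (2 * (suc i + suc j) + d + (suc i + suc j))) + 2 * (3 * suc p * suc i + 3 * suc p * suc j)
    + (6 * (p * (suc i + suc j)) + 5 * (suc i + suc j) + 4 * (p * d) + 3 * d + 6 * p + 6) ≡
    3 * (2 * suc p) * (2 * (suc i + suc j) + d + (suc i + suc j)) + 2 * (2 * suc p + suc i + (2 * suc p + suc j))
  lemma = solve-∀
... | inj₂ le = flagged (ℕ.≤-trans (ℕ.+-monoˡ-≤ (k₁ + k₂) le) (ℕ.≤-reflexive (l (k₁ + k₂))))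
    (ℕ.≤-trans (s≤s z≤n) (ℕ.m≤n+m 2 a)) (≤-by (4 * (p * a) + 2 * a) (lemma p i j a))
  where
  l : ∀ k → 2 * k + k ≡ 3 * k
  l = solve-∀
  lemma : ∀ p i j a → 2 * suc p * (a + 2) + (a + (suc i + suc j)) + (2 * (2 * suc p) + (a + (suc i + suc j))) +
      2 * (3 * suc p * suc i + 3 * suc p * suc j)
    + (4 * (p * a) + 2 * a) ≡
    3 * (2 * suc p) * (a + (suc i + suc j)) + 2 * (2 * suc p + suc i + (2 * suc p + suc j))
  lemma = solve-∀

-- There are S e² orderings. The bounds `h₁` and `h₂` are weighted by 2 S e and added to the bound
-- for the interleavings; the slacks y₁ and y₂ are first added to both sides and cancelled at the
-- end.
combine-costs : ∀ p S e K I c₁ c₂ x y₁ y₂ z₁ z₂ → 2 * p * I ≤ e * (e * (S * K)) →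
  p * c₁ + e * y₁ ≤ e * z₁ → p * c₂ + e * y₂ ≤ e * z₂ →
  K + (2 * (2 * p) + x) + 2 * (z₁ + z₂) ≤ 3 * (2 * p) * x + 2 * (y₁ + y₂) →
  2 * p * (I + (S * (e * c₁) + S * (e * c₂))) + S * (e * e) * (2 * (2 * p) + x) ≤ S * (e * e) * (3 * (2 * p) * x)
combine-costs p S e K I c₁ c₂ x y₁ y₂ z₁ z₂ hI h₁ h₂ hK = ℕ.+-cancelʳ-≤ (S * (e * e) * (2 * (y₁ + y₂))) _ _ (begin
  2 * p * (I + (S * (e * c₁) + S * (e * c₂))) + T′ * w + T′ * (2 * (y₁ + y₂)) ≡⟨ l₁ p I S e c₁ c₂ w y₁ y₂ ⟩
  2 * p * I + 2 * (S * e) * (p * c₁ + e * y₁) + 2 * (S * e) * (p * c₂ + e * y₂) + T′ * w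
    ≤⟨ ℕ.+-monoˡ-≤ (T′ * w) (ℕ.+-mono-≤ (ℕ.+-mono-≤ hI (ℕ.*-monoʳ-≤ (2 * (S * e)) h₁))
        (ℕ.*-monoʳ-≤ (2 * (S * e)) h₂)) ⟩
  e * (e * (S * K)) + 2 * (S * e) * (e * z₁) + 2 * (S * e) * (e * z₂) + T′ * w ≡⟨ l₂ S e K z₁ z₂ w ⟩
  T′ * (K + w + 2 * (z₁ + z₂)) ≤⟨ ℕ.*-monoʳ-≤ T′ hK ⟩
  T′ * (3 * (2 * p) * x + 2 * (y₁ + y₂)) ≡⟨ ℕ.*-distribˡ-+ T′ (3 * (2 * p) * x) _ ⟩
  T′ * (3 * (2 * p) * x) + T′ * (2 * (y₁ + y₂)) ∎)
  where
  open ℕ.≤-Reasoning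
  T′ = S * (e * e)
  w = 2 * (2 * p) + x
  l₁ : ∀ p I S e c₁ c₂ w y₁ y₂ → 2 * p * (I + (S * (e * c₁) + S * (e * c₂))) + S * (e * e) * w + S * (e * e) *
      (2 * (y₁ + y₂)) ≡
    2 * p * I + 2 * (S * e) * (p * c₁ + e * y₁) + 2 * (S * e) * (p * c₂ + e * y₂) + S * (e * e) * w
  l₁ = solve-∀
  l₂ : ∀ S e K z₁ z₂ w → e * (e * (S * K)) + 2 * (S * e) * (e * z₁) + 2 * (S * e) * (e * z₂) + S * (e * e) * w ≡
    S * (e * e) * (K + w + 2 * (z₁ + z₂))
  l₂ = solve-∀

map-is-just-annotate : ∀ α μ β → map is-just (annotate α μ β) ≡ α ++ μ ++ β
map-is-just-annotate α μ β = trans (map-++ is-just (annotatePlain α) _) (cong₂ _++_ (plain≡ false α)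
  (trans (map-++ is-just (annotateRun μ) _) (cong₂ _++_ (run≡ μ) (plain≡ false β))))
  where
  plain≡ : ∀ m α → map is-just (map (λ b → if b then just m else nothing) α) ≡ α
  plain≡ m []          = refl
  plain≡ m (true ∷ α)  = cong (true ∷_) (plain≡ m α)
  plain≡ m (false ∷ α) = cong (false ∷_) (plain≡ m α)
  run≡ : ∀ μ → map is-just (annotateRun μ) ≡ μ
  run≡ []          = refl
  run≡ (true ∷ μ)  = cong (true ∷_) (plain≡ true μ)
  run≡ (false ∷ μ) = cong (false ∷_) (run≡ μ)

length-marks : ∀ a k b → length (marks a k b) ≡ a + (k + b)
length-marks a k b = trans (length-++ (plain a)) (cong₂ _+_ (length-replicate a)
  (trans (length-++ (run k)) (cong₂ _+_ (length-run k) (length-replicate b))))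
  where
  length-run : ∀ k → length (run k) ≡ k
  length-run zero    = refl
  length-run (suc k) = cong suc (length-replicate k)

encode-one-sided : ∀ t m₁ m₂ → m₁ ≡ [] ⊎ m₂ ≡ [] → encode t m₁ m₂ ≡ []
encode-one-sided []          m₁       m₂       _           = refl
encode-one-sided (true ∷ t)  []       m₂       (inj₁ refl) = encode-one-sided t [] m₂ (inj₁ refl)
encode-one-sided (false ∷ t) []       m₂       (inj₁ refl) = encode-one-sided t [] (drop 1 m₂) (inj₁ refl)
encode-one-sided (true ∷ t)  []          []    (inj₂ refl) = encode-one-sided t [] [] (inj₂ refl)
encode-one-sided (true ∷ t)  (true ∷ m)  []    (inj₂ refl) = encode-one-sided t m [] (inj₂ refl)
encode-one-sided (true ∷ t)  (false ∷ m) []    (inj₂ refl) = encode-one-sided t m [] (inj₂ refl)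
encode-one-sided (false ∷ t) []          []    (inj₂ refl) = encode-one-sided t [] [] (inj₂ refl)
encode-one-sided (false ∷ t) (true ∷ m)  []    (inj₂ refl) = encode-one-sided t (true ∷ m) [] (inj₂ refl)
encode-one-sided (false ∷ t) (false ∷ m) []    (inj₂ refl) = encode-one-sided t (false ∷ m) [] (inj₂ refl)

length≡0⇒[] : ∀ {xs : List A} → length xs ≡ 0 → xs ≡ []
length≡0⇒[] {xs = []} _ = refl

-- At most (n + 1) · 6n lattice points can spoil a flagged interleaving of a set with at most 6n
-- points; each is visited with probability at most 1 / D-of p n, so together at most 1 / (2p).
D-of : ℕ → ℕ → ℕ
D-of p n = 2 * p * (suc n * (6 * n))

Large : (p n ℓ : ℕ) → Set
Large p n ℓ = D-of p n * D-of p n * (4 * (ℓ + (n + ℓ))) ≤ (2 * ℓ + 1) * (2 * ℓ + 1)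

-- The induction step for codes

module Step (p′ : ℕ) {Q : FinPoset} (E : Enumeration Q) (N>0 : 0 < size Q)
  (ℓ : ℕ) (ℓ>0 : 0 < ℓ) (large : Large (suc p′) (size Q) ℓ)
  (codes : ∀ Y → Code (suc p′) E Y)
  (ER : Enumeration (Chain ℓ ⊕ Q ⊕ Chain ℓ)) (orderings-ER : orderings ER ≡ map (Sandwich.sandwich E ℓ) (orderings E)) where

  open Sandwich E ℓ hiding (enumeration; orderings≡)

  private
    p N m e S W D : ℕ
    p = suc p′
    N = size Q
    m = ℓ + (N + ℓ)
    e = length (orderings E)
    S = B m m
    W = suc N * (6 * N)
    D = D-of p N

  E⊔ : Enumeration ((Chain ℓ ⊕ Q ⊕ Chain ℓ) ⊔ᴾ (Chain ℓ ⊕ Q ⊕ Chain ℓ))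
  E⊔ = ⊔-enumeration ER ER

  private
    Es : List (List (Fin N))
    Es = orderings E

    Sh : List (List Bool)
    Sh = shuffles m m

    open ⊔-Orderings ER ER using (∑-merged; ∈-triples⁻; triple-Shuffle; triples; length-merged)

    place : List Bool → List (Fin N) → List (Fin N) → List (Fin (m + m))
    place s q₁ q₂ = assemble m m (s , sandwich q₁ , sandwich q₂)

    ∈-sandwiches : ∀ {u} → u ∈ orderings ER → ∃ λ q → q ∈ Es × u ≡ sandwich q
    ∈-sandwiches u∈ = ∈.∈-map⁻ sandwich (subst (_ ∈_) orderings-ER u∈)

    sandwich∈ : ∀ {q} → q ∈ Es → sandwich q ∈ orderings ER
    sandwich∈ q∈ = subst (_ ∈_) (sym orderings-ER) (∈.∈-map⁺ sandwich q∈)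

    IsPlace : List (Fin (m + m)) → Set
    IsPlace w = ∃ λ s → ∃₂ λ q₁ q₂ → s ∈ Sh × q₁ ∈ Es × q₂ ∈ Es × w ≡ place s q₁ q₂

    ∈-places : ∀ {w} → w ∈ orderings E⊔ → IsPlace w
    ∈-places w∈ with (s , u , v) , t∈ , refl ← ∈.∈-map⁻ (assemble m m) w∈ with s∈ , u∈ , v∈ ← ∈-triples⁻ t∈
      with q₁ , q₁∈ , refl ← ∈-sandwiches u∈ | q₂ , q₂∈ , refl ← ∈-sandwiches v∈ = s , q₁ , q₂ , s∈ , q₁∈ , q₂∈ , refl

    ∑-sandwiches : ∀ (F : List (Fin m) → ℕ) → ∑ (orderings ER) F ≡ ∑ Es (F ∘ sandwich)
    ∑-sandwiches F = trans (cong (λ us → ∑ us F) orderings-ER) (∑-map sandwich Es F)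

    ∑-places : ∀ F → ∑ (orderings E⊔) F ≡ ∑ Sh λ s → ∑ Es λ q₁ → ∑ Es λ q₂ → F (place s q₁ q₂)
    ∑-places F = trans (∑-merged F) (∑-cong Sh λ s →
      trans (∑-sandwiches λ u → ∑ (orderings ER) λ v → F (assemble m m (s , u , v)))
        (∑-cong Es λ q₁ → ∑-sandwiches λ v → F (assemble m m (s , sandwich q₁ , v))))

    length-E⊔ : length (orderings E⊔) ≡ S * (e * e)
    length-E⊔ = trans length-merged (cong₂ _*_ (length-shuffles m m) (cong₂ _*_ e′ e′))
      where
      e′ : length (orderings ER) ≡ e
      e′ = trans (cong length orderings-ER) (length-map sandwich Es)

  module ForSubset (X : Fin (m + m) → Bool) where

    private
      X₁ X₂ : Fin m → Bool
      X₁ = X ∘ (_↑ˡ m)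
      X₂ = X ∘ (m ↑ʳ_)

      α₁ β₁ α₂ β₂ : List Bool
      α₁ = map (Xα X₁) (allFin ℓ)
      β₁ = map (Xβ X₁) (allFin ℓ)
      α₂ = map (Xα X₂) (allFin ℓ)
      β₂ = map (Xβ X₂) (allFin ℓ)

      Y₁ Y₂ : Fin N → Bool
      Y₁ = Xμ X₁
      Y₂ = Xμ X₂

      module C₁ = Code (codes Y₁)
      module C₂ = Code (codes Y₂)

      k₁ k₂ a x : ℕ
      k₁ = card Y₁
      k₂ = card Y₂
      a  = (# α₁ + # β₁) + (# α₂ + # β₂)
      x  = a + (k₁ + k₂)

      M₁ M₂ : List Bool
      M₁ = marks (# α₁) k₁ (# β₁)
      M₂ = marks (# α₂) k₂ (# β₂)

      x₁ x₂ : List (Fin N) → List (Maybe Bool)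
      x₁ q = annotate α₁ (map Y₁ q) β₁
      x₂ q = annotate α₂ (map Y₂ q) β₂

      word : List Bool → List (Fin N) → List (Fin N) → List Bool
      word s q₁ q₂ = restrictShuffle s (x₁ q₁) (x₂ q₂)

      rearrange : ∀ a k b a′ k′ b′ → a + (k + b) + (a′ + (k′ + b′)) ≡ (a + b) + (a′ + b′) + (k + k′)
      rearrange = solve-∀

      card-X : card X ≡ x
      card-X = trans (card-+ m m X) (trans (cong₂ _+_ (half X₁) (half X₂))
          (rearrange (# α₁) k₁ (# β₁) (# α₂) k₂ (# β₂)))
        where
        half : ∀ X → card X ≡ # map (Xα X) (allFin ℓ) + (card (Xμ X) + # map (Xβ X) (allFin ℓ))
        half X = trans (card-sandwich X) (cong₂ (λ u v → u + (card (Xμ X) + v))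
            (sym (∑-map (Xα X) (allFin ℓ) 𝟙)) (sym (∑-map (Xβ X) (allFin ℓ) 𝟙)))

      length-M : length M₁ + length M₂ ≡ x
      length-M = trans (cong₂ _+_ (length-marks (# α₁) k₁ (# β₁)) (length-marks (# α₂) k₂ (# β₂)))
          (rearrange (# α₁) k₁ (# β₁) (# α₂) k₂ (# β₂))

      #false-M : #false M₁ + #false M₂ ≡ a + (sgn k₁ + sgn k₂)
      #false-M = trans (cong₂ _+_ (#false-marks (# α₁) k₁ (# β₁)) (#false-marks (# α₂) k₂ (# β₂)))
          (rearrange (# α₁) (sgn k₁) (# β₁) (# α₂) (sgn k₂) (# β₂))

      -- Which positions are selected depends on the ordering q, but the sequence of marks depends
      -- only on the number of selected points. Hence the decoder knows `M₁` and `M₂` beforehand.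
      catMaybes-x₁ : ∀ {q} → q ∈ Es → catMaybes (x₁ q) ≡ M₁
      catMaybes-x₁ {q} q∈ = trans (catMaybes-annotate α₁ (map Y₁ q) β₁)
          (cong (λ k → marks (# α₁) k (# β₁)) (#-ordering Q {q} (sound E q∈) Y₁))

      catMaybes-x₂ : ∀ {q} → q ∈ Es → catMaybes (x₂ q) ≡ M₂
      catMaybes-x₂ {q} q∈ = trans (catMaybes-annotate α₂ (map Y₂ q) β₂)
          (cong (λ k → marks (# α₂) k (# β₂)) (#-ordering Q {q} (sound E q∈) Y₂))

      length-chain : ∀ (f : Fin ℓ → Bool) → length (map f (allFin ℓ)) ≡ ℓ
      length-chain f = trans (length-map f (allFin ℓ)) (length-tabulate {n = ℓ} id)

      length-middle : ∀ (f : Fin N → Bool) {q} → q ∈ Es → length (map f q) ≡ N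
      length-middle f {q} q∈ = trans (length-map f q) (IsOrdering⇒length Q (sound E q∈))

      module V {q₁ q₂} (q₁∈ : q₁ ∈ Es) (q₂∈ : q₂ ∈ Es) = NearCentre.Sides D ℓ N ℓ>0 large
        {α₁} {map Y₁ q₁} {β₁} {α₂} {map Y₂ q₂} {β₂}
        (length-chain _) (length-middle Y₁ q₁∈) (length-chain _) (length-chain _) (length-middle Y₂ q₂∈)
            (length-chain _)

      module Bad {q₁ q₂} (q₁∈ : q₁ ∈ Es) (q₂∈ : q₂ ∈ Es) where
        ∑-bad : D * ∑ Sh (λ s → 𝟙 (not (good (word s q₁ q₂) M₁ M₂))) ≤ suc N * x * S
        ∑-bad = subst₂ (λ M M′ → D * ∑ Sh (λ s → 𝟙 (not (good (word s q₁ q₂) M M′))) ≤ suc N * x * S)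
          (catMaybes-x₁ q₁∈) (catMaybes-x₂ q₂∈)
              (ℕ.≤-trans (V.∑-isBad q₁∈ q₂∈) (ℕ.≤-reflexive (cong (λ k → suc N * k * S)
            (trans (cong₂ (λ M M′ → length M + length M′) (catMaybes-x₁ q₁∈) (catMaybes-x₂ q₂∈)) length-M))))

        word-Shuffle : ∀ {s} → s ∈ Sh → Shuffle (word s q₁ q₂) M₁ M₂
        word-Shuffle {s} s∈ = subst₂ (Shuffle (word s q₁ q₂)) (catMaybes-x₁ q₁∈) (catMaybes-x₂ q₂∈)
          (Shuffle-restrict (∈-shuffles⇒Shuffle (x₁ q₁) (x₂ q₂) (subst₂ (λ i j → s ∈ shuffles i j)
            (sym (V.length-x₁ q₁∈ q₂∈)) (sym (V.length-x₂ q₁∈ q₂∈)) s∈)))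

      -- Each of the three parts can be decoded in front of an arbitrary suffix, so their
      -- concatenation can be decoded part by part.
      enc : Bool → List (Fin (m + m)) → List Bool
      enc f w = let (t , w₁ , w₂) = disassemble m m w in
        codeShuffle f M₁ M₂ t ++ (C₁.enc (middle w₁) ++ C₂.enc (middle w₂))

      disassemble-place : ∀ {s q₁ q₂} → s ∈ Sh → q₁ ∈ Es → q₂ ∈ Es →
        disassemble m m (filterᵇ X (place s q₁ q₂)) ≡
            (word s q₁ q₂ , filterᵇ X₁ (sandwich q₁) , filterᵇ X₂ (sandwich q₂))
      disassemble-place {s} {q₁} {q₂} s∈ q₁∈ q₂∈ = disassemble-filterᵇ m m X (x₁ q₁) (x₂ q₂)
        (triple-Shuffle s∈ (sandwich∈ q₁∈) (sandwich∈ q₂∈))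
        (trans (map-is-just-annotate α₁ (map Y₁ q₁) β₁) (sym (map-sandwich X₁ q₁)))
        (trans (map-is-just-annotate α₂ (map Y₂ q₂) β₂) (sym (map-sandwich X₂ q₂)))

      enc-place : ∀ f {s q₁ q₂} → s ∈ Sh → q₁ ∈ Es → q₂ ∈ Es →
        enc f (filterᵇ X (place s q₁ q₂)) ≡ codeShuffle f M₁ M₂ (word s q₁ q₂) ++
            (C₁.enc (filterᵇ Y₁ q₁) ++ C₂.enc (filterᵇ Y₂ q₂))
      enc-place f {s} {q₁} {q₂} s∈ q₁∈ q₂∈ = trans
        (cong (λ (t , w₁ , w₂) → codeShuffle f M₁ M₂ t ++ (C₁.enc (middle w₁) ++ C₂.enc (middle w₂)))
            (disassemble-place s∈ q₁∈ q₂∈))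
        (cong₂ (λ u v → codeShuffle f M₁ M₂ (word s q₁ q₂) ++ (C₁.enc u ++ C₂.enc v)) (middle-filterᵇ X₁ q₁)
            (middle-filterᵇ X₂ q₂))

      filterᵇ-place : ∀ {s q₁ q₂} → s ∈ Sh → q₁ ∈ Es → q₂ ∈ Es →
        filterᵇ X (place s q₁ q₂) ≡ assemble m m (word s q₁ q₂ , filterᵇ X₁ (sandwich q₁) , filterᵇ X₂ (sandwich q₂))
      filterᵇ-place {s} {q₁} {q₂} s∈ q₁∈ q₂∈ =
          trans (sym (assemble-disassemble m m (filterᵇ X (place s q₁ q₂))))
          (cong (assemble m m) (disassemble-place s∈ q₁∈ q₂∈))

      -- The selected chain points appear in the same order in every sandwich, so the code of the
      -- middle part determines the whole restricted side.
      filterᵇ-sandwich-cong : ∀ X′ {q q′} → filterᵇ (Xμ X′) q ≡ filterᵇ (Xμ X′) q′ → filterᵇ X′ (sandwich q) ≡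
          filterᵇ X′ (sandwich q′)
      filterᵇ-sandwich-cong X′ {q} {q′} eq = trans (filterᵇ-sandwich X′ q)
        (trans (cong (λ u → concatenate (filterᵇ (Xα X′) (allFin ℓ))
            (concatenate u (filterᵇ (Xβ X′) (allFin ℓ)))) eq) (sym (filterᵇ-sandwich X′ q′)))

      decodable : ∀ f {w w′} → w ∈ orderings E⊔ → w′ ∈ orderings E⊔ → ∀ {u u′} →
        enc f (filterᵇ X w) ++ u ≡ enc f (filterᵇ X w′) ++ u′ → filterᵇ X w ≡ filterᵇ X w′ × u ≡ u′
      decodable f {w} {w′} w∈ w′∈ {u} {u′} = fromPlaces (∈-places w∈) (∈-places w′∈)
       where
       fromPlaces : IsPlace w → IsPlace w′ → enc f (filterᵇ X w) ++ u ≡ enc f (filterᵇ X w′) ++ u′ →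
           filterᵇ X w ≡ filterᵇ X w′ × u ≡ u′
       fromPlaces (s , q₁ , q₂ , s∈ , q₁∈ , q₂∈ , refl) (s′ , q₁′ , q₂′ , s∈′ , q₁∈′ , q₂∈′ , refl) eq =
        trans (filterᵇ-place s∈ q₁∈ q₂∈) (trans (cong (assemble m m) (cong₂ _,_ t≡ (cong₂ _,_
          (filterᵇ-sandwich-cong X₁ (proj₁ second)) (filterᵇ-sandwich-cong X₂ (proj₁ third)))))
              (sym (filterᵇ-place s∈′ q₁∈′ q₂∈′))) ,
        proj₂ third
        where
        split : ∀ t v₁ v₂ u → (t ++ (v₁ ++ v₂)) ++ u ≡ t ++ (v₁ ++ (v₂ ++ u))
        split t v₁ v₂ u = trans (++-assoc t (v₁ ++ v₂) u) (cong (t ++_) (++-assoc v₁ v₂ u))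
        first : word s q₁ q₂ ≡ word s′ q₁′ q₂′ × C₁.enc (filterᵇ Y₁ q₁) ++ (C₂.enc (filterᵇ Y₂ q₂) ++ u) ≡
            C₁.enc (filterᵇ Y₁ q₁′) ++ (C₂.enc (filterᵇ Y₂ q₂′) ++ u′)
        first = codeShuffle-decodable f (Bad.word-Shuffle q₁∈ q₂∈ s∈) (Bad.word-Shuffle q₁∈′ q₂∈′ s∈′)
          (trans (sym (split (codeShuffle f M₁ M₂ (word s q₁ q₂)) (C₁.enc (filterᵇ Y₁ q₁))
              (C₂.enc (filterᵇ Y₂ q₂)) u)) (trans
              (trans (cong (_++ u) (sym (enc-place f s∈ q₁∈ q₂∈)))
              (trans eq (cong (_++ u′) (enc-place f s∈′ q₁∈′ q₂∈′))))
            (split (codeShuffle f M₁ M₂ (word s′ q₁′ q₂′)) (C₁.enc (filterᵇ Y₁ q₁′)) (C₂.enc (filterᵇ Y₂ q₂′)) u′)))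
        t≡ = proj₁ first
        second = C₁.decodable q₁∈ q₁∈′ (proj₂ first)
        third = C₂.decodable q₂∈ q₂∈′ (proj₂ second)

      interleaving : Bool → List (Fin N) → List (Fin N) → ℕ
      interleaving f q₁ q₂ = ∑ Sh λ s → length (codeShuffle f M₁ M₂ (word s q₁ q₂))

      cost≡ : ∀ f → ∑ (orderings E⊔) (λ w → length (enc f (filterᵇ X w))) ≡
        ∑ Es (λ q₁ → ∑ Es λ q₂ → interleaving f q₁ q₂) + (S * (e * C₁.cost) + S * (e * C₂.cost))
      cost≡ f = begin
        ∑ (orderings E⊔) (λ w → length (enc f (filterᵇ X w)))
          ≡⟨ ∑-places _ ⟩
        ∑ Sh (λ s → ∑ Es λ q₁ → ∑ Es λ q₂ → length (enc f (filterᵇ X (place s q₁ q₂))))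
          ≡⟨ ∑-cong-∈ Sh (λ s s∈ → ∑-cong-∈ Es λ q₁ q₁∈ → ∑-cong-∈ Es λ q₂ q₂∈ →
              trans (cong length (enc-place f s∈ q₁∈ q₂∈))
               (trans (length-++ (codeShuffle f M₁ M₂ (word s q₁ q₂)))
                   (cong (lI s q₁ q₂ ℕ.+_) (length-++ (C₁.enc (filterᵇ Y₁ q₁)))))) ⟩
        ∑ Sh (λ s → ∑ Es λ q₁ → ∑ Es λ q₂ → lI s q₁ q₂ + (l₁ q₁ + l₂ q₂))
          ≡⟨ ∑-cong Sh (λ s → trans (∑-cong Es λ q₁ →
              trans (∑-+ Es _ _) (cong (∑ Es (λ q₂ → lI s q₁ q₂) ℕ.+_)
              (trans (∑-+ Es _ _) (cong (_+ C₂.cost) (∑-const Es (l₁ q₁))))))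
               (trans (∑-+ Es _ _) (cong (∑ Es (λ q₁ → ∑ Es λ q₂ → lI s q₁ q₂) ℕ.+_)
                   (trans (∑-+ Es _ _) (cong₂ _+_ (∑-*ˡ Es e l₁) (∑-const Es C₂.cost)))))) ⟩
        ∑ Sh (λ s → ∑ Es (λ q₁ → ∑ Es λ q₂ → lI s q₁ q₂) + (e * C₁.cost + e * C₂.cost))
          ≡⟨ trans (∑-+ Sh _ _) (cong₂ _+_ (∑-swap₃ Sh Es Es lI)
              (trans (∑-const Sh _) (trans (cong (_* (e * C₁.cost + e * C₂.cost)) (length-shuffles m m))
              (ℕ.*-distribˡ-+ S (e * C₁.cost) _)))) ⟩
        ∑ Es (λ q₁ → ∑ Es λ q₂ → interleaving f q₁ q₂) + (S * (e * C₁.cost) + S * (e * C₂.cost)) ∎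
        where
        open ≡-Reasoning
        lI : List Bool → List (Fin N) → List (Fin N) → ℕ
        lI s q₁ q₂ = length (codeShuffle f M₁ M₂ (word s q₁ q₂))
        l₁ l₂ : List (Fin N) → ℕ
        l₁ q = length (C₁.enc (filterᵇ Y₁ q))
        l₂ q = length (C₂.enc (filterᵇ Y₂ q))

      codeFrom : 0 < x → ∀ f K → (∀ {q₁ q₂} → q₁ ∈ Es → q₂ ∈ Es → 2 * p * interleaving f q₁ q₂ ≤ S * K) →
        StepBound p a k₁ k₂ K → Code (2 * p) E⊔ X
      codeFrom x>0 f K le hK = record
        { enc       = enc f
        ; decodable = decodable f
        ; bound     = subst₂ _≤_
            (cong₂ _+_ (cong (2 * p *_) (sym (cost≡ f)))
                (cong₂ _*_ (sym length-E⊔) (trans (sym (slack≡ x>0)) (cong (slack (2 * p)) (sym card-X)))))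
            (cong₂ _*_ (sym length-E⊔) (cong (3 * (2 * p) *_) (sym card-X)))
            (combine-costs p S e K I C₁.cost C₂.cost x (slack p k₁) (slack p k₂) (3 * p * k₁)
                (3 * p * k₂) I≤ C₁.bound C₂.bound hK)
        }
        where
        slack≡ : ∀ {x} → 0 < x → slack (2 * p) x ≡ 2 * (2 * p) + x
        slack≡ {suc x} _ = refl
        I = ∑ Es (λ q₁ → ∑ Es λ q₂ → interleaving f q₁ q₂)
        I≤ : 2 * p * I ≤ e * (e * (S * K))
        I≤ = begin
          2 * p * I ≡⟨ ∑-*ˡ Es (2 * p) _ ⟨
          ∑ Es (λ q₁ → 2 * p * ∑ Es λ q₂ → interleaving f q₁ q₂) ≡⟨ ∑-cong Es (λ q₁ → sym (∑-*ˡ Es (2 * p) _)) ⟩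
          ∑ Es (λ q₁ → ∑ Es λ q₂ → 2 * p * interleaving f q₁ q₂)
            ≤⟨ ∑-mono-∈ Es (λ q₁ q₁∈ → ∑-mono-∈ Es λ q₂ q₂∈ → le q₁∈ q₂∈) ⟩
          ∑ Es (λ q₁ → ∑ Es λ q₂ → S * K) ≡⟨ trans (∑-cong Es λ q₁ → ∑-const Es (S * K)) (∑-const Es _) ⟩
          e * (e * (S * K)) ∎
          where open ℕ.≤-Reasoning

      bound-const : ∀ f c {q₁ q₂} → (∀ {s} → s ∈ Sh → length (codeShuffle f M₁ M₂ (word s q₁ q₂)) ≤ c) →
        2 * p * interleaving f q₁ q₂ ≤ S * (2 * p * c)
      bound-const f c {q₁} {q₂} le = begin
        2 * p * interleaving f q₁ q₂ ≤⟨ ℕ.*-monoʳ-≤ (2 * p) (∑-mono-∈ Sh λ s s∈ → le s∈) ⟩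
        2 * p * ∑ Sh (λ _ → c)
          ≡⟨ cong (2 * p *_) (trans (∑-const Sh c) (cong (_* c) (length-shuffles m m))) ⟩
        2 * p * (S * c) ≡⟨ swap (2 * p) S c ⟩
        S * (2 * p * c) ∎
        where
        open ℕ.≤-Reasoning
        swap : ∀ a b c → a * (b * c) ≡ b * (a * c)
        swap = solve-∀

      -- For each fixed pair of orderings of the copies, at most a fraction 1/(2p) of the shuffles
      -- is bad, and a bad one costs at most x extra bits. This is the summand x next to
      -- `2 * p * b`.
      bound-flagged : x ≤ 3 * (k₁ + k₂) → let b = a + (sgn k₁ + sgn k₂) in 0 < b → ∀ {q₁ q₂} → q₁ ∈ Es → q₂ ∈ Es →
        2 * p * interleaving true q₁ q₂ ≤ S * (2 * p * b + x)
      bound-flagged x≤ b>0 {q₁} {q₂} q₁∈ q₂∈ = begin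
        2 * p * interleaving true q₁ q₂
          ≤⟨ ℕ.*-monoʳ-≤ (2 * p) (∑-mono-∈ Sh λ s s∈ →
              subst₂ (λ b x → length (codeShuffle true M₁ M₂ (word s q₁ q₂)) ≤ b + bad s * x) #false-M length-M
                (length-codeShuffle-true (Bad.word-Shuffle q₁∈ q₂∈ s∈) (subst (0 <_) (sym #false-M) b>0))) ⟩
        2 * p * ∑ Sh (λ s → b + bad s * x)
          ≡⟨ cong (2 * p *_) (trans (∑-+ Sh _ _)
              (cong₂ _+_ (trans (∑-const Sh b) (cong (_* b) (length-shuffles m m))) (∑-*ʳ Sh x bad))) ⟩
        2 * p * (S * b + ∑ Sh bad * x) ≡⟨ l₁ (2 * p) S b (∑ Sh bad) x ⟩
        S * (2 * p * b) + 2 * p * ∑ Sh bad * x ≤⟨ ℕ.+-monoʳ-≤ (S * (2 * p * b)) (ℕ.*-monoˡ-≤ x few) ⟩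
        S * (2 * p * b) + S * x ≡⟨ ℕ.*-distribˡ-+ S (2 * p * b) x ⟨
        S * (2 * p * b + x) ∎
        where
        open ℕ.≤-Reasoning
        b = a + (sgn k₁ + sgn k₂)
        bad : List Bool → ℕ
        bad s = 𝟙 (not (good (word s q₁ q₂) M₁ M₂))
        l₁ : ∀ q S b c x → q * (S * b + c * x) ≡ S * (q * b) + q * c * x
        l₁ = solve-∀
        l₂ : ∀ N → 3 * (N + N) ≡ 6 * N
        l₂ = solve-∀
        l₃ : ∀ w q c → w * (q * c) ≡ q * w * c
        l₃ = solve-∀
        -- Here the condition of the flagged mode removes ℓ from the bound on the size of X.
        x≤6N : x ≤ 6 * N
        x≤6N = ℕ.≤-trans x≤ (ℕ.≤-trans (ℕ.*-monoʳ-≤ 3 (ℕ.+-mono-≤ (card≤n Y₁) (card≤n Y₂))) (ℕ.≤-reflexive (l₂ N)))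
        few : 2 * p * ∑ Sh bad ≤ S
        few = ℕ.*-cancelˡ-≤ W {{ℕ.m*n≢0 (suc N) (6 * N) {{_}} {{ℕ.m*n≢0 6 N {{_}} {{ℕ.>-nonZero N>0}}}}}} (begin
          W * (2 * p * ∑ Sh bad) ≡⟨ l₃ W (2 * p) (∑ Sh bad) ⟩
          D * ∑ Sh bad ≤⟨ Bad.∑-bad q₁∈ q₂∈ ⟩
          suc N * x * S ≤⟨ ℕ.*-monoˡ-≤ S (ℕ.*-monoʳ-≤ (suc N) x≤6N) ⟩
          W * S ∎)

      one-sided-[] : a ≡ 0 → k₁ ≡ 0 ⊎ k₂ ≡ 0 → plain (length M₁) ≡ [] ⊎ plain (length M₂) ≡ []
      one-sided-[] a≡0 (inj₁ k₁≡0) = inj₁ (cong plain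
          (trans (length-marks (# α₁) k₁ (# β₁))
          (cong₂ _+_ (ℕ.m+n≡0⇒m≡0 (# α₁) ab) (cong₂ _+_ k₁≡0 (ℕ.m+n≡0⇒n≡0 (# α₁) ab)))))
        where ab = ℕ.m+n≡0⇒m≡0 (# α₁ + # β₁) a≡0
      one-sided-[] a≡0 (inj₂ k₂≡0) = inj₂ (cong plain
          (trans (length-marks (# α₂) k₂ (# β₂))
          (cong₂ _+_ (ℕ.m+n≡0⇒m≡0 (# α₂) ab) (cong₂ _+_ k₂≡0 (ℕ.m+n≡0⇒n≡0 (# α₂) ab)))))
        where ab = ℕ.m+n≡0⇒n≡0 (# α₁ + # β₁) a≡0

      nonempty-code : 0 < x → Mode p a k₁ k₂ → Code (2 * p) E⊔ X
      nonempty-code x>0 (unflagged hK) = codeFrom x>0 false (2 * p * (x ∸ 1))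
          (λ {q₁} {q₂} q₁∈ q₂∈ → bound-const false (x ∸ 1) {q₁} {q₂} λ {s} s∈ →
              subst (λ n → length (codeShuffle false M₁ M₂ (word s q₁ q₂)) ≤ n ∸ 1) length-M
                  (length-codeShuffle-false (Bad.word-Shuffle q₁∈ q₂∈ s∈))) hK
      nonempty-code x>0 (flagged x≤ b>0 hK) = codeFrom x>0 true _ (bound-flagged x≤ b>0) hK
      nonempty-code x>0 (one-sided a≡0 k≡0 hK) =
          codeFrom x>0 false 0 (λ {q₁} {q₂} _ _ → ℕ.≤-trans (bound-const false 0 {q₁} {q₂} λ {s} _ →
              ℕ.≤-reflexive (cong length (encode-one-sided (word s q₁ q₂) _ _ (one-sided-[] a≡0 k≡0))))
                  (ℕ.≤-reflexive (cong (S *_) (ℕ.*-zeroʳ (2 * p))))) hK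

      empty-code : x ≡ 0 → Code (2 * p) E⊔ X
      empty-code x≡0 = record
        { enc       = λ _ → []
        ; decodable = λ u∈ v∈ eq → trans (empty u∈) (sym (empty v∈)) , eq
        ; bound     = ℕ.≤-trans (ℕ.≤-reflexive
            (cong₂ _+_ (trans (cong (2 * p *_) (∑-0 (orderings E⊔))) (ℕ.*-zeroʳ (2 * p)))
                        (trans (cong (length (orderings E⊔) *_) (cong (slack (2 * p)) (trans card-X x≡0)))
                            (ℕ.*-zeroʳ (length (orderings E⊔)))))) z≤n
        }
        where
        empty : ∀ {u} → u ∈ orderings E⊔ → filterᵇ X u ≡ []
        empty {u} u∈ = length≡0⇒[] (trans (length-filterᵇ X u)
            (trans (∑-ordering ((Chain ℓ ⊕ Q ⊕ Chain ℓ) ⊔ᴾ (Chain ℓ ⊕ Q ⊕ Chain ℓ)) {u} (sound E⊔ u∈) (𝟙 ∘ X))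
            (trans card-X x≡0)))

    code : Code (2 * p) (⊔-enumeration ER ER) X
    code = fromSize x refl
      where
      fromSize : ∀ n → n ≡ x → Code (2 * p) E⊔ X
      fromSize zero    eq = empty-code (sym eq)
      fromSize (suc n) eq = nonempty-code x>0 (mode p′ a k₁ k₂ x>0)
        where
        x>0 : 0 < x
        x>0 = subst (0 <_) eq (s≤s z≤n)

-- The entropy per point

filter-does : ∀ {p} {P : A → Set p} (P? : ∀ x → Dec (P x)) (q : A → Bool) → (∀ x → does (P? x) ≡ q x) → ∀ xs →
    filter P? xs ≡ filterᵇ q xs
filter-does P? q eq []       = refl
filter-does P? q eq (x ∷ xs) with does (P? x) | q x | eq x
... | true  | true  | _ = cong (x ∷_) (filter-does P? q eq xs)
... | false | false | _ = filter-does P? q eq xs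

does-∈? : ∀ {n} x (X : Subset n) → does (x ∈? X) ≡ Vec.lookup X x
does-∈? zero    (true ∷ X)  = refl
does-∈? zero    (false ∷ X) = refl
does-∈? (suc x) (_ ∷ X)     = does-∈? x X

∣∣≡card : ∀ {n} (X : Subset n) → ∣ X ∣ ≡ card (Vec.lookup X)
∣∣≡card []      = refl
∣∣≡card (b ∷ X) = trans (∣∷∣ b) (cong (𝟙 b ℕ.+_)
    (trans (∣∣≡card X) (trans (sym (∑-map suc (allFin _) (𝟙 ∘ Vec.lookup (b ∷ X))))
  (cong (λ xs → ∑ xs (𝟙 ∘ Vec.lookup (b ∷ X))) (map-tabulate id suc)))))
  where
  ∣∷∣ : ∀ b → ∣ b ∷ X ∣ ≡ 𝟙 b + ∣ X ∣
  ∣∷∣ true  = refl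
  ∣∷∣ false = refl

seq-foldr-⊔ᴿ : ∀ (p : ℚ → Set) → (∀ x y → p x → p y → p (x ℚ.⊔ y)) → ∀ n (f : A → ℝ) xs →
  p 0ℚ → (∀ x → x ∈ xs → p (seq (f x) n)) → p (seq (foldr _⊔ᴿ_ 0ᴿ (map f xs)) n)
seq-foldr-⊔ᴿ p closed n f []       p₀ ps = p₀
seq-foldr-⊔ᴿ p closed n f (x ∷ xs) p₀ ps = closed (seq (f x) n) (seq (foldr _⊔ᴿ_ 0ᴿ (map f xs)) n)
  (ps x (here refl)) (seq-foldr-⊔ᴿ p closed n f xs p₀ λ y y∈ → ps y (there y∈))

module _ (p′ : ℕ) {Q : FinPoset} (E : Enumeration Q) (e>0 : 0 < length (orderings E)) (codes : ∀ Y → Code (suc p′) E Y) where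

  private
    p T′ : ℕ
    p  = suc p′
    T′ = length (orderings E)

    -- Half of the margin 1/p in the bound for codes.
    ε : ℚ
    ε = + 1 / (2 * p)

    ε*2p : ε ℚ.* ι (2 * p) ≡ 1ℚ
    ε*2p = /-*-ι 1 (p′ + suc (p′ + 0))

    module ForX (X : Subset (size Q)) (X>0 : 0 < ∣ X ∣) where
      Y : Fin (size Q) → Bool
      Y = Vec.lookup X

      c : ℕ
      c = ∣ X ∣

      module Y = Code (codes Y)

      LE : List (Labelling Q)
      LE = linearExtensions Q

      samples : List (List (Fin (size Q)))
      samples = map (restrict Q X ∘ ordering Q) LE

      restrict≡ : ∀ w → restrict Q X w ≡ filterᵇ Y w
      restrict≡ = filter-does (_∈? X) Y λ x → does-∈? x X

      length-samples : length samples ≡ T′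
      length-samples = trans (length-map (restrict Q X ∘ ordering Q) LE)
          (trans (sym (length-map (ordering Q) LE)) (↭.↭-length (map-ordering-↭ E)))

      ∑-samples : ∑ samples (length ∘ Y.enc) ≡ Y.cost
      ∑-samples = trans (∑-map (restrict Q X ∘ ordering Q) LE (length ∘ Y.enc))
        (trans (∑-cong LE λ f → cong (length ∘ Y.enc) (restrict≡ (ordering Q f)))
        (trans (sym (∑-map (ordering Q) LE λ w → length (Y.enc (filterᵇ Y w))))
            (∑-↭ (λ w → length (Y.enc (filterᵇ Y w))) (map-ordering-↭ E))))

      sample⁻ : ∀ {v} → v ∈ samples → ∃ λ w → w ∈ orderings E × v ≡ filterᵇ Y w
      sample⁻ v∈ with f , f∈ , refl ← ∈.∈-map⁻ (restrict Q X ∘ ordering Q) v∈ =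
        ordering Q f , complete E (ordering-isOrdering Q f (∈-linearExtensions⁻ Q f∈)) , restrict≡ (ordering Q f)

      prefixFree : PrefixFree Y.enc samples
      prefixFree x∈ y∈ s t eq with u , u∈ , refl ← sample⁻ x∈ | v , v∈ , refl ← sample⁻ y∈ = proj₁ (Y.decodable u∈ v∈ eq)

      cost-bound : p * Y.cost + T′ * (2 * p + c) ≤ T′ * (3 * p * c)
      cost-bound = subst₂ (λ a b → p * Y.cost + T′ * a ≤ T′ * (3 * p * b)) (slack≡ X>0) (sym (∣∣≡card X))
        (subst (λ b → p * Y.cost + T′ * slack p b ≤ T′ * (3 * p * card Y)) (sym (∣∣≡card X)) Y.bound)
        where
        slack≡ : ∀ {c} → 0 < c → slack p c ≡ 2 * p + c
        slack≡ {suc c} _ = refl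

      -- The bound on the n-th approximant per point, with denominators cleared. Of the slack 2p +
      -- c, the part 2p covers the rounding error 1/(n + 1) ≤ 1 and the part c leaves the uniform
      -- margin 1/(2p).
      nat-bound : ∀ n → (suc n * Y.cost + T′) * (2 * p) + c * (T′ * suc n) ≤ 3 * (c * (T′ * suc n) * (2 * p))
      nat-bound n = begin
        (N * Y.cost + T′) * (2 * p) + c * (T′ * N)
          ≤⟨ ℕ.m≤m+n _ (T′ * (2 * p) * n + 2 * p * (T′ * N) + c * (T′ * N)) ⟩
        (N * Y.cost + T′) * (2 * p) + c * (T′ * N) + (T′ * (2 * p) * n + 2 * p * (T′ * N) + c * (T′ * N))
          ≡⟨ l₁ n Y.cost T′ p c ⟩
        2 * N * (p * Y.cost + T′ * (2 * p + c)) ≤⟨ ℕ.*-monoʳ-≤ (2 * N) cost-bound ⟩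
        2 * N * (T′ * (3 * p * c)) ≡⟨ l₂ N T′ p c ⟩
        3 * (c * (T′ * N) * (2 * p)) ∎
        where
        open ℕ.≤-Reasoning
        N = suc n
        l₁ : ∀ n C T p c → (suc n * C + T) * (2 * p) + c * (T * suc n) +
            (T * (2 * p) * n + 2 * p * (T * suc n) + c * (T * suc n)) ≡ 2 * suc n * (p * C + T * (2 * p + c))
        l₁ = solve-∀
        l₂ : ∀ N T p c → 2 * N * (T * (3 * p * c)) ≡ 3 * (c * (T * N) * (2 * p))
        l₂ = solve-∀

      rearrange : ∀ r H ε c t q → (r ℚ.* H ℚ.+ ε) ℚ.* (c ℚ.* t ℚ.* q) ≡
          (r ℚ.* c) ℚ.* (H ℚ.* t) ℚ.* q ℚ.+ (ε ℚ.* q) ℚ.* (c ℚ.* t)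
      rearrange = solve 6 (λ r H ε c t q → (r :* H :+ ε) :* (c :* t :* q) := (r :* c) :* (H :* t) :* q :+
          (ε :* q) :* (c :* t)) refl
        where open +-*-Solver

      perPoint≤ : ∀ n (H : ℝ) → seq H n ℚ.* ι (T′ * suc n) ℚ.≤ ι (suc n * Y.cost + T′) →
          ratio 1 c ℚ.* seq H n ℚ.+ ε ℚ.≤ + 3 / 1
      perPoint≤ n H le = ℚ.*-cancelʳ-≤-pos F {{F-pos}} (begin
        (ratio 1 c ℚ.* Hn ℚ.+ ε) ℚ.* F ≡⟨ rearrange (ratio 1 c) Hn ε (ι c) t (ι (2 * p)) ⟩
        (ratio 1 c ℚ.* ι c) ℚ.* (Hn ℚ.* t) ℚ.* ι (2 * p) ℚ.+ (ε ℚ.* ι (2 * p)) ℚ.* (ι c ℚ.* t)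
          ≡⟨ cong₂ (λ a b → a ℚ.* (Hn ℚ.* t) ℚ.* ι (2 * p) ℚ.+ b ℚ.* (ι c ℚ.* t)) (ratio-*-ι 1 X>0) ε*2p ⟩
        1ℚ ℚ.* (Hn ℚ.* t) ℚ.* ι (2 * p) ℚ.+ 1ℚ ℚ.* (ι c ℚ.* t)
          ≡⟨ cong₂ (λ a b → a ℚ.* ι (2 * p) ℚ.+ b) (ℚ.*-identityˡ (Hn ℚ.* t)) (ℚ.*-identityˡ (ι c ℚ.* t)) ⟩
        (Hn ℚ.* t) ℚ.* ι (2 * p) ℚ.+ ι c ℚ.* t
          ≤⟨ ℚ.+-monoˡ-≤ (ι c ℚ.* t) (ℚ.*-monoʳ-≤-nonNeg (ι (2 * p))
              {{ℚ.pos⇒nonNeg (ι (2 * p)) {{ι-pos (2 * p)}}}} le) ⟩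
        ι (suc n * Y.cost + T′) ℚ.* ι (2 * p) ℚ.+ ι c ℚ.* t
          ≡⟨ cong₂ ℚ._+_ (ι-* (suc n * Y.cost + T′) (2 * p)) (ι-* c (T′ * suc n)) ⟨
        ι ((suc n * Y.cost + T′) * (2 * p)) ℚ.+ ι (c * (T′ * suc n))
          ≡⟨ ι-+ ((suc n * Y.cost + T′) * (2 * p)) (c * (T′ * suc n)) ⟨
        ι ((suc n * Y.cost + T′) * (2 * p) + c * (T′ * suc n)) ≤⟨ ι-mono-≤ (nat-bound n) ⟩
        ι (3 * (c * (T′ * suc n) * (2 * p))) ≡⟨ ι-* 3 (c * (T′ * suc n) * (2 * p)) ⟩
        ι 3 ℚ.* ι (c * (T′ * suc n) * (2 * p))
          ≡⟨ cong (ι 3 ℚ.*_) (trans (ι-* (c * (T′ * suc n)) (2 * p)) (cong (ℚ._* ι (2 * p)) (ι-* c (T′ * suc n)))) ⟩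
        ι 3 ℚ.* F ∎)
        where
        open ℚ.≤-Reasoning
        Hn = seq H n
        t = ι (T′ * suc n)
        F = ι c ℚ.* t ℚ.* ι (2 * p)
        F-pos : ℚ.Positive F
        F-pos = ℚ.pos*pos⇒pos (ι c ℚ.* t) {{ℚ.pos*pos⇒pos (ι c) {{ι-pos c {{ℕ.>-nonZero X>0}}}} t
            {{ι-pos (T′ * suc n) {{ℕ.m*n≢0 T′ (suc n) {{ℕ.>-nonZero e>0}}}}}}}} (ι (2 * p)) {{ι-pos (2 * p)}}

      bound : ∀ n → ratio 1 c ℚ.* seq (entropy (List.≡-dec Fin._≟_) samples) n ℚ.+ ε ℚ.≤ + 3 / 1
      bound n = perPoint≤ n (entropy (List.≡-dec Fin._≟_) samples)
        (subst₂ (λ a b → seq (entropy (List.≡-dec Fin._≟_) samples) n ℚ.* ι (a * suc n) ℚ.≤ ι (suc n * b + a))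
            length-samples ∑-samples
          (entropy-bound (List.≡-dec Fin._≟_) samples Y.enc (subst (0 <_) (sym length-samples) e>0) prefixFree n))

  -- The margin is the same for every nonempty subset and every approximant, so it survives the
  -- maximum and holds from index 0 on.
  τ<3 : τ Q <ᴿ fromℚ (+ 3 / 1)
  τ<3 = ε , ℚ.positive⁻¹ ε {{ε-pos}} , 0 , λ n _ → seq-foldr-⊔ᴿ (λ y → y ℚ.+ ε ℚ.≤ + 3 / 1) closed n
    (λ X → ratio 1 ∣ X ∣ · entropy (List.≡-dec Fin._≟_) (map (restrict Q X ∘ ordering Q) (linearExtensions Q)))
    (nonemptySubsets (size Q)) base (λ X X∈ →
        ForX.bound X (nonempty X (proj₂ (∈.∈-filter⁻ nonempty? {xs = allVecs (true ∷ false ∷ []) (size Q)} X∈))) n)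
    where
    ε-pos : ℚ.Positive ε
    ε-pos = ℚ.normalize-pos 1 (2 * p)
    closed : ∀ x y → x ℚ.+ ε ℚ.≤ + 3 / 1 → y ℚ.+ ε ℚ.≤ + 3 / 1 → (x ℚ.⊔ y) ℚ.+ ε ℚ.≤ + 3 / 1
    closed x y hx hy with ℚ.⊔-sel x y
    ... | inj₁ eq = subst (λ z → z ℚ.+ ε ℚ.≤ + 3 / 1) (sym eq) hx
    ... | inj₂ eq = subst (λ z → z ℚ.+ ε ℚ.≤ + 3 / 1) (sym eq) hy
    base : 0ℚ ℚ.+ ε ℚ.≤ + 3 / 1
    base = subst (ℚ._≤ + 3 / 1) (sym (ℚ.+-identityˡ ε)) (/-≤ 1 (p′ + suc (p′ + 0)) 3 0 (s≤s z≤n))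
    nonempty : ∀ X → Nonempty X → 0 < ∣ X ∣
    nonempty X (x , x∈) = subst (0 <_) (sym (∣∣≡card X))
      (ℕ.≤-trans (ℕ.≤-reflexive (sym (cong 𝟙 (Vec.[]=⇒lookup x∈)))) (term≤∑ (𝟙 ∘ Vec.lookup X) (∈.∈-allFin x)))

-- The sequence

-- As n ≤ ℓ, each half has m ≤ 3ℓ points, and ℓ = 3D² gives D² · 4m ≤ 12 D² ℓ = 4ℓ², which is below
-- (2ℓ + 1)².
ℓ-of : ℕ → ℕ → ℕ
ℓ-of p n = 3 * (D-of p n * D-of p n)

D-pos : ∀ p n → 0 < p → 0 < n → 0 < D-of p n
D-pos (suc p) (suc n) _ _ = s≤s z≤n

ℓ-pos : ∀ p n → 0 < p → 0 < n → 0 < ℓ-of p n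
ℓ-pos p n p>0 n>0 = ℕ.*-mono-< {0} {3} (s≤s z≤n) (ℕ.*-mono-< (D-pos p n p>0 n>0) (D-pos p n p>0 n>0))

n≤ℓ : ∀ p n → 0 < p → 0 < n → n ≤ ℓ-of p n
n≤ℓ p n p>0 n>0 = begin
  n ≤⟨ ℕ.m≤m*n n 6 ⟩
  n * 6 ≡⟨ ℕ.*-comm n 6 ⟩
  6 * n ≤⟨ ℕ.m≤m+n (6 * n) (n * (6 * n)) ⟩
  suc n * (6 * n) ≤⟨ ℕ.m≤n*m (suc n * (6 * n)) (2 * p) {{ℕ.m*n≢0 2 p {{_}} {{ℕ.>-nonZero p>0}}}} ⟩
  D-of p n ≤⟨ ℕ.m≤m*n (D-of p n) (D-of p n) {{ℕ.>-nonZero (D-pos p n p>0 n>0)}} ⟩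
  D-of p n * D-of p n ≤⟨ ℕ.m≤n*m (D-of p n * D-of p n) 3 ⟩
  ℓ-of p n ∎
  where open ℕ.≤-Reasoning

ℓ-large : ∀ p n → 0 < p → 0 < n → Large p n (ℓ-of p n)
ℓ-large p n p>0 n>0 = begin
  D² * (4 * (ℓ + (n + ℓ))) ≤⟨ ℕ.*-monoʳ-≤ D² (ℕ.*-monoʳ-≤ 4 (ℕ.+-monoʳ-≤ ℓ (ℕ.+-monoˡ-≤ ℓ (n≤ℓ p n p>0 n>0)))) ⟩
  D² * (4 * (ℓ + (ℓ + ℓ))) ≤⟨ ℕ.m≤m+n _ (4 * ℓ + 1) ⟩
  D² * (4 * (ℓ + (ℓ + ℓ))) + (4 * ℓ + 1) ≡⟨ lemma D² ⟩
  (2 * ℓ + 1) * (2 * ℓ + 1) ∎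
  where
  open ℕ.≤-Reasoning
  D² = D-of p n * D-of p n
  ℓ  = 3 * D²
  lemma : ∀ d → d * (4 * (3 * d + (3 * d + 3 * d))) + (4 * (3 * d) + 1) ≡ (2 * (3 * d) + 1) * (2 * (3 * d) + 1)
  lemma = solve-∀

-- suc (pow r) = 2^r
pow : ℕ → ℕ
pow zero    = 0
pow (suc r) = pow r + suc (pow r + 0)

-- The chain lengths depend on the size of the preceding poset, which is itself built from them.
-- Computing the sizes numerically breaks this circle; `size-P` confirms them afterwards.
sizes : ℕ → ℕ
sizes zero    = 2
sizes (suc r) = let ℓ = ℓ-of (suc (pow r)) (sizes r); m = ℓ + (sizes r + ℓ) in m + m

lengths : ℕ → ℕ
lengths zero    = 1
lengths (suc r) = ℓ-of (suc (pow r)) (sizes r)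

size-P : ∀ r → size (P lengths r) ≡ sizes r
size-P zero    = refl
size-P (suc r) = cong (λ n → let m = lengths (suc r) + (n + lengths (suc r)) in m + m) (size-P r)

sizes-pos : ∀ r → 0 < sizes r
sizes-pos zero    = s≤s z≤n
sizes-pos (suc r) = let ℓ = ℓ-of (suc (pow r)) (sizes r) in
  ℕ.≤-trans (sizes-pos r) (ℕ.≤-trans (ℕ.m≤m+n (sizes r) ℓ)
      (ℕ.≤-trans (ℕ.m≤n+m (sizes r + ℓ) ℓ) (ℕ.m≤m+n (ℓ + (sizes r + ℓ)) _)))

lengths-pos : ∀ r → 0 < lengths r
lengths-pos zero    = s≤s z≤n
lengths-pos (suc r) = ℓ-pos (suc (pow r)) (sizes r) (s≤s z≤n) (sizes-pos r)

factor : ℕ → ℚ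
factor i = + (2 * m₁₊ lengths i + 1) / suc (m₁₊ lengths i)

-- Equivalent to m ≥ 1, which the positive chain lengths ensure.
3/2≤factor : ∀ i → + 3 / 2 ℚ.≤ factor i
3/2≤factor i = /-≤ 3 1 (2 * m + 1) m (begin
  3 * suc m ≡⟨ l₁ m ⟩
  3 * m + 2 + 1
    ≤⟨ ℕ.+-monoʳ-≤ (3 * m + 2) (ℕ.≤-trans (lengths-pos (suc i))
        (ℕ.m≤m+n (lengths (suc i)) (size (P lengths i) + lengths (suc i)))) ⟩
  3 * m + 2 + m ≡⟨ l₂ m ⟩
  (2 * m + 1) * 2 ∎)
  where
  open ℕ.≤-Reasoning
  m = m₁₊ lengths i
  l₁ : ∀ m → 3 * suc m ≡ 3 * m + 2 + 1
  l₁ = solve-∀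
  l₂ : ∀ m → 3 * m + 2 + m ≡ (2 * m + 1) * 2
  l₂ = solve-∀

*-mono-≤-nonNeg : ∀ {a b c d} → 0ℚ ℚ.≤ a → 0ℚ ℚ.≤ d → a ℚ.≤ b → c ℚ.≤ d → a ℚ.* c ℚ.≤ b ℚ.* d
*-mono-≤-nonNeg {a} {b} {c} {d} a≥0 d≥0 a≤b c≤d =
    ℚ.≤-trans (ℚ.*-monoˡ-≤-nonNeg a {{ℚ.nonNegative a≥0}} c≤d) (ℚ.*-monoʳ-≤-nonNeg d {{ℚ.nonNegative d≥0}} a≤b)

0≤1 : 0ℚ ℚ.≤ 1ℚ
0≤1 = ℚ.nonNegative⁻¹ 1ℚ

1≤3/2 : 1ℚ ℚ.≤ + 3 / 2
1≤3/2 = /-≤ 1 0 3 1 (s≤s (s≤s z≤n))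

1≤[3/2]^ : ∀ r → 1ℚ ℚ.≤ (+ 3 / 2) ^ r
1≤[3/2]^ zero    = ℚ.≤-refl
1≤[3/2]^ (suc r) = *-mono-≤-nonNeg {1ℚ} {+ 3 / 2} {1ℚ} 0≤1 (ℚ.≤-trans 0≤1 (1≤[3/2]^ r)) 1≤3/2 (1≤[3/2]^ r)

[3/2]^≤∏ : ∀ r → (+ 3 / 2) ^ r ℚ.≤ ∏< r factor
[3/2]^≤∏ zero    = ℚ.≤-refl
[3/2]^≤∏ (suc r) = ℚ.≤-trans (ℚ.≤-reflexive (ℚ.*-comm (+ 3 / 2) ((+ 3 / 2) ^ r)))
  (*-mono-≤-nonNeg (ℚ.≤-trans 0≤1 (1≤[3/2]^ r)) (ℚ.≤-trans 0≤1 (ℚ.≤-trans 1≤3/2 (3/2≤factor r))) ([3/2]^≤∏ r)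
      (3/2≤factor r))

1≤∏ : ∀ r → 1ℚ ℚ.≤ ∏< r factor
1≤∏ r = ℚ.≤-trans (1≤[3/2]^ r) ([3/2]^≤∏ r)

record Level (p′ : ℕ) (Q : FinPoset) (g : ℚ) : Set where
  no-eta-equality
  field
    enum    : Enumeration Q
    enum>0  : 0 < length (orderings enum)
    codes   : ∀ Y → Code (suc p′) enum Y
    profile : Profile Q g

open Level

-- A chain has a single ordering, so the empty code serves. With p = 1 the bound is 2 + c ≤ 3c for c
-- ≥ 1, an equality at c = 1.
level-zero : Level 0 (Chain 2) 1ℚ
level-zero = record
  { enum    = chain-enumeration 2
  ; enum>0  = s≤s z≤n
  ; codes   = λ Y → record
      { enc       = λ _ → []
      ; decodable = λ { (here refl) (here refl) eq → refl , eq }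
      ; bound     = trivial-bound (card Y)
      }
  ; profile = Chain-profile 1
  }
  where
  trivial-bound : ∀ c → 1 * slack 1 c ≤ 1 * (3 * 1 * c)
  trivial-bound zero    = z≤n
  trivial-bound (suc c) = ℕ.≤-trans (ℕ.m≤m+n (1 * (2 + suc c)) (2 * c)) (ℕ.≤-reflexive (lemma c))
    where
    lemma : ∀ c → 1 * (2 + suc c) + 2 * c ≡ 1 * (3 * 1 * suc c)
    lemma = solve-∀

module Next {p′ : ℕ} {Q : FinPoset} {g : ℚ} (lev : Level p′ Q g) (k : ℕ) where

  private
    ℓ : ℕ
    ℓ = suc k

  R : FinPoset
  R = Chain ℓ ⊕ Q ⊕ Chain ℓ

  ER : Enumeration R
  ER = Sandwich.enumeration (enum lev) ℓ

  ER>0 : 0 < length (orderings ER)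
  ER>0 = subst (0 <_) (sym (trans (cong length (Sandwich.orderings≡ (enum lev) ℓ))
      (length-map _ (orderings (enum lev)))))
    (enum>0 lev)

  E⊔>0 : 0 < length (orderings (⊔-enumeration ER ER))
  E⊔>0 = subst (0 <_) (sym (length-⊔ ER ER ER>0 ER>0)) (ℕ.*-mono-< (B-pos (size R) (size R)) (ℕ.*-mono-< ER>0 ER>0))

  R-profile : 1ℚ ℚ.≤ g → Profile R g
  R-profile 1≤g = Chain⊕-profile (⊕-enumeration (enum lev) (chain-enumeration ℓ))
    (subst (0 <_) (sym (length-⊕ (enum lev) (chain-enumeration ℓ) (enum>0 lev) (s≤s z≤n)))
        (ℕ.*-mono-< (enum>0 lev) (s≤s z≤n)))
    (⊕Chain-profile (enum lev) (enum>0 lev) (profile lev) 1≤g k) 1≤g ℓ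

  R⊔R-profile : 1ℚ ℚ.≤ g → Profile (R ⊔ᴾ R) (g ℚ.* (+ (2 * size R + 1) / suc (size R)))
  R⊔R-profile 1≤g = subst (Profile (R ⊔ᴾ R)) (ℚ.*-comm (+ (2 * size R + 1) / suc (size R)) g)
    (⊔-profile ER ER>0 (R-profile 1≤g) (ℚ.<-≤-trans (ℚ.positive⁻¹ 1ℚ) 1≤g))

  R⊔R-code : 0 < size Q → Large (suc p′) (size Q) ℓ → ∀ Y → Code (2 * suc p′) (⊔-enumeration ER ER) Y
  R⊔R-code N>0 large = Step.ForSubset.code p′ (enum lev) N>0 ℓ (s≤s z≤n) large (codes lev) ER
      (Sandwich.orderings≡ (enum lev) ℓ)

  level-suc : 0 < size Q → 1ℚ ℚ.≤ g → Large (suc p′) (size Q) ℓ →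
    Level (p′ + suc (p′ + 0)) (R ⊔ᴾ R) (g ℚ.* (+ (2 * size R + 1) / suc (size R)))
  level-suc N>0 1≤g large = record
    { enum    = ⊔-enumeration ER ER
    ; enum>0  = E⊔>0
    ; codes   = R⊔R-code N>0 large
    ; profile = R⊔R-profile 1≤g
    }

level : ∀ r → Level (pow r) (P lengths r) (∏< r factor)
level zero    = level-zero
-- The chain length is generalised to a positive ℓ so that it can be matched with `suc k`, the form
-- in which the chain above the copy is handled.
level (suc r) = go (lengths (suc r)) (lengths-pos (suc r))
  (subst (λ n → Large (suc (pow r)) n (lengths (suc r))) (sym (size-P r))
      (ℓ-large (suc (pow r)) (sizes r) (s≤s z≤n) (sizes-pos r)))
  where
  go : ∀ ℓ → 0 < ℓ → Large (suc (pow r)) (size (P lengths r)) ℓ → let R = Chain ℓ ⊕ P lengths r ⊕ Chain ℓ in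
    Level (pow (suc r)) (R ⊔ᴾ R) (∏< r factor ℚ.* (+ (2 * size R + 1) / suc (size R)))
  go (suc k) _ large = Next.level-suc (level r) k (subst (0 <_) (sym (size-P r)) (sizes-pos r)) (1≤∏ r) large

theorem6p1 : ∃ λ (L : ℕ → ℕ) →
    (∀ r → 1 ≤ r → 1 ≤ L r) ×
    (∀ r →
    let Π = ∏< r (λ i → + (2 * m₁₊ L i + 1) / suc (m₁₊ L i)) in
    (τ (P L r) <ᴿ fromℚ (+ 3 / 1)) ×
    (gap (P L r) ≡ Π) ×
    (Π ≥ (+ 3 / 2) ^ r))
theorem6p1 = lengths , (λ r _ → lengths-pos r) , λ r →
  τ<3 (pow r) (enum (level r)) (enum>0 (level r)) (codes (level r)) ,
  Profile.gap≡ (profile (level r)) ,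
  [3/2]^≤∏ r
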